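{- Let $n\ge 1$ be an integer and let $G$ be a connected planar graph which is cospectral with the friendship graph $F_n$. Then $G$ is isomorphic to $F_n$.
   Context: All graphs are finite, simple and undirected. The friendship graph $F_n$ ($n\ge 1$) is the graph with $2n+1$ vertices and $3n$ edges obtained from $n$ copies of the triangle $C_3$ by identifying one vertex of each copy into a single common vertex. Two graphs are cospectral if their $(0,1)$-adjacency matrices have the same multiset of eigenvalues. -}

module Defs where

open import Algebra.Bundles.Raw using (RawRing)
import Algebra.Definitions.RawMonoid as RawMonoidOps
open import Data.Bool using (Bool; true; false; if_then_else_; _∧_; not)
open import Data.Fin as Fin using (Fin; zero; suc; toℕ; punchIn; quotient)
import Data.Fin.Properties as Fin
open import Data.List using (List; foldr; length; map)
open import Data.Nat as ℕ using (ℕ; zero; suc)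
import Data.Nat.Properties as ℕ
open import Data.Product using (Σ; ∃; _×_; _,_; proj₁; proj₂)
open import Data.Rational as ℚ using (ℚ; 0ℚ; 1ℚ; ½)
import Data.Rational.Properties as ℚ
open import Data.Rational.Solver using (module +-*-Solver)
open import Function.Bundles using (_↔_; Inverse)
open import Level using (0ℓ)
open import Relation.Binary.Construct.Closure.ReflexiveTransitive using (Star)
open import Relation.Binary.PropositionalEquality
open import Relation.Nullary using (¬_; does)

------------------------------------------------------------------------
-- Real numbers: Cauchy sequences of rationals, up to _≈ℝ_

IsCauchy : (ℕ → ℚ) → Set
IsCauchy x = ∀ ε → 0ℚ ℚ.< ε →
  ∃ λ N → ∀ m n → N ℕ.≤ m → N ℕ.≤ n → ℚ.∣ x m ℚ.- x n ∣ ℚ.≤ ε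

record ℝ : Set where
  constructor mkℝ
  field
    seq    : ℕ → ℚ
    cauchy : IsCauchy seq

open ℝ public

infix 4 _≈ℝ_ _<ℝ_ _≤ℝ_

record _≈ℝ_ (x y : ℝ) : Set where
  constructor mk≈
  field
    close : ∀ ε → 0ℚ ℚ.< ε →
      ∃ λ N → ∀ n → N ℕ.≤ n → ℚ.∣ seq x n ℚ.- seq y n ∣ ℚ.≤ ε

open _≈ℝ_ public

_<ℝ_ : ℝ → ℝ → Set
x <ℝ y = ∃ λ ε → 0ℚ ℚ.< ε ×
  ∃ λ N → ∀ n → N ℕ.≤ n → seq x n ℚ.+ ε ℚ.≤ seq y n

_≤ℝ_ : ℝ → ℝ → Set
x ≤ℝ y = ¬ (y <ℝ x)

fromℚ : ℚ → ℝ
fromℚ q = mkℝ (λ _ → q) λ ε 0<ε → 0 , λ _ _ _ _ →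
  subst (ℚ._≤ ε) (cong ℚ.∣_∣ (sym (ℚ.+-inverseʳ q))) (ℚ.<⇒≤ 0<ε)

0ℝ 1ℝ : ℝ
0ℝ = fromℚ 0ℚ
1ℝ = fromℚ 1ℚ

private
  0<½ε : ∀ {ε} → 0ℚ ℚ.< ε → 0ℚ ℚ.< ½ ℚ.* ε
  0<½ε {ε} 0<ε = ℚ.positive⁻¹ (½ ℚ.* ε)
    {{ℚ.pos*pos⇒pos ½ ε {{ℚ.positive 0<ε}}}}

  halves : ∀ ε → ½ ℚ.* ε ℚ.+ ½ ℚ.* ε ≡ ε
  halves ε = trans (sym (ℚ.*-distribʳ-+ ε ½ ½)) (ℚ.*-identityˡ ε)

  +-cauchy : ∀ {x y} → IsCauchy x → IsCauchy y → IsCauchy (λ n → x n ℚ.+ y n)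
  +-cauchy {x} {y} cx cy ε 0<ε
    with cx (½ ℚ.* ε) (0<½ε 0<ε) | cy (½ ℚ.* ε) (0<½ε 0<ε)
  ... | M , hx | N , hy = M ℕ.⊔ N , λ m n p q → begin
      ℚ.∣ (x m ℚ.+ y m) ℚ.- (x n ℚ.+ y n) ∣
        ≡⟨ cong ℚ.∣_∣ (rearrange (x m) (y m) (x n) (y n)) ⟩
      ℚ.∣ (x m ℚ.- x n) ℚ.+ (y m ℚ.- y n) ∣
        ≤⟨ ℚ.∣p+q∣≤∣p∣+∣q∣ (x m ℚ.- x n) (y m ℚ.- y n) ⟩
      ℚ.∣ x m ℚ.- x n ∣ ℚ.+ ℚ.∣ y m ℚ.- y n ∣
        ≤⟨ ℚ.+-mono-≤
             (hx m n (ℕ.m⊔n≤o⇒m≤o M N p) (ℕ.m⊔n≤o⇒m≤o M N q))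
             (hy m n (ℕ.m⊔n≤o⇒n≤o M N p) (ℕ.m⊔n≤o⇒n≤o M N q)) ⟩
      ½ ℚ.* ε ℚ.+ ½ ℚ.* ε
        ≡⟨ halves ε ⟩
      ε ∎
    where
    open ℚ.≤-Reasoning
    rearrange : ∀ a b c d →
      (a ℚ.+ b) ℚ.- (c ℚ.+ d) ≡ (a ℚ.- c) ℚ.+ (b ℚ.- d)
    rearrange = solve 4 (λ a b c d →
      (a :+ b) :- (c :+ d) := (a :- c) :+ (b :- d)) refl
      where open +-*-Solver

  neg-cauchy : ∀ {x} → IsCauchy x → IsCauchy (λ n → ℚ.- x n)
  neg-cauchy {x} cx ε 0<ε with cx ε 0<ε
  ... | N , h = N , λ m n p q →
    subst (ℚ._≤ ε)
      (trans (sym (ℚ.∣-p∣≡∣p∣ (x m ℚ.- x n)))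
             (cong ℚ.∣_∣ (ℚ.neg-distrib-+ (x m) (ℚ.- x n))))
      (h m n p q)

  Bounded : (ℕ → ℚ) → Set
  Bounded x = ∃ λ B → 0ℚ ℚ.< B × ∃ λ N → ∀ n → N ℕ.≤ n → ℚ.∣ x n ∣ ℚ.≤ B

  bounded : ∀ {x} → IsCauchy x → Bounded x
  bounded {x} cx with cx 1ℚ (ℚ.positive⁻¹ 1ℚ)
  ... | N , h = 1ℚ ℚ.+ ℚ.∣ x N ∣
              , ℚ.+-mono-<-≤ (ℚ.positive⁻¹ 1ℚ) (ℚ.0≤∣p∣ (x N))
              , N , λ n p → begin
      ℚ.∣ x n ∣                         ≡⟨ cong ℚ.∣_∣ (split (x n) (x N)) ⟩
      ℚ.∣ (x n ℚ.- x N) ℚ.+ x N ∣       ≤⟨ ℚ.∣p+q∣≤∣p∣+∣q∣ (x n ℚ.- x N) (x N) ⟩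
      ℚ.∣ x n ℚ.- x N ∣ ℚ.+ ℚ.∣ x N ∣   ≤⟨ ℚ.+-monoˡ-≤ ℚ.∣ x N ∣ (h n N p ℕ.≤-refl) ⟩
      1ℚ ℚ.+ ℚ.∣ x N ∣                  ∎
    where
    open ℚ.≤-Reasoning
    split : ∀ a b → a ≡ (a ℚ.- b) ℚ.+ b
    split = solve 2 (λ a b → a := (a :- b) :+ b) refl
      where open +-*-Solver

  *-mono : ∀ {a b c d} → ℚ.∣ a ∣ ℚ.≤ b → 0ℚ ℚ.< b → ℚ.∣ c ∣ ℚ.≤ d →
           ℚ.∣ a ℚ.* c ∣ ℚ.≤ b ℚ.* d
  *-mono {a} {b} {c} {d} a≤b 0<b c≤d = begin
    ℚ.∣ a ℚ.* c ∣         ≡⟨ ℚ.∣p*q∣≡∣p∣*∣q∣ a c ⟩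
    ℚ.∣ a ∣ ℚ.* ℚ.∣ c ∣   ≤⟨ ℚ.*-monoʳ-≤-nonNeg ℚ.∣ c ∣ {{ℚ.∣-∣-nonNeg c}} a≤b ⟩
    b ℚ.* ℚ.∣ c ∣         ≤⟨ ℚ.*-monoˡ-≤-nonNeg b {{ℚ.nonNegative (ℚ.<⇒≤ 0<b)}} c≤d ⟩
    b ℚ.* d               ∎
    where open ℚ.≤-Reasoning

  divide : ∀ C ε → 0ℚ ℚ.< C → 0ℚ ℚ.< ε → ∃ λ δ → 0ℚ ℚ.< δ × C ℚ.* δ ≡ ε
  divide C ε 0<C 0<ε =
    1/C ℚ.* ε , ℚ.positive⁻¹ (1/C ℚ.* ε) {{δ-pos}} , C*δ≡ε
    where
    C-pos : ℚ.Positive C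
    C-pos = ℚ.positive 0<C
    C-nonZero : ℚ.NonZero C
    C-nonZero = ℚ.pos⇒nonZero C {{C-pos}}
    1/C : ℚ
    1/C = (ℚ.1/ C) {{C-nonZero}}
    δ-pos : ℚ.Positive (1/C ℚ.* ε)
    δ-pos = ℚ.pos*pos⇒pos 1/C {{ℚ.1/pos⇒pos C {{C-pos}}}} ε {{ℚ.positive 0<ε}}
    C*δ≡ε : C ℚ.* (1/C ℚ.* ε) ≡ ε
    C*δ≡ε = trans (sym (ℚ.*-assoc C 1/C ε))
      (trans (cong (ℚ._* ε) (ℚ.*-inverseʳ C {{C-nonZero}})) (ℚ.*-identityˡ ε))

  *-difference : ∀ a b c d →
    a ℚ.* b ℚ.- c ℚ.* d ≡ a ℚ.* (b ℚ.- d) ℚ.+ d ℚ.* (a ℚ.- c)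
  *-difference = solve 4 (λ a b c d →
    a :* b :- c :* d := a :* (b :- d) :+ d :* (a :- c)) refl
    where open +-*-Solver

  *-close : ∀ {a b c d A B δ} → 0ℚ ℚ.< A → 0ℚ ℚ.< B →
    ℚ.∣ a ∣ ℚ.≤ A → ℚ.∣ d ∣ ℚ.≤ B →
    ℚ.∣ a ℚ.- c ∣ ℚ.≤ δ → ℚ.∣ b ℚ.- d ∣ ℚ.≤ δ →
    ℚ.∣ a ℚ.* b ℚ.- c ℚ.* d ∣ ℚ.≤ (A ℚ.+ B) ℚ.* δ
  *-close {a} {b} {c} {d} {A} {B} {δ} 0<A 0<B a≤A d≤B ac bd = begin
    ℚ.∣ a ℚ.* b ℚ.- c ℚ.* d ∣
      ≡⟨ cong ℚ.∣_∣ (*-difference a b c d) ⟩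
    ℚ.∣ a ℚ.* (b ℚ.- d) ℚ.+ d ℚ.* (a ℚ.- c) ∣
      ≤⟨ ℚ.∣p+q∣≤∣p∣+∣q∣ (a ℚ.* (b ℚ.- d)) (d ℚ.* (a ℚ.- c)) ⟩
    ℚ.∣ a ℚ.* (b ℚ.- d) ∣ ℚ.+ ℚ.∣ d ℚ.* (a ℚ.- c) ∣
      ≤⟨ ℚ.+-mono-≤ (*-mono {a} {A} {b ℚ.- d} {δ} a≤A 0<A bd)
                    (*-mono {d} {B} {a ℚ.- c} {δ} d≤B 0<B ac) ⟩
    A ℚ.* δ ℚ.+ B ℚ.* δ
      ≡⟨ sym (ℚ.*-distribʳ-+ δ A B) ⟩
    (A ℚ.+ B) ℚ.* δ ∎
    where open ℚ.≤-Reasoning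

  *-cauchy : ∀ {x y} → IsCauchy x → IsCauchy y → IsCauchy (λ n → x n ℚ.* y n)
  *-cauchy {x} {y} cx cy ε 0<ε =
    from-bounds (bounded cx) (bounded cy)
    where
    Goal : Set
    Goal = ∃ λ N → ∀ m n → N ℕ.≤ m → N ℕ.≤ n →
      ℚ.∣ x m ℚ.* y m ℚ.- x n ℚ.* y n ∣ ℚ.≤ ε

    Tail : (ℕ → ℚ) → ℚ → Set
    Tail z δ = ∃ λ N → ∀ m n → N ℕ.≤ m → N ℕ.≤ n → ℚ.∣ z m ℚ.- z n ∣ ℚ.≤ δ

    from-tails : ∀ {A B K L δ} → 0ℚ ℚ.< A → 0ℚ ℚ.< B →
      (∀ n → K ℕ.≤ n → ℚ.∣ x n ∣ ℚ.≤ A) → (∀ n → L ℕ.≤ n → ℚ.∣ y n ∣ ℚ.≤ B) →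
      (A ℚ.+ B) ℚ.* δ ≡ ε → Tail x δ → Tail y δ → Goal
    from-tails {A} {B} {K} {L} {δ} 0<A 0<B bx by eq (M , hx) (N , hy) =
      (K ℕ.⊔ L) ℕ.⊔ (M ℕ.⊔ N) , λ m n p q →
      let
        p₁ = ℕ.m⊔n≤o⇒m≤o (K ℕ.⊔ L) (M ℕ.⊔ N) p
        p₂ = ℕ.m⊔n≤o⇒n≤o (K ℕ.⊔ L) (M ℕ.⊔ N) p
        q₁ = ℕ.m⊔n≤o⇒m≤o (K ℕ.⊔ L) (M ℕ.⊔ N) q
        q₂ = ℕ.m⊔n≤o⇒n≤o (K ℕ.⊔ L) (M ℕ.⊔ N) q
      in
      subst (ℚ.∣ x m ℚ.* y m ℚ.- x n ℚ.* y n ∣ ℚ.≤_) eq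
        (*-close {x m} {y m} {x n} {y n} {A} {B} {δ} 0<A 0<B
          (bx m (ℕ.m⊔n≤o⇒m≤o K L p₁)) (by n (ℕ.m⊔n≤o⇒n≤o K L q₁))
          (hx m n (ℕ.m⊔n≤o⇒m≤o M N p₂) (ℕ.m⊔n≤o⇒m≤o M N q₂))
          (hy m n (ℕ.m⊔n≤o⇒n≤o M N p₂) (ℕ.m⊔n≤o⇒n≤o M N q₂)))

    from-bounds : Bounded x → Bounded y → Goal
    from-bounds (A , 0<A , K , bx) (B , 0<B , L , by) =
      let δ , 0<δ , eq = divide (A ℚ.+ B) ε (ℚ.+-mono-< {0ℚ} {A} {0ℚ} {B} 0<A 0<B) 0<ε
      in from-tails {A} {B} {K} {L} {δ} 0<A 0<B bx by eq (cx δ 0<δ) (cy δ 0<δ)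

infixl 6 _+ℝ_ _-ℝ_
infixl 7 _*ℝ_

_+ℝ_ _*ℝ_ : ℝ → ℝ → ℝ
x +ℝ y = mkℝ (λ n → seq x n ℚ.+ seq y n)
  (+-cauchy {seq x} {seq y} (cauchy x) (cauchy y))
x *ℝ y = mkℝ (λ n → seq x n ℚ.* seq y n)
  (*-cauchy {seq x} {seq y} (cauchy x) (cauchy y))

negℝ : ℝ → ℝ
negℝ x = mkℝ (λ n → ℚ.- seq x n) (neg-cauchy {seq x} (cauchy x))

_-ℝ_ : ℝ → ℝ → ℝ
x -ℝ y = x +ℝ negℝ y

ℝ-rawRing : RawRing 0ℓ 0ℓ
ℝ-rawRing = record
  { Carrier = ℝ ; _≈_ = _≈ℝ_ ; _+_ = _+ℝ_ ; _*_ = _*ℝ_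
  ; -_ = negℝ ; 0# = 0ℝ ; 1# = 1ℝ }

------------------------------------------------------------------------
-- Determinants and spectra

module Determinant {c ℓ} (R : RawRing c ℓ) where
  open RawRing R
  open RawMonoidOps +-rawMonoid using (sum)

  Matrix : ℕ → Set c
  Matrix n = Fin n → Fin n → Carrier

  sign : ℕ → Carrier
  sign zero    = 1#
  sign (suc k) = - sign k

  -- Laplace expansion along the first row.
  det : ∀ {n} → Matrix n → Carrier
  det {zero}  M = 1#
  det {suc n} M = sum λ j →
    sign (toℕ j) * (M zero j * det λ i k → M (suc i) (punchIn j k))

  scalar : ∀ {n} → Carrier → Matrix n
  scalar x i j = if does (i Fin.≟ j) then x else 0#

open Determinant ℝ-rawRing

infixl 6 _-ᴹ_

_-ᴹ_ : ∀ {n} → Matrix n → Matrix n → Matrix n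
(M -ᴹ N) i j = M i j -ℝ N i j

-- The list λs enumerates, with multiplicity, the n eigenvalues of M: the
-- characteristic polynomial det (x I − M) is the product of the x − λ.  Both
-- sides are polynomial in x, so their agreement at every real x is their
-- equality as polynomials.
IsSpectrum : ∀ {n} → Matrix n → List ℝ → Set
IsSpectrum {n} M λs = length λs ≡ n ×
  (∀ x → det (scalar x -ᴹ M) ≈ℝ foldr _*ℝ_ 1ℝ (map (λ μ → x -ℝ μ) λs))

------------------------------------------------------------------------
-- Finite simple graphs

record Graph : Set where
  field
    order       : ℕ
    adj         : Fin order → Fin order → Bool
    symmetric   : ∀ u v → adj u v ≡ adj v u
    irreflexive : ∀ u → adj u u ≡ false

  Vertex : Set
  Vertex = Fin order

  Adj : Vertex → Vertex → Set
  Adj u v = adj u v ≡ true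

  -- An edge is listed once, from its smaller to its larger end.
  record Edge : Set where
    constructor mkEdge
    field
      src tgt   : Vertex
      .ordered  : src Fin.< tgt
      .adjacent : Adj src tgt

  open Edge public

  adjacencyMatrix : Matrix order
  adjacencyMatrix u v = if adj u v then 1ℝ else 0ℝ

open Graph

Connected : Graph → Set
Connected G = ∀ u v → Star (Adj G) u v

-- A common enumeration exists exactly when the two multisets are equal:
-- IsSpectrum is invariant under reordering and under _≈ℝ_ of the entries.
-- Adjacency matrices are real symmetric, so all their eigenvalues are real.
Cospectral : Graph → Graph → Set
Cospectral G H = ∃ λ λs →
  IsSpectrum (adjacencyMatrix G) λs × IsSpectrum (adjacencyMatrix H) λs

infix 4 _≅_

record _≅_ (G H : Graph) : Set where
  field
    bijection : Vertex G ↔ Vertex H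
    preserves : ∀ u v →
      adj G u v ≡ adj H (Inverse.to bijection u) (Inverse.to bijection v)

-- Vertex zero is the common vertex; the vertices suc i and suc j belong to the
-- same triangle when i and j have the same quotient by 2.
friendshipGraph : ℕ → Graph
friendshipGraph n = record
  { order       = suc (n ℕ.* 2)
  ; adj         = adjF
  ; symmetric   = sym-adjF
  ; irreflexive = irr-adjF
  }
  where
  adjF : Fin (suc (n ℕ.* 2)) → Fin (suc (n ℕ.* 2)) → Bool
  adjF zero    zero    = false
  adjF zero    (suc j) = true
  adjF (suc i) zero    = true
  adjF (suc i) (suc j) =
    does (quotient {n} 2 i Fin.≟ quotient {n} 2 j) ∧ not (does (i Fin.≟ j))

  ≟-sym : ∀ {m} (i j : Fin m) → does (i Fin.≟ j) ≡ does (j Fin.≟ i)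
  ≟-sym zero    zero    = refl
  ≟-sym zero    (suc j) = refl
  ≟-sym (suc i) zero    = refl
  ≟-sym (suc i) (suc j) = ≟-sym i j

  ≟-refl : ∀ {m} (i : Fin m) → does (i Fin.≟ i) ≡ true
  ≟-refl zero    = refl
  ≟-refl (suc i) = ≟-refl i

  sym-adjF : ∀ u v → adjF u v ≡ adjF v u
  sym-adjF zero    zero    = refl
  sym-adjF zero    (suc j) = refl
  sym-adjF (suc i) zero    = refl
  sym-adjF (suc i) (suc j) = cong₂ (λ a b → a ∧ not b)
    (≟-sym (quotient {n} 2 i) (quotient {n} 2 j)) (≟-sym i j)

  irr-adjF : ∀ u → adjF u u ≡ false
  irr-adjF zero    = refl
  irr-adjF (suc i) = cong₂ (λ a b → a ∧ not b)
    (≟-refl (quotient {n} 2 i)) (≟-refl i)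

------------------------------------------------------------------------
-- Planarity

ℝ² : Set
ℝ² = ℝ × ℝ

infix 4 _≈ℝ²_

_≈ℝ²_ : ℝ² → ℝ² → Set
(x , y) ≈ℝ² (x′ , y′) = x ≈ℝ x′ × y ≈ℝ y′

Within : ℚ → ℝ → ℝ → Set
Within ε x y = x <ℝ y +ℝ fromℚ ε × y <ℝ x +ℝ fromℚ ε

Within² : ℚ → ℝ² → ℝ² → Set
Within² ε (x , y) (x′ , y′) = Within ε x x′ × Within ε y y′

InUnit InOpenUnit : ℝ → Set
InUnit     t = 0ℝ ≤ℝ t × t ≤ℝ 1ℝ
InOpenUnit t = 0ℝ <ℝ t × t <ℝ 1ℝ

-- A simple arc in the plane: an injective continuous image of [0,1].  Only
-- the values of γ on [0,1] matter.
record IsArc (γ : ℝ → ℝ²) : Set where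
  field
    continuous : ∀ s → InUnit s → ∀ ε → 0ℚ ℚ.< ε →
      ∃ λ δ → 0ℚ ℚ.< δ ×
      (∀ t → InUnit t → Within δ s t → Within² ε (γ s) (γ t))
    injective  : ∀ s t → InUnit s → InUnit t → γ s ≈ℝ² γ t → s ≈ℝ t

record PlaneEmbedding (G : Graph) : Set where
  field
    point  : Vertex G → ℝ²
    curve  : Edge G → ℝ → ℝ²

    point-injective : ∀ u v → point u ≈ℝ² point v → u ≡ v
    curve-arc       : ∀ e → IsArc (curve e)
    curve-src       : ∀ e → curve e 0ℝ ≈ℝ² point (src e)
    curve-tgt       : ∀ e → curve e 1ℝ ≈ℝ² point (tgt e)

    -- The interior of an edge contains no vertex and no point of another edge.
    avoids-vertices : ∀ e s v → InOpenUnit s → ¬ (curve e s ≈ℝ² point v)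
    avoids-edges    : ∀ e e′ s t → e ≢ e′ → InOpenUnit s → InUnit t →
                      ¬ (curve e s ≈ℝ² curve e′ t)

Planar : Graph → Set
Planar = PlaneEmbedding

{-# OPTIONS --safe #-}

-- Planarity is not needed.  A graph G cospectral with the friendship graph has
-- 2n + 1 vertices and 3n edges, and A = A(G) satisfies (A² − 1)(A² − A − 2n) = 0;
-- for n ≥ 2 the matrix B = A² − 1 is therefore positive semidefinite, and it has
-- rank 2.  Its diagonal entries are the deg j − 1 and its other entries count
-- common neighbours, so connectedness excludes vertices of degree 1, and a vertex
-- i of degree 2 exists because the average degree is below 3.  Put e = δ i; the
-- images of e and A e under B span the range of B, which determines the degree of
-- every vertex j from (B e) j and (B A e) j.  Counting common neighbours of the two
-- neighbours u, v of i then leaves two possibilities.  If u and v are adjacent, one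
-- of them has degree 2n and every other vertex has degree 2, so G is the friendship
-- graph.  Otherwise u and v have degree 2; if this happened at every vertex of
-- degree 2, then by connectedness G would be a cycle, with too few edges.
--
-- All this takes place over ℤ.  The determinants enter only through their values
-- at rational points: Cramer's rule shows that a power of (A² − 1)(A² − A − 2n)
-- maps every vector into the image of x − A for every integer x, and x − A is
-- expanding for large x; and det (1 − y A) modulo y³ gives the number of edges.
module Submission where

open import Defs
open import Algebra.Bundles.Raw using (RawRing)
import Algebra.Definitions.RawMonoid as RawMonoidOps
open import Data.Bool using (Bool; true; false; if_then_else_)
open import Data.Empty using (⊥; ⊥-elim)
open import Data.Fin using (Fin; zero; suc; toℕ; fromℕ<; punchIn) renaming (_≟_ to _≟ᶠ_)
open import Data.Fin.Permutation
  using (Permutation; Permutation′; _⟨$⟩ʳ_; _⟨$⟩ˡ_; transpose; lift₀; flip; _∘ₚ_; inverseʳ; inverseˡ)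
  renaming (id to idₚ)
open import Data.Fin.Properties as Fin using (any?; all?; ¬∀⟶∃¬; toℕ-fromℕ<)
open import Data.Integer as ℤᵇ
  using (ℤ; 0ℤ; 1ℤ; -1ℤ; _+_; _*_; _-_; -_; _^_; ∣_∣; _≤_; +-*-rawRing)
  renaming (+_ to pos)
import Data.Integer.Properties as ℤ
open import Data.Integer.Tactic.RingSolver using (solve-∀)
open import Data.List using (List; []; _∷_; foldr; map)
open import Data.Nat as ℕ using (ℕ; zero; suc; _≥_)
import Data.Nat.Properties as ℕ
open import Data.Product using (∃; _×_; _,_; proj₁; proj₂)
open import Data.Rational as ℚ using (ℚ; 0ℚ; 1ℚ; ½)
open import Data.Rational.Literals using (fromℤ)
import Data.Rational.Properties as ℚ
open import Data.Rational.Solver using (module +-*-Solver)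
import Data.Rational.Unnormalised as ℚᵘ
import Data.Rational.Unnormalised.Properties as ℚᵘ
open import Data.Sum using (_⊎_; inj₁; inj₂; [_,_]′)
open import Data.Vec using (Vec; []; _∷_; replicate)
open import Function using (_∘_; id)
open import Relation.Binary.Construct.Closure.ReflexiveTransitive using (Star; _◅_) renaming (ε to nil)
open import Relation.Binary.PropositionalEquality
open import Relation.Nullary using (¬_; Dec; does; yes; no)
open import Relation.Nullary.Decidable using (from-yes; _→-dec_; _⊎-dec_)

open import Algebra.Properties.AbelianGroup ℤ.+-0-abelianGroup using () renaming (∙-cancelˡ to +-cancelˡ)
open import Algebra.Properties.Semiring.Sum ℤ.+-*-semiring
  using (sum; sum-cong-≗; ∑-distrib-+; ∑-comm; *-distribˡ-sum; sum-permute)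

open ≡-Reasoning

-- Determinants over ℤ

-- The nontrivial eigenvalues are the roots of x² - x - 2n, in general irrational, and equality of
-- Cauchy reals is not decidable; so no eigenvector is ever formed. Rank two is expressed instead by
-- the equality case of Bessel's inequality: the squared components of all the δ j along e and along
-- q = A e - τ e, taken for the form of B, add up to the trace of B, which the number of edges
-- determines. Every vertex then satisfies an equation between integers. A vertex of degree 2 is the
-- convenient start because B gives it norm 1, so that orthogonalising against it needs no division.
--
-- The case n = 1 stands apart: -1 is then a root of both factors and B has smaller rank, but the
-- number of edges alone settles it.
--
-- The equations at the two neighbours of i have sporadic integer solutions with n = 4 and n = 6.
-- There 8s or 12s must be a square for s = deg j - 1 at every vertex j adjacent to neither
-- neighbour, which makes these degrees too large for the number of edges.
--
-- Determinants are iterated contractions of a top form, because multilinearity and alternation, the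
-- sources of Cramer's rule, are laborious to read off a Laplace expansion.

Row : ℕ → Set
Row n = Fin n → ℤ

δ : ∀ {n} → Fin n → Fin n → ℤ
δ i j = if does (i ≟ᶠ j) then 1ℤ else 0ℤ

sum-0 : ∀ {n} (f : Row n) → (∀ i → f i ≡ 0ℤ) → sum f ≡ 0ℤ
sum-0 {zero}  f z = refl
sum-0 {suc n} f z = cong₂ _+_ (z zero) (sum-0 (f ∘ suc) (z ∘ suc))

sum-lin : ∀ {n} k (f g : Row n) → sum (λ i → k * f i + g i) ≡ k * sum f + sum g
sum-lin k f g = trans (∑-distrib-+ (λ i → k * f i) g) (cong (_+ sum g) (sym (*-distribˡ-sum k f)))

sum-δ : ∀ {n} (i : Fin n) (f : Row n) → sum (λ j → δ i j * f j) ≡ f i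
sum-δ zero f = trans (cong₂ _+_ (ℤ.*-identityˡ (f zero)) (sum-0 (λ j → 0ℤ * f (suc j)) (λ _ → refl)))
  (ℤ.+-identityʳ (f zero))
sum-δ (suc i) f = trans (ℤ.+-identityˡ _) (sum-δ i (f ∘ suc))

δ-sym : ∀ {n} (i j : Fin n) → δ i j ≡ δ j i
δ-sym zero    zero    = refl
δ-sym zero    (suc j) = refl
δ-sym (suc i) zero    = refl
δ-sym (suc i) (suc j) = δ-sym i j

sum-δʳ : ∀ {n} (i : Fin n) (f : Row n) → sum (λ j → f j * δ j i) ≡ f i
sum-δʳ i f = trans (sum-cong-≗ λ j → trans (ℤ.*-comm (f j) (δ j i)) (cong (_* f j) (δ-sym j i))) (sum-δ i f)

-- The exterior algebra on n generators: coefficient functions on the subsets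
-- of the generators.
Λ : ℕ → Set
Λ n = Vec Bool n → ℤ

-- The interior product by `r`. Writing ω = e₀ ∧ α + β, it is r₀ α - e₀ ∧ (r contracted into α) + (r
-- contracted into β); the minus sign comes from passing e₀.
contract : ∀ {n} → Row n → Λ n → Λ n
contract r ω []          = 0ℤ
contract r ω (false ∷ S) = r zero * ω (true ∷ S) + contract (r ∘ suc) (ω ∘ (false ∷_)) S
contract r ω (true ∷ S)  = - contract (r ∘ suc) (ω ∘ (true ∷_)) S

contract-cong : ∀ {n} {r s : Row n} {ω η : Λ n} → r ≗ s → ω ≗ η → contract r ω ≗ contract s η
contract-cong e f []          = refl
contract-cong e f (false ∷ S) =
  cong₂ _+_ (cong₂ _*_ (e zero) (f (true ∷ S))) (contract-cong (e ∘ suc) (f ∘ (false ∷_)) S)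
contract-cong e f (true ∷ S)  = cong -_ (contract-cong (e ∘ suc) (f ∘ (true ∷_)) S)

contract-lin : ∀ {n} (r : Row n) k (ω η : Λ n) S →
  contract r (λ T → k * ω T + η T) S ≡ k * contract r ω S + contract r η S
contract-lin r k ω η [] = zero-eq k
  where
  zero-eq : ∀ k → 0ℤ ≡ k * 0ℤ + 0ℤ
  zero-eq = solve-∀
contract-lin r k ω η (false ∷ S)
  rewrite contract-lin (r ∘ suc) k (ω ∘ (false ∷_)) (η ∘ (false ∷_)) S =
  eq (r zero) k (ω (true ∷ S)) (η (true ∷ S)) _ _
  where
  eq : ∀ r k a b c d → r * (k * a + b) + (k * c + d) ≡ k * (r * a + c) + (r * b + d)
  eq = solve-∀
contract-lin r k ω η (true ∷ S)
  rewrite contract-lin (r ∘ suc) k (ω ∘ (true ∷_)) (η ∘ (true ∷_)) S = eq k _ _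
  where
  eq : ∀ k c d → - (k * c + d) ≡ k * - c + - d
  eq = solve-∀

contract-row-lin : ∀ {n} k (r s : Row n) (ω : Λ n) S →
  contract (λ j → k * r j + s j) ω S ≡ k * contract r ω S + contract s ω S
contract-row-lin k r s ω [] = zero-eq k
  where
  zero-eq : ∀ k → 0ℤ ≡ k * 0ℤ + 0ℤ
  zero-eq = solve-∀
contract-row-lin k r s ω (false ∷ S)
  rewrite contract-row-lin k (r ∘ suc) (s ∘ suc) (ω ∘ (false ∷_)) S =
  eq (r zero) (s zero) k (ω (true ∷ S)) _ _
  where
  eq : ∀ r s k a c d → (k * r + s) * a + (k * c + d) ≡ k * (r * a + c) + (s * a + d)
  eq = solve-∀
contract-row-lin k r s ω (true ∷ S)
  rewrite contract-row-lin k (r ∘ suc) (s ∘ suc) (ω ∘ (true ∷_)) S = eq k _ _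
  where
  eq : ∀ k c d → - (k * c + d) ≡ k * - c + - d
  eq = solve-∀

contract-neg : ∀ {n} (r : Row n) (ω : Λ n) S → contract r (λ T → - ω T) S ≡ - contract r ω S
contract-neg r ω [] = refl
contract-neg r ω (false ∷ S) rewrite contract-neg (r ∘ suc) (ω ∘ (false ∷_)) S =
  eq (r zero) (ω (true ∷ S)) _
  where
  eq : ∀ r a b → r * - a + - b ≡ - (r * a + b)
  eq = solve-∀
contract-neg r ω (true ∷ S) = cong -_ (contract-neg (r ∘ suc) (ω ∘ (true ∷_)) S)

contract-0 : ∀ {n} (r : Row n) S → contract r (λ _ → 0ℤ) S ≡ 0ℤ
contract-0 r []          = refl
contract-0 r (false ∷ S) rewrite contract-0 (r ∘ suc) S = eq (r zero)
  where
  eq : ∀ r → r * 0ℤ + 0ℤ ≡ 0ℤ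
  eq = solve-∀
contract-0 r (true ∷ S)  rewrite contract-0 (r ∘ suc) S = refl

contract-row-0 : ∀ {n} {r : Row n} → (∀ j → r j ≡ 0ℤ) → ∀ ω S → contract r ω S ≡ 0ℤ
contract-row-0 z ω [] = refl
contract-row-0 z ω (false ∷ S)
  rewrite z zero | contract-row-0 (z ∘ suc) (ω ∘ (false ∷_)) S = refl
contract-row-0 z ω (true ∷ S)
  rewrite contract-row-0 (z ∘ suc) (ω ∘ (true ∷_)) S = refl

contract-anticomm : ∀ {n} (r s : Row n) (ω : Λ n) S →
  contract r (contract s ω) S ≡ - contract s (contract r ω) S
contract-anticomm r s ω [] = refl
contract-anticomm r s ω (false ∷ S)
  rewrite contract-lin (r ∘ suc) (s zero) (ω ∘ (true ∷_)) (contract (s ∘ suc) (ω ∘ (false ∷_))) S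
        | contract-lin (s ∘ suc) (r zero) (ω ∘ (true ∷_)) (contract (r ∘ suc) (ω ∘ (false ∷_))) S
        | contract-anticomm (r ∘ suc) (s ∘ suc) (ω ∘ (false ∷_)) S = eq (r zero) (s zero) _ _ _
  where
  eq : ∀ r s a b c → r * - a + (s * b + - c) ≡ - (s * - b + (r * a + c))
  eq = solve-∀
contract-anticomm r s ω (true ∷ S) =
  cong -_ (trans (contract-neg (r ∘ suc) _ S)
    (trans (cong -_ (contract-anticomm (r ∘ suc) (s ∘ suc) (ω ∘ (true ∷_)) S))
           (cong -_ (sym (contract-neg (s ∘ suc) _ S)))))

contract-square : ∀ {n} (r : Row n) (ω : Λ n) S → contract r (contract r ω) S ≡ 0ℤ
contract-square r ω [] = refl
contract-square r ω (false ∷ S)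
  rewrite contract-lin (r ∘ suc) (r zero) (ω ∘ (true ∷_)) (contract (r ∘ suc) (ω ∘ (false ∷_))) S
        | contract-square (r ∘ suc) (ω ∘ (false ∷_)) S = eq (r zero) _
  where
  eq : ∀ r a → r * - a + (r * a + 0ℤ) ≡ 0ℤ
  eq = solve-∀
contract-square r ω (true ∷ S) =
  trans (cong -_ (contract-neg (r ∘ suc) _ S))
    (cong (λ x → - - x) (contract-square (r ∘ suc) (ω ∘ (true ∷_)) S))

Rows : ℕ → ℕ → Set
Rows m n = Fin m → Row n

contracts : ∀ {m n} → Rows m n → Λ n → Λ n
contracts {zero}  R ω = ω
contracts {suc m} R ω = contracts (R ∘ suc) (contract (R zero) ω)

contracts-cong : ∀ {m n} {R R′ : Rows m n} {ω η : Λ n} →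
  (∀ i j → R i j ≡ R′ i j) → ω ≗ η → contracts R ω ≗ contracts R′ η
contracts-cong {zero}  e f = f
contracts-cong {suc m} e f = contracts-cong (e ∘ suc) (contract-cong (e zero) f)

contracts-lin : ∀ {m n} (R : Rows m n) k (ω η : Λ n) S →
  contracts R (λ T → k * ω T + η T) S ≡ k * contracts R ω S + contracts R η S
contracts-lin {zero}  R k ω η S = refl
contracts-lin {suc m} R k ω η S =
  trans (contracts-cong {R = R ∘ suc} (λ _ _ → refl) (contract-lin (R zero) k ω η) S)
        (contracts-lin (R ∘ suc) k _ _ S)

contracts-0 : ∀ {m n} (R : Rows m n) {ω : Λ n} → (∀ S → ω S ≡ 0ℤ) → ∀ S → contracts R ω S ≡ 0ℤ
contracts-0 {zero}  R z = z
contracts-0 {suc m} R z = contracts-0 (R ∘ suc)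
  λ S → trans (contract-cong {r = R zero} (λ _ → refl) z S) (contract-0 (R zero) S)

contracts-neg : ∀ {m n} (R : Rows m n) (ω : Λ n) S →
  contracts R (λ T → - ω T) S ≡ - contracts R ω S
contracts-neg {zero}  R ω S = refl
contracts-neg {suc m} R ω S =
  trans (contracts-cong {R = R ∘ suc} (λ _ _ → refl) (contract-neg (R zero) ω) S)
        (contracts-neg (R ∘ suc) _ S)

contracts-sum : ∀ {l m n} (R : Rows m n) (k : Row l) (ω : Fin l → Λ n) S →
  contracts R (λ T → sum λ j → k j * ω j T) S ≡ sum λ j → k j * contracts R (ω j) S
contracts-sum {zero}  R k ω S = contracts-0 R (λ _ → refl) S
contracts-sum {suc l} R k ω S =
  trans (contracts-lin R (k zero) (ω zero) _ S)
        (cong (k zero * contracts R (ω zero) S +_) (contracts-sum R (k ∘ suc) (ω ∘ suc) S))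

-- Anticommutativity carries the contraction by `s` past the earlier rows until it meets the row
-- equal to it, where the square vanishes.
contracts-hit : ∀ {m n} (R : Rows m n) i {s} → s ≗ R i → ∀ ω S → contracts R (contract s ω) S ≡ 0ℤ
contracts-hit R zero e ω = contracts-0 (R ∘ suc) λ S →
  trans (contract-cong {r = R zero} (λ _ → refl) (contract-cong {ω = ω} e (λ _ → refl)) S)
        (contract-square (R zero) ω S)
contracts-hit R (suc i) {s} e ω S =
  trans (contracts-cong {R = R ∘ suc} (λ _ _ → refl) (contract-anticomm (R zero) s ω) S)
  (trans (contracts-neg (R ∘ suc) _ S)
         (cong -_ (contracts-hit (R ∘ suc) i e (contract (R zero) ω) S)))

contracts-repeat : ∀ {m n} (R : Rows m n) i k → i ≢ k → R i ≗ R k → ∀ ω S → contracts R ω S ≡ 0ℤ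
contracts-repeat R zero    zero    i≢k e ω = ⊥-elim (i≢k refl)
contracts-repeat R zero    (suc k) i≢k e ω = contracts-hit (R ∘ suc) k e ω
contracts-repeat R (suc i) zero    i≢k e ω = contracts-hit (R ∘ suc) i (sym ∘ e) ω
contracts-repeat R (suc i) (suc k) i≢k e ω =
  contracts-repeat (R ∘ suc) i k (i≢k ∘ cong suc) e (contract (R zero) ω)

replace : ∀ {m n} → Fin m → Row n → Rows m n → Rows m n
replace zero    v R zero    = v
replace zero    v R (suc i) = R (suc i)
replace (suc k) v R zero    = R zero
replace (suc k) v R (suc i) = replace k v (R ∘ suc) i

replace-eq : ∀ {m n} k (v : Row n) (R : Rows m n) → replace k v R k ≡ v
replace-eq zero    v R = refl
replace-eq (suc k) v R = replace-eq k v (R ∘ suc)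

replace-neq : ∀ {m n} k i (v : Row n) (R : Rows m n) → k ≢ i → replace k v R i ≡ R i
replace-neq zero    zero    v R k≢i = ⊥-elim (k≢i refl)
replace-neq zero    (suc i) v R k≢i = refl
replace-neq (suc k) zero    v R k≢i = refl
replace-neq (suc k) (suc i) v R k≢i = replace-neq k i v (R ∘ suc) (k≢i ∘ cong suc)

replace-cong : ∀ {m n} k {v w : Row n} {R R′ : Rows m n} → v ≗ w → (∀ i j → R i j ≡ R′ i j) →
  ∀ i j → replace k v R i j ≡ replace k w R′ i j
replace-cong zero    e f zero    = e
replace-cong zero    e f (suc i) = f (suc i)
replace-cong (suc k) e f zero    = f zero
replace-cong (suc k) e f (suc i) = replace-cong k e (f ∘ suc) i

replace-self : ∀ {m n} k (R : Rows m n) i j → replace k (R k) R i j ≡ R i j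
replace-self zero    R zero    j = refl
replace-self zero    R (suc i) j = refl
replace-self (suc k) R zero    j = refl
replace-self (suc k) R (suc i) j = replace-self k (R ∘ suc) i j

contracts-replace-lin : ∀ {m n} k a (v w : Row n) (R : Rows m n) ω S →
  contracts (replace k (λ j → a * v j + w j) R) ω S
    ≡ a * contracts (replace k v R) ω S + contracts (replace k w R) ω S
contracts-replace-lin zero a v w R ω S =
  trans (contracts-cong {R = R ∘ suc} (λ _ _ → refl) (contract-row-lin a v w ω) S)
        (contracts-lin (R ∘ suc) a _ _ S)
contracts-replace-lin (suc k) a v w R ω S =
  contracts-replace-lin k a v w (R ∘ suc) (contract (R zero) ω) S

contracts-replace-0 : ∀ {m n} k {v : Row n} (R : Rows m n) → (∀ j → v j ≡ 0ℤ) →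
  ∀ ω S → contracts (replace k v R) ω S ≡ 0ℤ
contracts-replace-0 zero    R z ω = contracts-0 (R ∘ suc) (contract-row-0 z ω)
contracts-replace-0 (suc k) R z ω = contracts-replace-0 k (R ∘ suc) z (contract (R zero) ω)

contracts-replace-sum : ∀ {l m n} k (a : Row l) (v : Fin l → Row n) (R : Rows m n) ω S →
  contracts (replace k (λ j → sum λ i → a i * v i j) R) ω S
    ≡ sum λ i → a i * contracts (replace k (v i) R) ω S
contracts-replace-sum {zero}  k a v R ω S = contracts-replace-0 k R (λ _ → refl) ω S
contracts-replace-sum {suc l} k a v R ω S =
  trans (contracts-replace-lin k (a zero) (v zero) _ R ω S)
        (cong (a zero * contracts (replace k (v zero) R) ω S +_)
          (contracts-replace-sum k (a ∘ suc) (v ∘ suc) R ω S))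

top : ∀ {n} → Λ n
top []          = 1ℤ
top (false ∷ S) = 0ℤ
top (true ∷ S)  = top S

∅ : ∀ {n} → Vec Bool n
∅ = replicate _ false

-- The rows are contracted into e₀ ∧ ... ∧ eₙ₋₁ one after the other, the first row first. With this
-- order the signs agree with the expansion along the first row.
det : ∀ {n} → Rows n n → ℤ
det R = contracts R top ∅

det-cong : ∀ {n} {R R′ : Rows n n} → (∀ i j → R i j ≡ R′ i j) → det R ≡ det R′
det-cong e = contracts-cong e (λ _ → refl) ∅

-- By linearity in row k only the term i = k survives: every other replacement produces two equal
-- rows.
det-replace : ∀ {n} k (v : Row n) (R : Rows n n) →
  det (replace k (λ j → sum λ i → v i * R i j) R) ≡ v k * det R
det-replace k v R = begin
  det (replace k (λ j → sum λ i → v i * R i j) R)  ≡⟨ contracts-replace-sum k v R R top ∅ ⟩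
  sum (λ i → v i * det (replace k (R i) R))        ≡⟨ sum-cong-≗ term ⟩
  sum (λ i → δ k i * (v i * det R))                ≡⟨ sum-δ k (λ i → v i * det R) ⟩
  v k * det R                                      ∎
  where
  term : ∀ i → v i * det (replace k (R i) R) ≡ δ k i * (v i * det R)
  term i with k ≟ᶠ i
  ... | yes refl = trans (cong (v i *_) (det-cong (replace-self k R))) (sym (ℤ.*-identityˡ _))
  ... | no  k≢i  = trans (cong (v i *_) (contracts-repeat (replace k (R i) R) k i k≢i
      (λ j → trans (cong (λ w → w j) (replace-eq k (R i) R))
                   (cong (λ w → w j) (sym (replace-neq k i (R i) R k≢i)))) top ∅))
      (ℤ.*-zeroʳ (v i))

-- `C k j` is the cofactor at (k, j), written as the determinant with row k replaced by a unit row,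
-- so `u` is the adjugate applied to v. Pairing row i with the cofactors of row k puts row i in
-- place of row k, which `det-replace` evaluates.
cramer : ∀ {n} (R : Rows n n) (v : Row n) →
  ∃ λ u → ∀ i → sum (λ j → R i j * u j) ≡ det R * v i
cramer {n} R v = u , λ i → begin
  sum (λ j → R i j * u j)
    ≡⟨ sum-cong-≗ (λ j → *-distribˡ-sum (R i j) λ k → v k * C k j) ⟩
  sum (λ j → sum λ k → R i j * (v k * det (replace k (δ j) R)))
    ≡⟨ ∑-comm (λ j k → R i j * (v k * C k j)) ⟩
  sum (λ k → sum λ j → R i j * (v k * det (replace k (δ j) R)))
    ≡⟨ sum-cong-≗ (λ k → trans (sum-cong-≗ λ j → swap (R i j) (v k) (C k j))
         (sym (*-distribˡ-sum (v k) λ j → R i j * C k j))) ⟩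
  sum (λ k → v k * sum λ j → R i j * det (replace k (δ j) R))
    ≡⟨ sum-cong-≗ (λ k → cong (v k *_) (row i k)) ⟩
  sum (λ k → v k * (δ i k * det R))
    ≡⟨ sum-cong-≗ (λ k → rot (v k) (δ i k) (det R)) ⟩
  sum (λ k → δ i k * (det R * v k))
    ≡⟨ sum-δ i (λ k → det R * v k) ⟩
  det R * v i ∎
  where
  C : Fin n → Fin n → ℤ
  C k j = det (replace k (δ j) R)
  u : Row n
  u j = sum λ k → v k * C k j
  swap : ∀ a b c → a * (b * c) ≡ b * (a * c)
  swap = solve-∀
  rot : ∀ a b c → a * (b * c) ≡ b * (c * a)
  rot = solve-∀
  unit : ∀ i k → sum (λ l → δ i l * R l k) ≡ R i k
  unit i k = sum-δ i (λ l → R l k)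
  row : ∀ i k → sum (λ j → R i j * det (replace k (δ j) R)) ≡ δ i k * det R
  row i k = begin
    sum (λ j → R i j * det (replace k (δ j) R))
      ≡⟨ sym (contracts-replace-sum k (R i) δ R top ∅) ⟩
    det (replace k (λ l → sum λ j → R i j * δ j l) R)
      ≡⟨ det-cong (replace-cong k (λ l → trans
           (sum-δʳ l (R i))
           (sym (unit i l))) (λ _ _ → refl)) ⟩
    det (replace k (λ l → sum λ j → δ i j * R j l) R)
      ≡⟨ det-replace k (δ i) R ⟩
    δ i k * det R ∎

-- Expansion along the first row and the first column simultaneously.
det-bordered : ∀ {n} (M : Rows (suc n) (suc n)) → det M ≡
  M zero zero * det (λ i j → M (suc i) (suc j))
    - sum λ i → M (suc i) zero * det (replace i (M zero ∘ suc) (λ i j → M (suc i) (suc j)))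
det-bordered {n} M = begin
  det M
    ≡⟨ contracts-cong {R = M ∘ suc} (λ _ _ → refl) first ∅ ⟩
  contracts (M ∘ suc) (λ T → -1ℤ * low q top T + M zero zero * high top T) ∅
    ≡⟨ contracts-lin (M ∘ suc) -1ℤ (low q top) (λ T → M zero zero * high top T) ∅ ⟩
  -1ℤ * contracts (M ∘ suc) (low q top) ∅ + contracts (M ∘ suc) (λ T → M zero zero * high top T) ∅
    ≡⟨ cong₂ (λ x y → -1ℤ * x + y) (contracts-low (M ∘ suc) top)
         (trans (contracts-cong {R = M ∘ suc} (λ _ _ → refl) (λ T → sym (ℤ.+-identityʳ (M zero zero * high top T))) ∅)
         (trans (contracts-lin (M ∘ suc) (M zero zero) (high top) (λ _ → 0ℤ) ∅)
           (cong₂ (λ x y → M zero zero * x + y) (contracts-high (M ∘ suc) top ∅)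
                  (contracts-0 (M ∘ suc) (λ _ → refl) ∅)))) ⟩
  -1ℤ * border + (M zero zero * det R + 0ℤ)
    ≡⟨ eq border (M zero zero * det R) ⟩
  M zero zero * det R - border ∎
  where
  eq : ∀ a b → -1ℤ * a + (b + 0ℤ) ≡ b - a
  eq = solve-∀
  q : Row n
  q = M zero ∘ suc
  R : Rows n n
  R i j = M (suc i) (suc j)
  border : ℤ
  border = sum λ i → M (suc i) zero * det (replace i q R)
  -- `low q τ` is e₀ ∧ (q contracted into τ), and `high τ` is τ seen as a form without e₀.
  -- Contracting e₀ ∧ `top` by the first row leaves these two terms.
  low : ∀ {n} → Row n → Λ n → Λ (suc n)
  low q τ (false ∷ S) = 0ℤ
  low q τ (true ∷ S)  = contract q τ S
  high : ∀ {n} → Λ n → Λ (suc n)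
  high τ (false ∷ S) = τ S
  high τ (true ∷ S)  = 0ℤ
  first : ∀ S → contract (M zero) top S ≡ -1ℤ * low q top S + M zero zero * high top S
  first (false ∷ S) = trans (cong (M zero zero * top S +_) (contract-0 q S)) (ℤ.+-comm (M zero zero * top S) 0ℤ)
  first (true ∷ S)  = eq₁ (M zero zero) (contract q top S)
    where
    eq₁ : ∀ a b → - b ≡ -1ℤ * b + a * 0ℤ
    eq₁ = solve-∀
  high-step : ∀ {n} (r : Row (suc n)) (τ : Λ n) S →
    contract r (high τ) S ≡ high (contract (r ∘ suc) τ) S
  high-step r τ (false ∷ S) = eq₂ (r zero) (contract (r ∘ suc) τ S)
    where
    eq₂ : ∀ a b → a * 0ℤ + b ≡ b
    eq₂ = solve-∀
  high-step r τ (true ∷ S)  = cong -_ (contract-0 (r ∘ suc) S)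
  contracts-high : ∀ {m n} (Q : Rows m (suc n)) (τ : Λ n) (S : Vec Bool n) →
    contracts Q (high τ) (false ∷ S) ≡ contracts (λ i → Q i ∘ suc) τ S
  contracts-high {zero}  Q τ S = refl
  contracts-high {suc m} Q τ S =
    trans (contracts-cong {R = Q ∘ suc} (λ _ _ → refl) (high-step (Q zero) τ) (false ∷ S))
          (contracts-high (Q ∘ suc) (contract (Q zero ∘ suc) τ) S)
  -- The next row either removes e₀, and then q takes the place of that row, or passes both e₀ and
  -- q; the two signs of the second case cancel, so q always stands where the removing row stood.
  low-step : ∀ {n} (q : Row n) (r : Row (suc n)) (τ : Λ n) S →
    contract r (low q τ) S ≡ r zero * high (contract q τ) S + low q (contract (r ∘ suc) τ) S
  low-step q r τ (false ∷ S) = cong (r zero * contract q τ S +_) (contract-0 (r ∘ suc) S)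
  low-step q r τ (true ∷ S)  =
    trans (trans (cong -_ (contract-anticomm (r ∘ suc) q τ S)) (ℤ.neg-involutive _))
          (eq₃ (r zero) _)
    where
    eq₃ : ∀ a b → b ≡ a * 0ℤ + b
    eq₃ = solve-∀
  contracts-low : ∀ {m n} {q : Row n} (Q : Rows m (suc n)) (τ : Λ n) →
    contracts Q (low q τ) (false ∷ ∅)
      ≡ sum λ i → Q i zero * contracts (replace i q (λ i → Q i ∘ suc)) τ ∅
  contracts-low {zero}  Q τ = refl
  contracts-low {suc m} {q = q} Q τ =
    trans (contracts-cong {R = Q ∘ suc} (λ _ _ → refl) (low-step q (Q zero) τ) (false ∷ ∅))
    (trans (contracts-lin (Q ∘ suc) (Q zero zero) (high (contract q τ)) _ (false ∷ ∅))
      (cong₂ (λ x y → Q zero zero * x + y)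
        (contracts-high (Q ∘ suc) (contract q τ) ∅)
        (contracts-low (Q ∘ suc) (contract (Q zero ∘ suc) τ))))

-- Agreement with the Laplace expansion

module DetZ = Determinant +-*-rawRing

-- One contraction of `top` is already the signed sum over the generators left out. The remaining
-- rows act on each summand through their columns other than j, which gives the minor.
laplace : ∀ {n} (M : Rows n n) → DetZ.det M ≡ det M
laplace {zero}  M = refl
laplace {suc n} M = begin
  sum (λ j → DetZ.sign (toℕ j) * (M zero j * DetZ.det λ i k → M (suc i) (punchIn j k)))
    ≡⟨ sum-cong-≗ (λ j → trans (cong (λ d → DetZ.sign (toℕ j) * (M zero j * d)) (minor j))
         (sym (ℤ.*-assoc (DetZ.sign (toℕ j)) (M zero j) _))) ⟩
  sum (λ j → (DetZ.sign (toℕ j) * M zero j) * contracts (M ∘ suc) (ι j top) ∅)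
    ≡⟨ sym (contracts-sum (M ∘ suc) (λ j → DetZ.sign (toℕ j) * M zero j) (λ j → ι j top) ∅) ⟩
  contracts (M ∘ suc) (λ S → sum λ j → (DetZ.sign (toℕ j) * M zero j) * ι j top S) ∅
    ≡⟨ contracts-cong {R = M ∘ suc} (λ _ _ → refl) (λ S → sym (contract-top (M zero) S)) ∅ ⟩
  det M ∎
  where
  -- `ι j` embeds the exterior algebra on the generators other than j.
  ι : ∀ {n} → Fin (suc n) → Λ n → Λ (suc n)
  ι zero                ω (false ∷ S) = ω S
  ι zero                ω (true ∷ S)  = 0ℤ
  ι {n = suc n} (suc j) ω (b ∷ S)     = ι j (ω ∘ (b ∷_)) S
  ι-0 : ∀ {n} (j : Fin (suc n)) S → ι {n} j (λ _ → 0ℤ) S ≡ 0ℤ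
  ι-0 zero                (false ∷ S) = refl
  ι-0 zero                (true ∷ S)  = refl
  ι-0 {n = suc n} (suc j) (b ∷ S)     = ι-0 j S
  ι-lin : ∀ {n} (j : Fin (suc n)) k (ω η : Λ n) S →
    ι j (λ T → k * ω T + η T) S ≡ k * ι j ω S + ι j η S
  ι-lin zero                k ω η (false ∷ S) = refl
  ι-lin zero                k ω η (true ∷ S)  = eq₀ k
    where
    eq₀ : ∀ k → 0ℤ ≡ k * 0ℤ + 0ℤ
    eq₀ = solve-∀
  ι-lin {n = suc n} (suc j) k ω η (b ∷ S)     = ι-lin j k (ω ∘ (b ∷_)) (η ∘ (b ∷_)) S
  ι-neg : ∀ {n} (j : Fin (suc n)) (ω : Λ n) S → ι j (λ T → - ω T) S ≡ - ι j ω S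
  ι-neg zero                ω (false ∷ S) = refl
  ι-neg zero                ω (true ∷ S)  = refl
  ι-neg {n = suc n} (suc j) ω (b ∷ S)     = ι-neg j (ω ∘ (b ∷_)) S
  ι-∅ : ∀ {n} (j : Fin (suc n)) (ω : Λ n) → ι j ω ∅ ≡ ω ∅
  ι-∅ zero                ω = refl
  ι-∅ {n = suc n} (suc j) ω = ι-∅ j (ω ∘ (false ∷_))
  ι-step : ∀ {n} (j : Fin (suc n)) (r : Row (suc n)) (ω : Λ n) S →
    contract r (ι j ω) S ≡ ι j (contract (r ∘ punchIn j) ω) S
  ι-step zero r ω (false ∷ S) = eq₁ (r zero) _
    where
    eq₁ : ∀ a b → a * 0ℤ + b ≡ b
    eq₁ = solve-∀
  ι-step zero r ω (true ∷ S) = cong -_ (contract-0 (r ∘ suc) S)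
  ι-step {n = suc n} (suc j) r ω (false ∷ S) =
    trans (cong (r zero * ι j (ω ∘ (true ∷_)) S +_) (ι-step j (r ∘ suc) (ω ∘ (false ∷_)) S))
          (sym (ι-lin j (r zero) (ω ∘ (true ∷_)) _ S))
  ι-step {n = suc n} (suc j) r ω (true ∷ S) =
    trans (cong -_ (ι-step j (r ∘ suc) (ω ∘ (true ∷_)) S)) (sym (ι-neg j _ S))
  ι-steps : ∀ {m n} (j : Fin (suc n)) (R : Rows m (suc n)) (ω : Λ n) S →
    contracts R (ι j ω) S ≡ ι j (contracts (λ i → R i ∘ punchIn j) ω) S
  ι-steps {zero}  j R ω S = refl
  ι-steps {suc m} j R ω S =
    trans (contracts-cong {R = R ∘ suc} (λ _ _ → refl) (ι-step j (R zero) ω) S)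
          (ι-steps j (R ∘ suc) _ S)
  minor : ∀ j → DetZ.det (λ i k → M (suc i) (punchIn j k)) ≡ contracts (M ∘ suc) (ι j top) ∅
  minor j = trans (laplace (λ i k → M (suc i) (punchIn j k)))
    (sym (trans (ι-steps j (M ∘ suc) top ∅) (ι-∅ j _)))
  contract-top : ∀ {n} (r : Row (suc n)) S →
    contract r top S ≡ sum λ j → (DetZ.sign (toℕ j) * r j) * ι j top S
  contract-top {n} r (b ∷ S) = trans (here b) (cong₂ _+_ (cong (_* ι zero top (b ∷ S)) (sym (ℤ.*-identityˡ (r zero)))) (there b r S))
    where
    rest : ∀ {n} → Bool → Row (suc n) → Λ n
    rest b r S = contract (r ∘ suc) (top ∘ (b ∷_)) S
    sgn : Bool → ℤ → ℤ
    sgn false x = x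
    sgn true  x = - x
    here : ∀ b → contract r top (b ∷ S) ≡ r zero * ι zero top (b ∷ S) + sgn b (rest b r S)
    here false = refl
    here true  = eq₂ (r zero) (rest true r S)
      where
      eq₂ : ∀ a b → - b ≡ a * 0ℤ + - b
      eq₂ = solve-∀
    there : ∀ {n} b (r : Row (suc n)) S → sgn b (rest b r S)
      ≡ sum λ j → ((- DetZ.sign (toℕ j)) * r (suc j)) * ι (suc j) top (b ∷ S)
    there {zero}  false r [] = refl
    there {zero}  true  r [] = refl
    -- Only one generator is left out of each term, so once generator 0 is missing all later terms
    -- vanish.
    there {suc n} false r S  = trans (contract-0 (r ∘ suc) S)
      (sym (sum-0 _ λ j → trans (cong (((- DetZ.sign (toℕ j)) * r (suc j)) *_) (ι-0 j S)) (ℤ.*-zeroʳ ((- DetZ.sign (toℕ j)) * r (suc j)))))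
    there {suc n} true  r S  = trans (cong -_ (contract-top (r ∘ suc) S))
      (trans (neg-sum (λ j → (DetZ.sign (toℕ j) * r (suc j)) * ι j top S))
             (sum-cong-≗ λ j → eq₃ (DetZ.sign (toℕ j)) (r (suc j)) (ι j top S)))
      where
      eq₃ : ∀ a b c → -1ℤ * (a * b * c) ≡ (- a) * b * c
      eq₃ = solve-∀
      neg-sum : ∀ {n} (f : Row n) → - sum f ≡ sum λ j → -1ℤ * f j
      neg-sum f = trans (sym (ℤ.-1*i≡-i (sum f))) (*-distribˡ-sum -1ℤ f)

-- Real characteristic polynomials at rational points

fromℤ-+ : ∀ a b → fromℤ (a + b) ≡ fromℤ a ℚ.+ fromℤ b
fromℤ-+ a b = ℚ.toℚᵘ-injective (ℚᵘ.≃-trans (ℚᵘ.*≡* (eq a b))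
  (ℚᵘ.≃-sym (ℚ.toℚᵘ-homo-+ (fromℤ a) (fromℤ b))))
  where
  eq : ∀ a b → (a + b) * pos 1 ≡ (a * pos 1 + b * pos 1) * pos 1
  eq = solve-∀

fromℤ-* : ∀ a b → fromℤ (a * b) ≡ fromℤ a ℚ.* fromℤ b
fromℤ-* a b = ℚ.toℚᵘ-injective (ℚᵘ.≃-trans (ℚᵘ.*≡* refl)
  (ℚᵘ.≃-sym (ℚ.toℚᵘ-homo-* (fromℤ a) (fromℤ b))))

fromℤ-neg : ∀ a → fromℤ (- a) ≡ ℚ.- fromℤ a
fromℤ-neg a = ℚ.toℚᵘ-injective (ℚᵘ.≃-trans (ℚᵘ.*≡* refl) (ℚᵘ.≃-sym (ℚ.toℚᵘ-homo‿- (fromℤ a))))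

fromℤ-injective : ∀ {a b} → fromℤ a ≡ fromℤ b → a ≡ b
fromℤ-injective = cong ℚ.numerator

module Detℝ = Determinant ℝ-rawRing

-- It is used with `val` the k-th term of a Cauchy sequence: the operations on `ℝ` are termwise, so
-- this is a homomorphism up to propositional equality. Scaling all entries by y scales the
-- determinant by yⁿ, which clears the denominators.
module ScaledDeterminant {c ℓ} (R : RawRing c ℓ) (val : RawRing.Carrier R → ℚ)
  (val-+   : ∀ a b → val (RawRing._+_ R a b) ≡ val a ℚ.+ val b)
  (val-*   : ∀ a b → val (RawRing._*_ R a b) ≡ val a ℚ.* val b)
  (val-neg : ∀ a → val (RawRing.-_ R a) ≡ ℚ.- val a)
  (val-0   : val (RawRing.0# R) ≡ 0ℚ)
  (val-1   : val (RawRing.1# R) ≡ 1ℚ) where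

  open RawRing R renaming (_+_ to _⊕_; _*_ to _⊗_; -_ to ⊖_)
  private
    module DetR = Determinant R
  open RawMonoidOps (RawRing.+-rawMonoid R) using () renaming (sum to sumᴿ)

  sum-scaled : ∀ {n} c (f : Fin n → Carrier) (g : Fin n → ℤ) →
    (∀ j → c ℚ.* val (f j) ≡ fromℤ (g j)) → c ℚ.* val (sumᴿ f) ≡ fromℤ (sum g)
  sum-scaled {zero}  c f g e = trans (cong (c ℚ.*_) val-0) (ℚ.*-zeroʳ c)
  sum-scaled {suc n} c f g e = begin
    c ℚ.* val (f zero ⊕ sumᴿ (f ∘ suc))
      ≡⟨ cong (c ℚ.*_) (val-+ (f zero) (sumᴿ (f ∘ suc))) ⟩
    c ℚ.* (val (f zero) ℚ.+ val (sumᴿ (f ∘ suc)))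
      ≡⟨ ℚ.*-distribˡ-+ c (val (f zero)) (val (sumᴿ (f ∘ suc))) ⟩
    c ℚ.* val (f zero) ℚ.+ c ℚ.* val (sumᴿ (f ∘ suc))
      ≡⟨ cong₂ ℚ._+_ (e zero) (sum-scaled c (f ∘ suc) (g ∘ suc) (e ∘ suc)) ⟩
    fromℤ (g zero) ℚ.+ fromℤ (sum (g ∘ suc))
      ≡⟨ sym (fromℤ-+ (g zero) (sum (g ∘ suc))) ⟩
    fromℤ (sum g) ∎

  val-sign : ∀ m → val (DetR.sign m) ≡ fromℤ (DetZ.sign m)
  val-sign zero    = val-1
  val-sign (suc m) = trans (val-neg (DetR.sign m))
    (trans (cong ℚ.-_ (val-sign m)) (sym (fromℤ-neg (DetZ.sign m))))

  det-scaled : ∀ {n} y (M : DetR.Matrix n) (M′ : DetZ.Matrix n) →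
    (∀ i j → fromℤ y ℚ.* val (M i j) ≡ fromℤ (M′ i j)) →
    fromℤ (y ^ n) ℚ.* val (DetR.det M) ≡ fromℤ (DetZ.det M′)
  det-scaled {zero}  y M M′ e = trans (ℚ.*-identityˡ (val 1#)) val-1
  det-scaled {suc n} y M M′ e = sum-scaled (fromℤ (y ^ suc n))
    (λ j → DetR.sign (toℕ j) ⊗ (M zero j ⊗ DetR.det (λ i k → M (suc i) (punchIn j k))))
    (λ j → DetZ.sign (toℕ j) * (M′ zero j * DetZ.det (λ i k → M′ (suc i) (punchIn j k)))) term
    where
    out : ∀ a b c → a ℚ.* (b ℚ.* c) ≡ b ℚ.* (a ℚ.* c)
    out = solve 3 (λ a b c → a :* (b :* c) := b :* (a :* c)) refl
      where open +-*-Solver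
    pair : ∀ a b c d → (a ℚ.* b) ℚ.* (c ℚ.* d) ≡ (a ℚ.* c) ℚ.* (b ℚ.* d)
    pair = solve 4 (λ a b c d → (a :* b) :* (c :* d) := (a :* c) :* (b :* d)) refl
      where open +-*-Solver
    term : ∀ j → fromℤ (y ^ suc n) ℚ.*
        val (DetR.sign (toℕ j) ⊗ (M zero j ⊗ DetR.det (λ i k → M (suc i) (punchIn j k))))
      ≡ fromℤ (DetZ.sign (toℕ j) * (M′ zero j * DetZ.det (λ i k → M′ (suc i) (punchIn j k))))
    term j = begin
      fromℤ (y * y ^ n) ℚ.* val (DetR.sign (toℕ j) ⊗ (M zero j ⊗ d))
        ≡⟨ cong₂ ℚ._*_ (fromℤ-* y (y ^ n)) (trans (val-* (DetR.sign (toℕ j)) (M zero j ⊗ d))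
             (cong₂ ℚ._*_ (val-sign (toℕ j)) (val-* (M zero j) d))) ⟩
      (fromℤ y ℚ.* fromℤ (y ^ n)) ℚ.* (s ℚ.* (val (M zero j) ℚ.* val d))
        ≡⟨ out (fromℤ y ℚ.* fromℤ (y ^ n)) s (val (M zero j) ℚ.* val d) ⟩
      s ℚ.* ((fromℤ y ℚ.* fromℤ (y ^ n)) ℚ.* (val (M zero j) ℚ.* val d))
        ≡⟨ cong (s ℚ.*_) (pair (fromℤ y) (fromℤ (y ^ n)) (val (M zero j)) (val d)) ⟩
      s ℚ.* ((fromℤ y ℚ.* val (M zero j)) ℚ.* (fromℤ (y ^ n) ℚ.* val d))
        ≡⟨ cong (s ℚ.*_) (cong₂ ℚ._*_ (e zero j)
             (det-scaled y (λ i k → M (suc i) (punchIn j k)) (λ i k → M′ (suc i) (punchIn j k))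
               (λ i l → e (suc i) (punchIn j l)))) ⟩
      s ℚ.* (fromℤ (M′ zero j) ℚ.* fromℤ d′)
        ≡⟨ cong (s ℚ.*_) (sym (fromℤ-* (M′ zero j) d′)) ⟩
      s ℚ.* fromℤ (M′ zero j * d′)
        ≡⟨ sym (fromℤ-* (DetZ.sign (toℕ j)) (M′ zero j * d′)) ⟩
      fromℤ (DetZ.sign (toℕ j) * (M′ zero j * d′)) ∎
      where
      s = fromℤ (DetZ.sign (toℕ j))
      d = DetR.det (λ i k → M (suc i) (punchIn j k))
      d′ = DetZ.det (λ i k → M′ (suc i) (punchIn j k))

-- If D = |a - b| were positive, both constants would eventually lie within D/4 of the same term of
-- z, whence D ≤ D/2.
≈ℝ-constants : ∀ {a b} x y z → (∀ k → seq x k ≡ a) → (∀ k → seq y k ≡ b) →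
  x ≈ℝ z → y ≈ℝ z → a ≡ b
≈ℝ-constants {a} {b} x y z ca cb (mk≈ hx) (mk≈ hy) with a ℚ.≟ b
... | yes a≡b = a≡b
... | no  a≢b = ⊥-elim (ℚ.<-irrefl refl (ℚ.<-≤-trans half<D D≤half))
  where
  D = ℚ.∣ a ℚ.- b ∣
  ¼ = ½ ℚ.* ½
  a-b≢0 : a ℚ.- b ≢ 0ℚ
  a-b≢0 e = a≢b (trans (split a b) (trans (cong (ℚ._+ b) e) (ℚ.+-identityˡ b)))
    where
    open +-*-Solver
    split : ∀ a b → a ≡ (a ℚ.- b) ℚ.+ b
    split = solve 2 (λ a b → a := (a :- b) :+ b) refl
  0<D : 0ℚ ℚ.< D
  0<D = ℚ.≰⇒> λ D≤0 → a-b≢0 (ℚ.∣p∣≡0⇒p≡0 (a ℚ.- b) (ℚ.≤-antisym D≤0 (ℚ.0≤∣p∣ (a ℚ.- b))))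
  ε = ¼ ℚ.* D
  0<ε : 0ℚ ℚ.< ε
  0<ε = ℚ.positive⁻¹ ε {{ℚ.pos*pos⇒pos ¼ D {{ℚ.positive 0<D}}}}
  half<D : ½ ℚ.* D ℚ.< D
  half<D = subst (½ ℚ.* D ℚ.<_) (ℚ.*-identityˡ D)
    (ℚ.*-monoˡ-<-pos D {{ℚ.positive 0<D}} {½} {1ℚ} (ℚ.*<* (ℤᵇ.+<+ (ℕ.s≤s (ℕ.s≤s ℕ.z≤n)))))
  M = proj₁ (hx ε 0<ε)
  N = proj₁ (hy ε 0<ε)
  k = M ℕ.⊔ N
  D≤half : D ℚ.≤ ½ ℚ.* D
  D≤half = ≤.begin
    ℚ.∣ a ℚ.- b ∣
      ≤.≡⟨ cong ℚ.∣_∣ (via a b (seq z k)) ⟩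
    ℚ.∣ (a ℚ.- seq z k) ℚ.+ ℚ.- (b ℚ.- seq z k) ∣
      ≤.≤⟨ ℚ.∣p+q∣≤∣p∣+∣q∣ (a ℚ.- seq z k) (ℚ.- (b ℚ.- seq z k)) ⟩
    ℚ.∣ a ℚ.- seq z k ∣ ℚ.+ ℚ.∣ ℚ.- (b ℚ.- seq z k) ∣
      ≤.≡⟨ cong (ℚ.∣ a ℚ.- seq z k ∣ ℚ.+_) (ℚ.∣-p∣≡∣p∣ (b ℚ.- seq z k)) ⟩
    ℚ.∣ a ℚ.- seq z k ∣ ℚ.+ ℚ.∣ b ℚ.- seq z k ∣
      ≤.≤⟨ ℚ.+-mono-≤
             (subst (λ s → ℚ.∣ s ℚ.- seq z k ∣ ℚ.≤ ε) (ca k) (proj₂ (hx ε 0<ε) k (ℕ.m≤m⊔n M N)))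
             (subst (λ s → ℚ.∣ s ℚ.- seq z k ∣ ℚ.≤ ε) (cb k) (proj₂ (hy ε 0<ε) k (ℕ.m≤n⊔m M N))) ⟩
    ε ℚ.+ ε
      ≤.≡⟨ sym (ℚ.*-distribʳ-+ D ¼ ¼) ⟩
    ½ ℚ.* D ≤.∎
    where
    module ≤ = ℚ.≤-Reasoning
    open ≤ using (step-≤; step-≡-⟩)
    open +-*-Solver
    via : ∀ a b c → a ℚ.- b ≡ (a ℚ.- c) ℚ.+ ℚ.- (b ℚ.- c)
    via = solve 3 (λ a b c → a :- b := (a :- c) :+ :- (b :- c)) refl

1ᵇ : Bool → ℤ
1ᵇ b = if b then 1ℤ else 0ℤ

adjℤ : (G : Graph) → Rows (Graph.order G) (Graph.order G)
adjℤ G u v = 1ᵇ (Graph.adj G u v)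

-- This is y times the characteristic matrix at p / y. Two specialisations are used: y = 1 gives x -
-- A, and p = 1 gives 1 - y A, whose determinant is the reversed characteristic polynomial.
charMatrix : ∀ {n} → ℤ → ℤ → Rows n n → Rows n n
charMatrix p y A i j = p * δ i j - y * A i j

cospectral-order : ∀ {G H} → Cospectral G H → Graph.order G ≡ Graph.order H
cospectral-order (_ , (lG , _) , (lH , _)) = trans (sym lG) lH

-- Evaluating the characteristic polynomials at p / y and clearing the denominators.
cospectral-det : ∀ {G H} → Cospectral G H → ∀ p y → y ≢ 0ℤ →
  det (charMatrix p y (adjℤ G)) ≡ det (charMatrix p y (adjℤ H))
cospectral-det {G} {H} cosp@(λs , (_ , spG) , (_ , spH)) p y y≢0 =
  trans (sym (laplace (charMatrix p y (adjℤ G))))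
  (trans (fromℤ-injective (cancel (trans
      (cong (λ n → inv n ℚ.* fromℤ (DetZ.det (charMatrix p y (adjℤ G)))) (sym (cospectral-order {G} {H} cosp)))
      (≈ℝ-constants (Detℝ.det (realMatrix G)) (Detℝ.det (realMatrix H))
        (foldr _*ℝ_ 1ℝ (map (λ μ → x -ℝ μ) λs)) (value G) (value H) (spG x) (spH x)))))
  (laplace (charMatrix p y (adjℤ H))))
  where
  φy≢0 : ∀ {z} → z ≢ 0ℤ → fromℤ z ≢ 0ℚ
  φy≢0 z≢0 e = z≢0 (cong ℚ.numerator e)
  inverse : ∀ z → z ≢ 0ℤ → ∃ λ r → r ℚ.* fromℤ z ≡ 1ℚ
  inverse z z≢0 = let instance nz = ℚ.≢-nonZero (φy≢0 z≢0) in
    (ℚ.1/ fromℤ z) , ℚ.*-inverseˡ (fromℤ z)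
  pow≢0 : ∀ n → y ^ n ≢ 0ℤ
  pow≢0 n e = y≢0 (ℤ.i^n≡0⇒i≡0 y n e)
  inv : ℕ → ℚ
  inv n = proj₁ (inverse (y ^ n) (pow≢0 n))
  q : ℚ
  q = proj₁ (inverse y y≢0) ℚ.* fromℤ p
  x : ℝ
  x = fromℚ q
  y*q : fromℤ y ℚ.* q ≡ fromℤ p
  y*q = begin
    fromℤ y ℚ.* (proj₁ (inverse y y≢0) ℚ.* fromℤ p)
      ≡⟨ ℚ.*-assoc (fromℤ y) (proj₁ (inverse y y≢0)) (fromℤ p) ⟨
    (fromℤ y ℚ.* proj₁ (inverse y y≢0)) ℚ.* fromℤ p
      ≡⟨ cong (ℚ._* fromℤ p) (trans (ℚ.*-comm (fromℤ y) (proj₁ (inverse y y≢0))) (proj₂ (inverse y y≢0))) ⟩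
    1ℚ ℚ.* fromℤ p
      ≡⟨ ℚ.*-identityˡ (fromℤ p) ⟩
    fromℤ p ∎
  realMatrix : (G : Graph) → Detℝ.Matrix (Graph.order G)
  realMatrix G i j = Detℝ.scalar x i j -ℝ Graph.adjacencyMatrix G i j
  entry : ∀ G k i j → fromℤ y ℚ.* seq (realMatrix G i j) k ≡ fromℤ (charMatrix p y (adjℤ G) i j)
  entry G k i j = begin
    fromℤ y ℚ.* (seq (Detℝ.scalar x i j) k ℚ.+ ℚ.- seq (Graph.adjacencyMatrix G i j) k)
      ≡⟨ cong₂ (λ a b → fromℤ y ℚ.* (a ℚ.+ ℚ.- b)) (diag (does (i ≟ᶠ j))) (edge (Graph.adj G i j)) ⟩
    fromℤ y ℚ.* (q ℚ.* fromℤ (δ i j) ℚ.+ ℚ.- fromℤ a)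
      ≡⟨ rearrange (fromℤ y) q (fromℤ (δ i j)) (fromℤ a) ⟩
    (fromℤ y ℚ.* q) ℚ.* fromℤ (δ i j) ℚ.+ ℚ.- (fromℤ y ℚ.* fromℤ a)
      ≡⟨ cong₂ (λ s t → s ℚ.* fromℤ (δ i j) ℚ.+ ℚ.- t) y*q (sym (fromℤ-* y a)) ⟩
    fromℤ p ℚ.* fromℤ (δ i j) ℚ.+ ℚ.- fromℤ (y * a)
      ≡⟨ cong₂ ℚ._+_ (sym (fromℤ-* p (δ i j))) (sym (fromℤ-neg (y * a))) ⟩
    fromℤ (p * δ i j) ℚ.+ fromℤ (- (y * a))
      ≡⟨ sym (fromℤ-+ (p * δ i j) (- (y * a))) ⟩
    fromℤ (p * δ i j - y * a) ∎
    where
    a = adjℤ G i j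
    diag : ∀ b → seq (if b then x else 0ℝ) k ≡ q ℚ.* fromℤ (1ᵇ b)
    diag true  = sym (ℚ.*-identityʳ q)
    diag false = sym (ℚ.*-zeroʳ q)
    edge : ∀ b → seq (if b then 1ℝ else 0ℝ) k ≡ fromℤ (1ᵇ b)
    edge true  = refl
    edge false = refl
    rearrange : ∀ y q d a → y ℚ.* (q ℚ.* d ℚ.+ ℚ.- a) ≡ (y ℚ.* q) ℚ.* d ℚ.+ ℚ.- (y ℚ.* a)
    rearrange = solve 4 (λ y q d a → y :* (q :* d :+ :- a) := (y :* q) :* d :+ :- (y :* a)) refl
      where open +-*-Solver
  -- At a rational point every entry is a constant sequence, so all terms of the determinant are the
  -- same rational number, independent of k.
  value : ∀ G k → seq (Detℝ.det (realMatrix G)) k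
    ≡ inv (Graph.order G) ℚ.* fromℤ (DetZ.det (charMatrix p y (adjℤ G)))
  value G k = begin
    s                            ≡⟨ ℚ.*-identityˡ s ⟨
    1ℚ ℚ.* s                     ≡⟨ cong (ℚ._* s) (proj₂ (inverse (y ^ N) (pow≢0 N))) ⟨
    (inv N ℚ.* fromℤ (y ^ N)) ℚ.* s  ≡⟨ ℚ.*-assoc (inv N) (fromℤ (y ^ N)) s ⟩
    inv N ℚ.* (fromℤ (y ^ N) ℚ.* s)
      ≡⟨ cong (inv N ℚ.*_) (Scaled.det-scaled y (realMatrix G) (charMatrix p y (adjℤ G)) (entry G k)) ⟩
    inv N ℚ.* fromℤ (DetZ.det (charMatrix p y (adjℤ G))) ∎
    where
    N = Graph.order G
    module Scaled = ScaledDeterminant ℝ-rawRing (λ x → seq x k)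
      (λ _ _ → refl) (λ _ _ → refl) (λ _ → refl) refl refl
    s = seq (Detℝ.det (realMatrix G)) k
  cancel : ∀ {a b} → inv (Graph.order H) ℚ.* a ≡ inv (Graph.order H) ℚ.* b → a ≡ b
  cancel {a} {b} e = trans (recover a) (trans (cong (fromℤ (y ^ Graph.order H) ℚ.*_) e) (sym (recover b)))
    where
    recover : ∀ a → a ≡ fromℤ (y ^ Graph.order H) ℚ.* (inv (Graph.order H) ℚ.* a)
    recover a = sym (trans (sym (ℚ.*-assoc (fromℤ (y ^ N)) (inv N) a))
      (trans (cong (ℚ._* a) (trans (ℚ.*-comm (fromℤ (y ^ N)) (inv N)) (proj₂ (inverse (y ^ N) (pow≢0 N)))))
             (ℚ.*-identityˡ a)))
      where N = Graph.order H

-- The friendship graph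

_≡_[mod_] : ℤ → ℤ → ℤ → Set
a ≡ b [mod q ] = ∃ λ z → a ≡ b + q * z

contract-mod : ∀ {n} q {r s : Row n} {ω η : Λ n} →
  (∀ j → r j ≡ s j [mod q ]) → (∀ S → ω S ≡ η S [mod q ]) →
  ∀ S → contract r ω S ≡ contract s η S [mod q ]
contract-mod q e f [] = 0ℤ , eq q
  where
  eq : ∀ q → 0ℤ ≡ 0ℤ + q * 0ℤ
  eq = solve-∀
contract-mod q {s = s} {η = η} e f (false ∷ S)
  with e zero | f (true ∷ S) | contract-mod q (e ∘ suc) (f ∘ (false ∷_)) S
... | x , p | y , p′ | z , p″ rewrite p | p′ | p″ =
  s zero * y + x * η (true ∷ S) + q * (x * y) + z , eq q (s zero) x (η (true ∷ S)) y _ z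
  where
  eq : ∀ q s x w y c z → (s + q * x) * (w + q * y) + (c + q * z)
     ≡ (s * w + c) + q * (s * y + x * w + q * (x * y) + z)
  eq = solve-∀
contract-mod q {r} {s} {ω} {η} e f (true ∷ S)
  with contract-mod q {r ∘ suc} {s ∘ suc} {ω ∘ (true ∷_)} {η ∘ (true ∷_)} (e ∘ suc) (f ∘ (true ∷_)) S
... | z , p = - z , trans (cong -_ p) (eq (contract (s ∘ suc) (η ∘ (true ∷_)) S) q z)
  where
  eq : ∀ c q z → - (c + q * z) ≡ - c + q * (- z)
  eq = solve-∀

contracts-mod : ∀ {m n} q {R R′ : Rows m n} {ω η : Λ n} →
  (∀ i j → R i j ≡ R′ i j [mod q ]) → (∀ S → ω S ≡ η S [mod q ]) →
  ∀ S → contracts R ω S ≡ contracts R′ η S [mod q ]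
contracts-mod {zero}  q e f = f
contracts-mod {suc m} q e f = contracts-mod q (e ∘ suc) (contract-mod q (e zero) f)

mod-refl : ∀ q a → a ≡ a [mod q ]
mod-refl q a = 0ℤ , eq a q
  where
  eq : ∀ a q → a ≡ a + q * 0ℤ
  eq = solve-∀

replace-mod : ∀ {m n} q k (v : Row n) {R R′ : Rows m n} →
  (∀ i j → R i j ≡ R′ i j [mod q ]) → ∀ i j → replace k v R i j ≡ replace k v R′ i j [mod q ]
replace-mod q zero    v e zero    j = mod-refl q (v j)
replace-mod q zero    v e (suc i) j = e (suc i) j
replace-mod q (suc k) v e zero    j = e zero j
replace-mod q (suc k) v e (suc i) j = replace-mod q k v (e ∘ suc) i j

det-first-column : ∀ {n} (M : Rows (suc n) (suc n)) → (∀ i → M (suc i) zero ≡ 0ℤ) →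
  det M ≡ M zero zero * det (λ i j → M (suc i) (suc j))
det-first-column M z = trans (det-bordered M)
  (trans (cong (λ s → M zero zero * det (λ i j → M (suc i) (suc j)) - s)
           (sum-0 (λ i → M (suc i) zero * det (replace i (M zero ∘ suc) (λ i j → M (suc i) (suc j)))) λ i → cong (_* det (replace i (M zero ∘ suc) (λ i j → M (suc i) (suc j)))) (z i)))
         (ℤ.+-identityʳ _))

det-δ : ∀ n → det (δ {n}) ≡ 1ℤ
det-δ zero    = refl
det-δ (suc n) = trans (det-first-column (δ {suc n}) (λ _ → refl))
  (trans (ℤ.*-identityˡ (det (δ {n}))) (det-δ n))

det-replace-δ : ∀ {n} (k : Fin n) (v : Row n) → det (replace k v δ) ≡ v k
det-replace-δ {n} k v = begin
  det (replace k v δ)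
    ≡⟨ det-cong (replace-cong k (λ j → sym (sum-δʳ j v)) (λ _ _ → refl)) ⟩
  det (replace k (λ j → sum λ i → v i * δ i j) δ)
    ≡⟨ det-replace k v δ ⟩
  v k * det (δ {n})
    ≡⟨ cong (v k *_) (det-δ n) ⟩
  v k * 1ℤ
    ≡⟨ ℤ.*-identityʳ (v k) ⟩
  v k ∎

det-replace-scale : ∀ {n} k a {v w : Row n} (R : Rows n n) → (∀ j → w j ≡ a * v j) →
  det (replace k w R) ≡ a * det (replace k v R)
det-replace-scale k a {v} {w} R e = begin
  det (replace k w R)
    ≡⟨ det-cong (replace-cong k (λ j → trans (e j) (sym (ℤ.+-identityʳ (a * v j)))) (λ _ _ → refl)) ⟩
  det (replace k (λ j → a * v j + 0ℤ) R)
    ≡⟨ contracts-replace-lin k a v (λ _ → 0ℤ) R top ∅ ⟩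
  a * det (replace k v R) + det (replace k (λ _ → 0ℤ) R)
    ≡⟨ cong (a * det (replace k v R) +_) (contracts-replace-0 k R (λ _ → refl) top ∅) ⟩
  a * det (replace k v R) + 0ℤ
    ≡⟨ ℤ.+-identityʳ _ ⟩
  a * det (replace k v R) ∎

-- Minus the sum of the principal 2 × 2 minors, for a zero diagonal.
pairs : ∀ {n} → Rows n n → ℤ
pairs {zero}  A = 0ℤ
pairs {suc n} A = sum (λ i → A (suc i) zero * A zero (suc i)) + pairs (λ i j → A (suc i) (suc j))

-- Off the diagonal all entries are multiples of q. Each border term therefore carries q² already,
-- one factor from the first column and one from the first row, and its inner determinant matters
-- only modulo q, where the matrix is the identity.
det-mod-cube : ∀ {n} (A : Rows n n) → (∀ i → A i i ≡ 0ℤ) → ∀ q →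
  det (charMatrix 1ℤ q A) ≡ 1ℤ - q * q * pairs A [mod q * q * q ]
det-mod-cube {zero}  A z q = 0ℤ , eq q
  where
  eq : ∀ q → 1ℤ ≡ 1ℤ - q * q * 0ℤ + q * q * q * 0ℤ
  eq = solve-∀
det-mod-cube {suc n} A z q with det-mod-cube (λ i j → A (suc i) (suc j)) (z ∘ suc) q
... | w , e = w - sum (λ i → A (suc i) zero * err i) , (begin
  det M
    ≡⟨ det-bordered M ⟩
  M zero zero * det M′ - sum (λ i → M (suc i) zero * det (replace i (M zero ∘ suc) M′))
    ≡⟨ cong₂ (λ a b → a * det M′ - b) (trans (cong (λ a → 1ℤ * 1ℤ - q * a) (z zero)) (one q))
         (trans (sum-cong-≗ term) (trans (sum-lin (q * q) prod (λ i → q * q * q * (A (suc i) zero * err i)))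
           (cong (q * q * sum prod +_) (sym (*-distribˡ-sum (q * q * q) λ i → A (suc i) zero * err i))))) ⟩
  1ℤ * det M′ - (q * q * sum prod + q * q * q * sum (λ i → A (suc i) zero * err i))
    ≡⟨ cong (λ a → 1ℤ * a - (q * q * sum prod + q * q * q * sum (λ i → A (suc i) zero * err i))) e ⟩
  1ℤ * (1ℤ - q * q * pairs A′ + q * q * q * w) - (q * q * sum prod + q * q * q * sum (λ i → A (suc i) zero * err i))
    ≡⟨ collect q (pairs A′) w (sum prod) (sum (λ i → A (suc i) zero * err i)) ⟩
  1ℤ - q * q * (sum prod + pairs A′) + q * q * q * (w - sum (λ i → A (suc i) zero * err i)) ∎)
  where
  M = charMatrix 1ℤ q A
  A′ : Rows n n
  A′ i j = A (suc i) (suc j)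
  M′ : Rows n n
  M′ = charMatrix 1ℤ q A′
  a : Row n
  a j = A zero (suc j)
  prod : Row n
  prod i = A (suc i) zero * a i
  M′-mod : ∀ i j → M′ i j ≡ δ i j [mod q ]
  M′-mod i j = - A′ i j , eq (δ i j) q (A′ i j)
    where
    eq : ∀ d q a → 1ℤ * d - q * a ≡ d + q * - a
    eq = solve-∀
  near : ∀ i → det (replace i a M′) ≡ det (replace i a δ) [mod q ]
  near i = contracts-mod q (replace-mod q i a M′-mod) (λ S → mod-refl q (top S)) ∅
  err : Row n
  err i = proj₁ (near i)
  one : ∀ q → 1ℤ * 1ℤ - q * 0ℤ ≡ 1ℤ
  one = solve-∀
  term : ∀ i → M (suc i) zero * det (replace i (M zero ∘ suc) M′)
       ≡ q * q * prod i + q * q * q * (A (suc i) zero * err i)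
  term i = begin
    (1ℤ * 0ℤ - q * A (suc i) zero) * det (replace i (M zero ∘ suc) M′)
      ≡⟨ cong ((1ℤ * 0ℤ - q * A (suc i) zero) *_)
           (trans (det-replace-scale i (- q) {a} M′ (λ j → neg q (a j)))
             (cong (- q *_) (trans (proj₂ (near i)) (cong (_+ q * err i) (det-replace-δ i a))))) ⟩
    (1ℤ * 0ℤ - q * A (suc i) zero) * (- q * (a i + q * err i))
      ≡⟨ eq q (A (suc i) zero) (a i) (err i) ⟩
    q * q * prod i + q * q * q * (A (suc i) zero * err i) ∎
    where
    neg : ∀ q a → 1ℤ * 0ℤ - q * a ≡ - q * a
    neg = solve-∀
    eq : ∀ q x a e → (1ℤ * 0ℤ - q * x) * (- q * (a + q * e)) ≡ q * q * (x * a) + q * q * q * (x * e)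
    eq = solve-∀
  collect : ∀ q p w s t → 1ℤ * (1ℤ - q * q * p + q * q * q * w) - (q * q * s + q * q * q * t)
    ≡ 1ℤ - q * q * (s + p) + q * q * q * (w - t)
  collect = solve-∀

-- The divisor |d| + 1 exceeds |d|, so the quotient must be 0.
multiple-of-larger : ∀ d → (∀ y → y ≢ 0ℤ → ∃ λ w → d ≡ y * w) → d ≡ 0ℤ
multiple-of-larger d h with h (pos (suc ∣ d ∣)) (λ ())
... | w , e = ℤ.∣i∣≡0⇒i≡0 (small ∣ d ∣ ∣ w ∣ (trans (cong ∣_∣ e) (ℤ.∣i*j∣≡∣i∣*∣j∣ (pos (suc ∣ d ∣)) w)))
  where
  small : ∀ a b → a ≡ suc a ℕ.* b → a ≡ 0
  small a zero    e = trans e (ℕ.*-zeroʳ a)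
  small a (suc b) e = ⊥-elim (ℕ.<-irrefl e (ℕ.m≤m*n (suc a) (suc b)))

-- Comparing both determinants modulo y³ shows that y³ divides y² (pairs A - pairs B). Hence every
-- nonzero y divides the difference.
pairs-det : ∀ {m n} (A : Rows m m) (B : Rows n n) → (∀ i → A i i ≡ 0ℤ) → (∀ i → B i i ≡ 0ℤ) →
  (∀ y → y ≢ 0ℤ → det (charMatrix 1ℤ y A) ≡ det (charMatrix 1ℤ y B)) → pairs A ≡ pairs B
pairs-det A B zA zB h = ℤ.i-j≡0⇒i≡j (pairs A) (pairs B) (multiple-of-larger (pairs A - pairs B) λ y y≢0 →
  let u , p = det-mod-cube A zA y
      v , p′ = det-mod-cube B zB y
      instance nz : ℤᵇ.NonZero y
               nz = ℤᵇ.≢-nonZero y≢0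
  in u - v , ℤ.*-cancelˡ-≡ y (pairs A - pairs B) (y * (u - v))
      (ℤ.*-cancelˡ-≡ y (y * (pairs A - pairs B)) (y * (y * (u - v)))
       (ℤ.i-j≡0⇒i≡j _ _ (trans (eq y (pairs A) (pairs B) u v)
         (ℤ.i≡j⇒i-j≡0 (trans (sym p′) (trans (sym (h y y≢0)) p)))))))
  where
  eq : ∀ y a b u v → y * (y * (a - b)) - y * (y * (y * (u - v)))
     ≡ (1ℤ - y * y * b + y * y * y * v) - (1ℤ - y * y * a + y * y * y * u)
  eq = solve-∀

-- Counting edges

sum-const : ∀ n c → sum {n} (λ _ → c) ≡ pos n * c
sum-const zero    c = refl
sum-const (suc n) c = trans (cong (c +_) (sum-const n c))
  (sym (trans (cong (_* c) (ℤ.pos-+ 1 n)) (eq (pos n) c)))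
  where
  eq : ∀ n c → (1ℤ + n) * c ≡ c + n * c
  eq = solve-∀

1ᵇ-idem : ∀ b → 1ᵇ b * 1ᵇ b ≡ 1ᵇ b
1ᵇ-idem true  = refl
1ᵇ-idem false = refl

-- The handshake lemma: `pairs` of a symmetric 0-1 matrix with zero diagonal is the number of edges.
degree-sum : ∀ {n} (a : Fin n → Fin n → Bool) → (∀ u v → a u v ≡ a v u) → (∀ u → a u u ≡ false) →
  sum (λ u → sum λ v → 1ᵇ (a u v)) ≡ pos 2 * pairs (λ u v → 1ᵇ (a u v))
degree-sum {zero}  a s z = refl
degree-sum {suc n} a s z = begin
  (1ᵇ (a zero zero) + sum r) + sum (λ i → c i + sum λ j → 1ᵇ (a (suc i) (suc j)))
    ≡⟨ cong₂ (λ x y → (x + sum r) + y) (cong 1ᵇ (z zero)) (∑-distrib-+ c _) ⟩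
  (0ℤ + sum r) + (sum c + sum (λ i → sum λ j → 1ᵇ (a (suc i) (suc j))))
    ≡⟨ cong₂ (λ x y → (0ℤ + sum r) + (x + y)) (sum-cong-≗ λ i → cong 1ᵇ (s (suc i) zero))
         (degree-sum (λ i j → a (suc i) (suc j)) (λ u v → s (suc u) (suc v)) (z ∘ suc)) ⟩
  (0ℤ + sum r) + (sum r + pos 2 * P)
    ≡⟨ eq (sum r) P ⟩
  pos 2 * (sum r + P)
    ≡⟨ cong (λ x → pos 2 * (x + P)) (sum-cong-≗ λ i → sym (trans
         (cong (λ b → 1ᵇ b * 1ᵇ (a zero (suc i))) (s (suc i) zero)) (1ᵇ-idem (a zero (suc i))))) ⟩
  pos 2 * (sum (λ i → c i * r i) + P) ∎
  where
  r c : Row n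
  r i = 1ᵇ (a zero (suc i))
  c i = 1ᵇ (a (suc i) zero)
  P = pairs (λ i j → 1ᵇ (a (suc i) (suc j)))
  eq : ∀ r p → (0ℤ + r) + (r + pos 2 * p) ≡ pos 2 * (r + p)
  eq = solve-∀

-- The characteristic polynomial of the friendship graph

petals : ∀ n → Rows (n ℕ.* 2) (n ℕ.* 2)
petals n i j = adjℤ (friendshipGraph n) (suc i) (suc j)

pos-suc : ∀ n → pos (suc n) ≡ 1ℤ + pos n
pos-suc n = ℤ.pos-+ 1 n

pairs-petals : ∀ n → pairs (petals n) ≡ pos n
pairs-petals zero    = refl
pairs-petals (suc n) = begin
  (1ℤ + sum (λ (i : Fin (n ℕ.* 2)) → 0ℤ * 0ℤ)) + (sum (λ (i : Fin (n ℕ.* 2)) → 0ℤ * 0ℤ) + pairs (petals n))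
    ≡⟨ cong₂ (λ x y → (1ℤ + x) + (x + y)) (sum-0 (λ (i : Fin (n ℕ.* 2)) → 0ℤ * 0ℤ) (λ _ → refl)) (pairs-petals n) ⟩
  (1ℤ + 0ℤ) + (0ℤ + pos n)
    ≡⟨ eq (pos n) ⟩
  1ℤ + pos n
    ≡⟨ sym (pos-suc n) ⟩
  pos (suc n) ∎
  where
  eq : ∀ n → (1ℤ + 0ℤ) + (0ℤ + n) ≡ 1ℤ + n
  eq = solve-∀

pairs-friendship : ∀ n → pairs (adjℤ (friendshipGraph n)) ≡ pos 3 * pos n
pairs-friendship n = begin
  sum {n ℕ.* 2} (λ i → 1ℤ) + pairs (petals n)
    ≡⟨ cong₂ _+_ (sum-const (n ℕ.* 2) 1ℤ) (pairs-petals n) ⟩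
  pos (n ℕ.* 2) * 1ℤ + pos n
    ≡⟨ cong (λ m → m * 1ℤ + pos n) (ℤ.pos-* n 2) ⟩
  pos n * pos 2 * 1ℤ + pos n
    ≡⟨ eq (pos n) ⟩
  pos 3 * pos n ∎
  where
  eq : ∀ n → n * pos 2 * 1ℤ + n ≡ pos 3 * n
  eq = solve-∀

module _ (x : ℤ) where

  -- Without the common vertex the graph is a perfect matching, so every column of A contains a
  -- single 1. The point is that a constant row becomes, after scaling by x - 1, a combination of
  -- the rows of x - A.
  petals-column-sum : ∀ n j → sum (λ i → charMatrix x 1ℤ (petals n) i j) ≡ x - 1ℤ
  petals-column-sum (suc n) zero = begin
    (x * 1ℤ - 1ℤ * 0ℤ) + ((x * 0ℤ - 1ℤ * 1ℤ) + sum (λ (i : Fin (n ℕ.* 2)) → x * 0ℤ - 1ℤ * 0ℤ))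
      ≡⟨ cong (λ s → (x * 1ℤ - 1ℤ * 0ℤ) + ((x * 0ℤ - 1ℤ * 1ℤ) + s)) (sum-0 (λ (i : Fin (n ℕ.* 2)) → x * 0ℤ - 1ℤ * 0ℤ) λ _ → off x) ⟩
    (x * 1ℤ - 1ℤ * 0ℤ) + ((x * 0ℤ - 1ℤ * 1ℤ) + 0ℤ)
      ≡⟨ eq x ⟩
    x - 1ℤ ∎
    where
    off : ∀ x → x * 0ℤ - 1ℤ * 0ℤ ≡ 0ℤ
    off = solve-∀
    eq : ∀ x → (x * 1ℤ - 1ℤ * 0ℤ) + ((x * 0ℤ - 1ℤ * 1ℤ) + 0ℤ) ≡ x - 1ℤ
    eq = solve-∀
  petals-column-sum (suc n) (suc zero) = begin
    (x * 0ℤ - 1ℤ * 1ℤ) + ((x * 1ℤ - 1ℤ * 0ℤ) + sum (λ (i : Fin (n ℕ.* 2)) → x * 0ℤ - 1ℤ * 0ℤ))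
      ≡⟨ cong (λ s → (x * 0ℤ - 1ℤ * 1ℤ) + ((x * 1ℤ - 1ℤ * 0ℤ) + s)) (sum-0 (λ (i : Fin (n ℕ.* 2)) → x * 0ℤ - 1ℤ * 0ℤ) λ _ → off x) ⟩
    (x * 0ℤ - 1ℤ * 1ℤ) + ((x * 1ℤ - 1ℤ * 0ℤ) + 0ℤ)
      ≡⟨ eq x ⟩
    x - 1ℤ ∎
    where
    off : ∀ x → x * 0ℤ - 1ℤ * 0ℤ ≡ 0ℤ
    off = solve-∀
    eq : ∀ x → (x * 0ℤ - 1ℤ * 1ℤ) + ((x * 1ℤ - 1ℤ * 0ℤ) + 0ℤ) ≡ x - 1ℤ
    eq = solve-∀
  petals-column-sum (suc n) (suc (suc j)) = begin
    (x * 0ℤ - 1ℤ * 0ℤ) + ((x * 0ℤ - 1ℤ * 0ℤ) + sum (λ i → charMatrix x 1ℤ (petals n) i j))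
      ≡⟨ cong (λ s → (x * 0ℤ - 1ℤ * 0ℤ) + ((x * 0ℤ - 1ℤ * 0ℤ) + s)) (petals-column-sum n j) ⟩
    (x * 0ℤ - 1ℤ * 0ℤ) + ((x * 0ℤ - 1ℤ * 0ℤ) + (x - 1ℤ))
      ≡⟨ eq x ⟩
    x - 1ℤ ∎
    where
    eq : ∀ x → (x * 0ℤ - 1ℤ * 0ℤ) + ((x * 0ℤ - 1ℤ * 0ℤ) + (x - 1ℤ)) ≡ x - 1ℤ
    eq = solve-∀

  det-petals : ∀ n → det (charMatrix x 1ℤ (petals n)) ≡ (x * x - 1ℤ) ^ n
  det-petals zero    = refl
  det-petals (suc n) = begin
    det M
      ≡⟨ det-bordered M ⟩
    M zero zero * det M′ - (M (suc zero) zero * det (replace zero q M′)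
        + sum (λ i → M (suc (suc i)) zero * det (replace (suc i) q M′)))
      ≡⟨ cong₂ (λ a b → M zero zero * a - b)
           (trans (det-first-column M′ (λ _ → off x)) (cong (M′ zero zero *_) (det-petals n)))
           (cong₂ (λ a b → M (suc zero) zero * a + b)
             (trans (det-first-column (replace zero q M′) (λ _ → off x)) (cong (q zero *_) (det-petals n)))
             (sum-0 (λ i → M (suc (suc i)) zero * det (replace (suc i) q M′))
               λ i → cong (_* det (replace (suc i) q M′)) (off x))) ⟩
    M zero zero * (M′ zero zero * D) - (M (suc zero) zero * (q zero * D) + 0ℤ)
      ≡⟨ eq x D ⟩
    (x * x - 1ℤ) * D ∎
    where
    D = (x * x - 1ℤ) ^ n
    M = charMatrix x 1ℤ (petals (suc n))
    M′ : Rows (suc (n ℕ.* 2)) (suc (n ℕ.* 2))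
    M′ i j = M (suc i) (suc j)
    q : Row (suc (n ℕ.* 2))
    q = M zero ∘ suc
    off : ∀ x → x * 0ℤ - 1ℤ * 0ℤ ≡ 0ℤ
    off = solve-∀
    eq : ∀ x d → (x * 1ℤ - 1ℤ * 0ℤ) * ((x * 1ℤ - 1ℤ * 0ℤ) * d)
      - ((x * 0ℤ - 1ℤ * 1ℤ) * ((x * 0ℤ - 1ℤ * 1ℤ) * d) + 0ℤ) ≡ (x * x - 1ℤ) * d
    eq = solve-∀

  -- The factor x - 1 on the left avoids a division. In the bordered expansion each of the 2n border
  -- determinants has a row constantly -1; scaled by x - 1 this row is minus the sum of all rows, so
  -- the determinant becomes -det P.
  det-friendship : ∀ n → (x - 1ℤ) * det (charMatrix x 1ℤ (adjℤ (friendshipGraph n)))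
    ≡ (x * x - x - pos 2 * pos n) * (x * x - 1ℤ) ^ n
  det-friendship n = begin
    (x - 1ℤ) * det M
      ≡⟨ cong ((x - 1ℤ) *_) (det-bordered M) ⟩
    (x - 1ℤ) * (M zero zero * det P - sum (λ i → m * det (replace i q P)))
      ≡⟨ cong (λ s → (x - 1ℤ) * (M zero zero * det P - s)) (sym (*-distribˡ-sum m λ i → det (replace i q P))) ⟩
    (x - 1ℤ) * (M zero zero * det P - m * sum (λ i → det (replace i q P)))
      ≡⟨ eq₁ x (det P) (sum (λ i → det (replace i q P))) ⟩
    x * (x - 1ℤ) * det P + (x - 1ℤ) * sum (λ i → det (replace i q P))
      ≡⟨ cong (x * (x - 1ℤ) * det P +_) (trans (*-distribˡ-sum (x - 1ℤ) λ i → det (replace i q P))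
           (trans (sum-cong-≗ border) (sum-const (n ℕ.* 2) (-1ℤ * det P)))) ⟩
    x * (x - 1ℤ) * det P + pos (n ℕ.* 2) * (-1ℤ * det P)
      ≡⟨ cong₂ (λ a b → x * (x - 1ℤ) * a + b * (-1ℤ * a)) (det-petals n) (ℤ.pos-* n 2) ⟩
    x * (x - 1ℤ) * D + pos n * pos 2 * (-1ℤ * D)
      ≡⟨ eq₂ x (pos n) D ⟩
    (x * x - x - pos 2 * pos n) * D ∎
    where
    D = (x * x - 1ℤ) ^ n
    M = charMatrix x 1ℤ (adjℤ (friendshipGraph n))
    P = charMatrix x 1ℤ (petals n)
    m : ℤ
    m = x * 0ℤ - 1ℤ * 1ℤ
    q : Row (n ℕ.* 2)
    q _ = m
    border : ∀ i → (x - 1ℤ) * det (replace i q P) ≡ -1ℤ * det P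
    border i = begin
      (x - 1ℤ) * det (replace i q P)
        ≡⟨ sym (det-replace-scale i (x - 1ℤ) {q} P λ j → trans (sym (*-distribˡ-sum -1ℤ λ l → P l j))
             (trans (cong (-1ℤ *_) (petals-column-sum n j)) (eq₀ x))) ⟩
      det (replace i (λ j → sum λ l → -1ℤ * P l j) P)
        ≡⟨ det-replace i (λ _ → -1ℤ) P ⟩
      -1ℤ * det P ∎
      where
      eq₀ : ∀ x → -1ℤ * (x - 1ℤ) ≡ (x - 1ℤ) * (x * 0ℤ - 1ℤ * 1ℤ)
      eq₀ = solve-∀
    eq₁ : ∀ x d s → (x - 1ℤ) * ((x * 1ℤ - 1ℤ * 0ℤ) * d - (x * 0ℤ - 1ℤ * 1ℤ) * s)
        ≡ x * (x - 1ℤ) * d + (x - 1ℤ) * s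
    eq₁ = solve-∀
    eq₂ : ∀ x n d → x * (x - 1ℤ) * d + n * pos 2 * (-1ℤ * d) ≡ (x * x - x - pos 2 * n) * d
    eq₂ = solve-∀

-- Symmetric integer matrices

infix 4 0≤_
-- Inequalities are kept in this unary form so that a ring identity, through `subst`, turns one into
-- another.
0≤_ : ℤ → Set
0≤ x = 0ℤ ≤ x

0≤-+ : ∀ {a b} → 0≤ a → 0≤ b → 0≤ a + b
0≤-+ p q = ℤ.+-mono-≤ p q

0≤-* : ∀ {a b} → 0≤ a → 0≤ b → 0≤ a * b
0≤-* {pos a} {pos b} _ _ = subst 0≤_ (ℤ.pos-* a b) (ℤᵇ.+≤+ ℕ.z≤n)

0≤-square : ∀ a → 0≤ a * a
0≤-square (pos a)       = 0≤-* {pos a} {pos a} (ℤᵇ.+≤+ ℕ.z≤n) (ℤᵇ.+≤+ ℕ.z≤n)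
0≤-square ℤᵇ.-[1+ a ] = ℤᵇ.+≤+ ℕ.z≤n

0≤-cancel : ∀ {a b} → 1ℤ ≤ a → 0≤ a * b → 0≤ b
0≤-cancel {a}     {pos b}         _ _ = ℤᵇ.+≤+ ℕ.z≤n
0≤-cancel {pos (suc a)} {ℤᵇ.-[1+ b ]} _ ()
0≤-cancel {pos zero} {ℤᵇ.-[1+ b ]} (ℤᵇ.+≤+ ()) _

0≤-antisym : ∀ {a} → 0≤ a → 0≤ - a → a ≡ 0ℤ
0≤-antisym {pos zero} _ _ = refl
0≤-antisym {pos (suc a)} _ ()

≤⇒0≤ : ∀ {a b} → a ≤ b → 0≤ b - a
≤⇒0≤ = ℤ.i≤j⇒0≤j-i

0≤⇒≤ : ∀ {a b} → 0≤ b - a → a ≤ b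
0≤⇒≤ = ℤ.0≤i-j⇒j≤i

square-0 : ∀ a → a * a ≡ 0ℤ → a ≡ 0ℤ
square-0 a e with ℤ.i*j≡0⇒i≡0∨j≡0 a e
... | inj₁ p = p
... | inj₂ p = p

0≤-sum : ∀ {n} (f : Row n) → (∀ i → 0≤ f i) → 0≤ sum f
0≤-sum {zero}  f p = ℤᵇ.+≤+ ℕ.z≤n
0≤-sum {suc n} f p = 0≤-+ (p zero) (0≤-sum (f ∘ suc) (p ∘ suc))

0≤-sum-0 : ∀ {n} (f : Row n) → (∀ i → 0≤ f i) → sum f ≡ 0ℤ → ∀ i → f i ≡ 0ℤ
0≤-sum-0 {suc n} f p e = λ where
    zero    → head
    (suc i) → 0≤-sum-0 (f ∘ suc) (p ∘ suc) tail i
  where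
  tail≥ : 0≤ sum (f ∘ suc)
  tail≥ = 0≤-sum (f ∘ suc) (p ∘ suc)
  neg : ∀ a b → a + b ≡ 0ℤ → b ≡ - a
  neg a b e = trans (sym (ℤ.+-identityˡ b)) (trans (cong (_+ b) (sym (ℤ.+-inverseˡ a)))
    (trans (ℤ.+-assoc (- a) a b) (trans (cong (- a +_) e) (ℤ.+-identityʳ (- a)))))
  head : f zero ≡ 0ℤ
  head = 0≤-antisym (p zero) (subst 0≤_ (neg (f zero) _ e) tail≥)
  tail : sum (f ∘ suc) ≡ 0ℤ
  tail = trans (neg (f zero) _ e) (cong -_ head)

⟨_,_⟩ : ∀ {n} → Row n → Row n → ℤ
⟨ u , v ⟩ = sum λ i → u i * v i

⟨⟩-cong : ∀ {n} {u u′ v v′ : Row n} → u ≗ u′ → v ≗ v′ → ⟨ u , v ⟩ ≡ ⟨ u′ , v′ ⟩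
⟨⟩-cong e f = sum-cong-≗ λ i → cong₂ _*_ (e i) (f i)

⟨⟩-comm : ∀ {n} (u v : Row n) → ⟨ u , v ⟩ ≡ ⟨ v , u ⟩
⟨⟩-comm u v = sum-cong-≗ λ i → ℤ.*-comm (u i) (v i)

infixl 6 _∔_
infixr 7 _·_
_∔_ : ∀ {n} → Row n → Row n → Row n
(u ∔ v) i = u i + v i
_·_ : ∀ {n} → ℤ → Row n → Row n
(a · u) i = a * u i

⟨⟩-lin : ∀ {n} a (u v w : Row n) → ⟨ a · u ∔ v , w ⟩ ≡ a * ⟨ u , w ⟩ + ⟨ v , w ⟩
⟨⟩-lin a u v w = trans (sum-cong-≗ λ i → eq a (u i) (v i) (w i)) (sum-lin a (λ i → u i * w i) (λ i → v i * w i))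
  where
  eq : ∀ a u v w → (a * u + v) * w ≡ a * (u * w) + v * w
  eq = solve-∀

⟨⟩-linʳ : ∀ {n} a (u v w : Row n) → ⟨ w , a · u ∔ v ⟩ ≡ a * ⟨ w , u ⟩ + ⟨ w , v ⟩
⟨⟩-linʳ a u v w = trans (⟨⟩-comm w (a · u ∔ v)) (trans (⟨⟩-lin a u v w)
  (cong₂ (λ x y → a * x + y) (⟨⟩-comm u w) (⟨⟩-comm v w)))

⟨⟩-0 : ∀ {n} (u : Row n) → ⟨ u , u ⟩ ≡ 0ℤ → ∀ i → u i ≡ 0ℤ
⟨⟩-0 u e i = square-0 (u i) (0≤-sum-0 (λ i → u i * u i) (λ i → 0≤-square (u i)) e i)

module SymmetricMatrix {N : ℕ} (A : Rows N N) (A-sym : ∀ i j → A i j ≡ A j i) where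

  M : Row N → Row N
  M v i = sum λ j → A i j * v j

  M-cong : ∀ {u v} → u ≗ v → M u ≗ M v
  M-cong e i = sum-cong-≗ λ j → cong (A i j *_) (e j)

  M-lin : ∀ a u v → M (a · u ∔ v) ≗ a · M u ∔ M v
  M-lin a u v i = ⟨⟩-linʳ a u v (A i)

  M-adj : ∀ u v → ⟨ M u , v ⟩ ≡ ⟨ u , M v ⟩
  M-adj u v = begin
    sum (λ i → sum (λ j → A i j * u j) * v i)
      ≡⟨ sum-cong-≗ (λ i → trans (ℤ.*-comm (M u i) (v i)) (*-distribˡ-sum (v i) λ j → A i j * u j)) ⟩
    sum (λ i → sum λ j → v i * (A i j * u j))
      ≡⟨ ∑-comm (λ i j → v i * (A i j * u j)) ⟩
    sum (λ j → sum λ i → v i * (A i j * u j))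
      ≡⟨ sum-cong-≗ (λ j → trans (sum-cong-≗ λ i → trans (cong (λ a → v i * (a * u j)) (A-sym i j)) (eq (v i) (A j i) (u j)))
           (sym (*-distribˡ-sum (u j) λ i → A j i * v i))) ⟩
    sum (λ j → u j * sum (λ i → A j i * v i)) ∎
    where
    eq : ∀ v a u → v * (a * u) ≡ u * (a * v)
    eq = solve-∀

  -- The value at A of the polynomial with the given coefficients, constant term first.
  ev : List ℤ → Row N → Row N
  ev []       v _ = 0ℤ
  ev (a ∷ as) v   = a · v ∔ ev as (M v)

  evalℤ : List ℤ → ℤ → ℤ
  evalℤ []       x = 0ℤ
  evalℤ (a ∷ as) x = a + evalℤ as x * x

  ev-cong : ∀ as {u v} → u ≗ v → ev as u ≗ ev as v
  ev-cong []       e i = refl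
  ev-cong (a ∷ as) e i = cong₂ (λ x y → a * x + y) (e i) (ev-cong as (M-cong e) i)

  M-0 : ∀ i → M (λ _ → 0ℤ) i ≡ 0ℤ
  M-0 i = sum-0 (λ j → A i j * 0ℤ) λ j → ℤ.*-zeroʳ (A i j)

  ev-M : ∀ as v → ev as (M v) ≗ M (ev as v)
  ev-M []       v i = sym (M-0 i)
  ev-M (a ∷ as) v i = trans (cong (a * M v i +_) (ev-M as (M v) i)) (sym (M-lin a v (ev as (M v)) i))

  0ᵛ : Row N
  0ᵛ _ = 0ℤ

  ⟨⟩-zero : ∀ u → ⟨ 0ᵛ , u ⟩ ≡ 0ℤ
  ⟨⟩-zero u = sum-0 (λ i → 0ℤ * u i) λ _ → refl

  ev-adj : ∀ as u v → ⟨ ev as u , v ⟩ ≡ ⟨ u , ev as v ⟩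
  ev-adj []       u v = trans (⟨⟩-zero v) (trans (sym (⟨⟩-zero u)) (⟨⟩-comm 0ᵛ u))
  ev-adj (a ∷ as) u v = begin
    ⟨ a · u ∔ ev as (M u) , v ⟩
      ≡⟨ ⟨⟩-lin a u (ev as (M u)) v ⟩
    a * ⟨ u , v ⟩ + ⟨ ev as (M u) , v ⟩
      ≡⟨ cong (a * ⟨ u , v ⟩ +_) (trans (ev-adj as (M u) v) (trans (M-adj u (ev as v))
           (⟨⟩-cong {u = u} (λ _ → refl) (λ i → sym (ev-M as v i))))) ⟩
    a * ⟨ u , v ⟩ + ⟨ u , ev as (M v) ⟩
      ≡⟨ sym (⟨⟩-linʳ a v (ev as (M v)) u) ⟩
    ⟨ u , a · v ∔ ev as (M v) ⟩ ∎

  infix 4 _≈[_]_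
  -- Congruence modulo the image of x − A.
  record _≈[_]_ (u : Row N) (x : ℤ) (v : Row N) : Set where
    constructor image
    field
      witness  : Row N
      equation : ∀ i → u i ≡ v i + (x * witness i - M witness i)

  open _≈[_]_

  ≈-lin : ∀ {x u u′ v v′} a → u ≈[ x ] u′ → v ≈[ x ] v′ → a · u ∔ v ≈[ x ] a · u′ ∔ v′
  ≈-lin {x} {u} {u′} {v} {v′} a (image w e) (image w′ e′) = image (a · w ∔ w′) λ i → begin
    a * u i + v i
      ≡⟨ cong₂ (λ p q → a * p + q) (e i) (e′ i) ⟩
    a * (u′ i + (x * w i - M w i)) + (v′ i + (x * w′ i - M w′ i))
      ≡⟨ eq a x (u′ i) (w i) (M w i) (v′ i) (w′ i) (M w′ i) ⟩
    (a * u′ i + v′ i) + (x * (a * w i + w′ i) - (a * M w i + M w′ i))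
      ≡⟨ cong (λ m → (a * u′ i + v′ i) + (x * (a * w i + w′ i) - m)) (sym (M-lin a w w′ i)) ⟩
    (a * u′ i + v′ i) + (x * (a * w i + w′ i) - M (a · w ∔ w′) i) ∎
    where
    eq : ∀ a x u w m v w′ m′ → a * (u + (x * w - m)) + (v + (x * w′ - m′))
       ≡ (a * u + v) + (x * (a * w + w′) - (a * m + m′))
    eq = solve-∀

  ≈-refl : ∀ {x u v} → u ≗ v → u ≈[ x ] v
  ≈-refl {x} {u} {v} e = image (λ _ → 0ℤ) λ i → trans (e i)
    (trans (eq (v i) x) (cong (λ m → v i + (x * 0ℤ - m)) (sym (M-0 i))))
    where
    eq : ∀ v x → v ≡ v + (x * 0ℤ - 0ℤ)
    eq = solve-∀

  ≈-trans : ∀ {x u v w} → u ≈[ x ] v → v ≈[ x ] w → u ≈[ x ] w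
  ≈-trans {x} {u} {v} {w} (image s e) (image t f) = image (1ℤ · s ∔ t) λ i → begin
    u i
      ≡⟨ trans (e i) (cong (_+ (x * s i - M s i)) (f i)) ⟩
    (w i + (x * t i - M t i)) + (x * s i - M s i)
      ≡⟨ eq (w i) x (t i) (M t i) (s i) (M s i) ⟩
    w i + (x * (1ℤ * s i + t i) - (1ℤ * M s i + M t i))
      ≡⟨ cong (λ m → w i + (x * (1ℤ * s i + t i) - m)) (sym (M-lin 1ℤ s t i)) ⟩
    w i + (x * (1ℤ * s i + t i) - M (1ℤ · s ∔ t) i) ∎
    where
    eq : ∀ w x t m s m′ → (w + (x * t - m)) + (x * s - m′) ≡ w + (x * (1ℤ * s + t) - (1ℤ * m′ + m))
    eq = solve-∀

  ≈-sym : ∀ {x u v} → u ≈[ x ] v → v ≈[ x ] u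
  ≈-sym {x} {u} {v} (image w e) = image (-1ℤ · w ∔ 0ᵛ) λ i → begin
    v i
      ≡⟨ eq (v i) x (w i) (M w i) ⟩
    (v i + (x * w i - M w i)) + (x * (-1ℤ * w i + 0ℤ) - (-1ℤ * M w i + 0ℤ))
      ≡⟨ cong₂ (λ p m → p + (x * (-1ℤ * w i + 0ℤ) - m)) (sym (e i))
           (sym (trans (M-lin -1ℤ w 0ᵛ i) (cong (-1ℤ * M w i +_) (M-0 i)))) ⟩
    u i + (x * (-1ℤ * w i + 0ℤ) - M (-1ℤ · w ∔ 0ᵛ) i) ∎
    where
    eq : ∀ v x w m → v ≡ (v + (x * w - m)) + (x * (-1ℤ * w + 0ℤ) - (-1ℤ * m + 0ℤ))
    eq = solve-∀

  ≈-scale : ∀ {x u v} a → u ≈[ x ] v → a · u ≈[ x ] a · v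
  ≈-scale {x} {u} {v} a r = ≈-trans (≈-refl (λ i → sym (ℤ.+-identityʳ (a * u i))))
    (≈-trans (≈-lin a r (≈-refl {u = 0ᵛ} {0ᵛ} (λ _ → refl))) (≈-refl (λ i → ℤ.+-identityʳ (a * v i))))

  x≈M : ∀ x v → x · v ≈[ x ] M v
  x≈M x v = image v λ i → eq (x * v i) (M v i)
    where
    eq : ∀ a b → a ≡ b + (a - b)
    eq = solve-∀

  -- Modulo the image of x - A the matrix A acts as the scalar x, so a polynomial in A acts as its
  -- value at x.
  eval≈ev : ∀ x as v → evalℤ as x · v ≈[ x ] ev as v
  eval≈ev x []       v = ≈-refl (λ _ → refl)
  eval≈ev x (a ∷ as) v = ≈-trans (≈-refl (λ i → eq a (evalℤ as x) x (v i)))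
    (≈-lin a (≈-refl {u = v} (λ _ → refl))
      (≈-trans (≈-scale (evalℤ as x) (x≈M x v)) (eval≈ev x as (M v))))
    where
    eq : ∀ a b x v → (a + b * x) * v ≡ a * v + b * (x * v)
    eq = solve-∀

  ev^ : List ℤ → ℕ → Row N → Row N
  ev^ as zero    v = v
  ev^ as (suc k) v = ev^ as k (ev as v)

  ev^-out : ∀ as k v → ev^ as (suc k) v ≗ ev as (ev^ as k v)
  ev^-out as zero    v i = refl
  ev^-out as (suc k) v i = ev^-out as k (ev as v) i

  eval^≈ev^ : ∀ x as k v → evalℤ as x ^ k · v ≈[ x ] ev^ as k v
  eval^≈ev^ x as zero    v = ≈-refl (λ i → ℤ.*-identityˡ (v i))
  eval^≈ev^ x as (suc k) v = ≈-trans (≈-refl λ i → eq (evalℤ as x) (evalℤ as x ^ k) (v i))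
    (≈-trans (≈-scale (evalℤ as x ^ k) (eval≈ev x as v)) (eval^≈ev^ x as k (ev as v)))
    where
    eq : ∀ a b v → a * b * v ≡ b * (a * v)
    eq = solve-∀

  -- For a self-adjoint operator F, F (F w) = 0 gives ⟨F w , F w⟩ = ⟨w , F (F w)⟩ = 0.
  ev²-0 : ∀ as w → (∀ i → ev as (ev as w) i ≡ 0ℤ) → ∀ i → ev as w i ≡ 0ℤ
  ev²-0 as w e = ⟨⟩-0 (ev as w) (trans (ev-adj as w (ev as w))
    (sum-0 (λ i → w i * ev as (ev as w) i) λ i → trans (cong (w i *_) (e i)) (ℤ.*-zeroʳ (w i))))

  -- A self-adjoint operator has no nilpotent part: `ev²-0` strips the exponent one factor at a
  -- time.
  ev^-0 : ∀ as k w → (∀ i → ev^ as (suc k) w i ≡ 0ℤ) → ∀ i → ev as w i ≡ 0ℤ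
  ev^-0 as zero    w e = e
  ev^-0 as (suc k) w e = ev^-0 as k w λ i → trans (ev^-out as k w i)
    (ev²-0 as (ev^ as k w) (λ i → trans (sym (trans (ev^-out as (suc k) w i)
      (ev-cong as (ev^-out as k w) i))) (e i)) i)

  -- Cramer's rule supplies an integral preimage of det(x - A) v under x - A.
  det-kills : ∀ x v → (λ i → det (charMatrix x 1ℤ A) * v i) ≈[ x ] 0ᵛ
  det-kills x v = let u , e = cramer (charMatrix x 1ℤ A) v in image u λ i → begin
    det (charMatrix x 1ℤ A) * v i
      ≡⟨ sym (e i) ⟩
    sum (λ j → (x * δ i j - 1ℤ * A i j) * u j)
      ≡⟨ sum-cong-≗ (λ j → eq x (δ i j) (A i j) (u j)) ⟩
    sum (λ j → x * (δ i j * u j) + -1ℤ * (A i j * u j))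
      ≡⟨ sum-lin x (λ j → δ i j * u j) (λ j → -1ℤ * (A i j * u j)) ⟩
    x * sum (λ j → δ i j * u j) + sum (λ j → -1ℤ * (A i j * u j))
      ≡⟨ cong₂ (λ a b → x * a + b) (sum-δ i u) (sym (*-distribˡ-sum -1ℤ λ j → A i j * u j)) ⟩
    x * u i + -1ℤ * M u i
      ≡⟨ eq′ (x * u i) (M u i) ⟩
    0ℤ + (x * u i - M u i) ∎
    where
    eq : ∀ x d a u → (x * d - 1ℤ * a) * u ≡ x * (d * u) + -1ℤ * (a * u)
    eq = solve-∀
    eq′ : ∀ a b → a + -1ℤ * b ≡ 0ℤ + (a - b)
    eq′ = solve-∀

  -- w is in the image of x − A for arbitrarily large x, where x − A is expanding.
  divisible-0 : ∀ K → 0≤ K → (∀ u → 0≤ K * ⟨ u , u ⟩ - ⟨ M u , u ⟩) →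
    ∀ w → (∀ x → w ≈[ x ] 0ᵛ) → ∀ i → w i ≡ 0ℤ
  divisible-0 K K≥0 bound w h i = begin
    w i                        ≡⟨ w-eq i ⟩
    0ℤ + (x * u i - M u i)     ≡⟨ cong₂ (λ a b → 0ℤ + (x * a - b)) (u-0 i) (trans (M-cong u-0 i) (M-0 i)) ⟩
    0ℤ + (x * 0ℤ - 0ℤ)         ≡⟨ eq x ⟩
    0ℤ                         ∎
    where
    eq : ∀ x → 0ℤ + (x * 0ℤ - 0ℤ) ≡ 0ℤ
    eq = solve-∀
    W = ⟨ w , w ⟩
    -- Since ⟨A u, u⟩ ≤ K U, this x gives ⟨w, u⟩ ≥ (1 + W) U, while 2 ⟨w, u⟩ ≤ U + W. Together (2W +
    -- 1) U ≤ W, and the nonnegative integer U must be 0.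
    x = K + 1ℤ + W
    u = witness (h x)
    w-eq = equation (h x)
    U = ⟨ u , u ⟩
    w·u : ⟨ w , u ⟩ ≡ x * U - ⟨ M u , u ⟩
    w·u = begin
      ⟨ w , u ⟩                       ≡⟨ ⟨⟩-cong {v = u} (λ i → trans (w-eq i) (eq₁ x (u i) (M u i))) (λ _ → refl) ⟩
      ⟨ x · u ∔ -1ℤ · M u , u ⟩       ≡⟨ ⟨⟩-lin x u (-1ℤ · M u) u ⟩
      x * U + ⟨ -1ℤ · M u , u ⟩       ≡⟨ cong (x * U +_) (trans (sum-cong-≗ λ i → ℤ.*-assoc -1ℤ (M u i) (u i)) (sym (*-distribˡ-sum -1ℤ λ i → M u i * u i))) ⟩
      x * U + -1ℤ * ⟨ M u , u ⟩       ≡⟨ eq₂ (x * U) ⟨ M u , u ⟩ ⟩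
      x * U - ⟨ M u , u ⟩             ∎
      where
      eq₁ : ∀ x u m → 0ℤ + (x * u - m) ≡ x * u + -1ℤ * m
      eq₁ = solve-∀
      eq₂ : ∀ a m → a + -1ℤ * m ≡ a - m
      eq₂ = solve-∀
    amgm : 0≤ (U + W) - pos 2 * ⟨ w , u ⟩
    amgm = subst 0≤_ (begin
      ⟨ -1ℤ · w ∔ u , -1ℤ · w ∔ u ⟩
        ≡⟨ ⟨⟩-lin -1ℤ w u (-1ℤ · w ∔ u) ⟩
      -1ℤ * ⟨ w , -1ℤ · w ∔ u ⟩ + ⟨ u , -1ℤ · w ∔ u ⟩
        ≡⟨ cong₂ (λ a b → -1ℤ * a + b) (⟨⟩-linʳ -1ℤ w u w)
             (trans (⟨⟩-linʳ -1ℤ w u u) (cong (λ a → -1ℤ * a + U) (⟨⟩-comm u w))) ⟩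
      -1ℤ * (-1ℤ * W + ⟨ w , u ⟩) + (-1ℤ * ⟨ w , u ⟩ + U)
        ≡⟨ eq₃ W ⟨ w , u ⟩ U ⟩
      (U + W) - pos 2 * ⟨ w , u ⟩ ∎)
      (0≤-sum (λ i → (-1ℤ · w ∔ u) i * (-1ℤ · w ∔ u) i) λ i → 0≤-square ((-1ℤ · w ∔ u) i))
      where
      eq₃ : ∀ w c u → -1ℤ * (-1ℤ * w + c) + (-1ℤ * c + u) ≡ (u + w) - pos 2 * c
      eq₃ = solve-∀
    U≥0 : 0≤ U
    U≥0 = 0≤-sum (λ i → u i * u i) λ i → 0≤-square (u i)
    W≥0 : 0≤ W
    W≥0 = 0≤-sum (λ i → w i * w i) λ i → 0≤-square (w i)
    small : 0≤ W - (pos 2 * W + 1ℤ) * U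
    small = subst 0≤_ (trans (cong (λ c → (U + W - pos 2 * c) + pos 2 * (K * U - ⟨ M u , u ⟩)) w·u)
        (eq₄ K W U ⟨ M u , u ⟩))
      (0≤-+ amgm (0≤-* {pos 2} (ℤᵇ.+≤+ ℕ.z≤n) (bound u)))
      where
      eq₄ : ∀ k w u m → (u + w - pos 2 * ((k + 1ℤ + w) * u - m)) + pos 2 * (k * u - m)
          ≡ w - (pos 2 * w + 1ℤ) * u
      eq₄ = solve-∀
    U-0 : U ≡ 0ℤ
    U-0 = go W U W≥0 U≥0 small
      where
      go : ∀ w u → 0≤ w → 0≤ u → 0≤ w - (pos 2 * w + 1ℤ) * u → u ≡ 0ℤ
      go w (pos zero)    _ _ _ = refl
      go w (pos (suc u)) w≥0 _ h = ⊥-elim (absurd (subst 0≤_ (trans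
          (cong (λ s → (w - (pos 2 * w + 1ℤ) * s) + (pos 2 * w + 1ℤ) * pos u + w) (pos-suc u)) (eq₅ w (pos u)))
          (0≤-+ (0≤-+ h (0≤-* {pos 2 * w + 1ℤ} {pos u} (0≤-+ (0≤-* {pos 2} {w} (ℤᵇ.+≤+ ℕ.z≤n) w≥0) (ℤᵇ.+≤+ ℕ.z≤n)) (ℤᵇ.+≤+ ℕ.z≤n))) w≥0)))
        where
        absurd : 0≤ -1ℤ → ⊥
        absurd ()
        eq₅ : ∀ w u → (w - (pos 2 * w + 1ℤ) * (1ℤ + u)) + (pos 2 * w + 1ℤ) * u + w ≡ -1ℤ
        eq₅ = solve-∀
    u-0 : ∀ i → u i ≡ 0ℤ
    u-0 = ⟨⟩-0 u U-0

-- Adjacency matrices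

module Spectral (G : Graph) where
  open Graph G

  A : Rows order order
  A = adjℤ G

  A-sym : ∀ i j → A i j ≡ A j i
  A-sym i j = cong 1ᵇ (symmetric i j)

  A-loop : ∀ i → A i i ≡ 0ℤ
  A-loop i = cong 1ᵇ (irreflexive i)

  A-idem : ∀ i j → A i j * A i j ≡ A i j
  A-idem i j = 1ᵇ-idem (adj i j)

  0≤A : ∀ i j → 0≤ A i j
  0≤A i j with adj i j
  ... | true  = ℤᵇ.+≤+ ℕ.z≤n
  ... | false = ℤᵇ.+≤+ ℕ.z≤n

  open SymmetricMatrix A A-sym public

  deg : Vertex → ℤ
  deg u = sum (A u)

  non-neighbour : ∀ u v → 0≤ 1ℤ - δ u v - A u v
  non-neighbour u v with u ≟ᶠ v
  ... | yes refl rewrite A-loop u = ℤᵇ.+≤+ ℕ.z≤n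
  ... | no _ with adj u v
  ... | true  = ℤᵇ.+≤+ ℕ.z≤n
  ... | false = ℤᵇ.+≤+ ℕ.z≤n

  sum-non-neighbours : ∀ u → sum (λ v → 1ℤ - δ u v - A u v) ≡ pos order - 1ℤ - deg u
  sum-non-neighbours u = begin
    sum (λ v → 1ℤ - δ u v - A u v)
      ≡⟨ sum-cong-≗ (λ v → eq (δ u v) (A u v)) ⟩
    sum (λ v → -1ℤ * (δ u v * 1ℤ) + (-1ℤ * A u v + 1ℤ))
      ≡⟨ sum-lin -1ℤ (λ v → δ u v * 1ℤ) (λ v → -1ℤ * A u v + 1ℤ) ⟩
    -1ℤ * sum (λ v → δ u v * 1ℤ) + sum (λ v → -1ℤ * A u v + 1ℤ)
      ≡⟨ cong₂ (λ a b → -1ℤ * a + b) (sum-δ u (λ _ → 1ℤ))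
           (trans (sum-lin -1ℤ (A u) (λ _ → 1ℤ)) (cong (-1ℤ * deg u +_) (sum-const order 1ℤ))) ⟩
    -1ℤ * 1ℤ + (-1ℤ * deg u + pos order * 1ℤ)
      ≡⟨ eq′ (pos order) (deg u) ⟩
    pos order - 1ℤ - deg u ∎
    where
    eq : ∀ d a → 1ℤ - d - a ≡ -1ℤ * (d * 1ℤ) + (-1ℤ * a + 1ℤ)
    eq = solve-∀
    eq′ : ∀ m d → -1ℤ * 1ℤ + (-1ℤ * d + m * 1ℤ) ≡ m - 1ℤ - d
    eq′ = solve-∀

  deg-bound : ∀ u → 0≤ pos order - 1ℤ - deg u
  deg-bound u = subst 0≤_ (sum-non-neighbours u) (0≤-sum (λ v → 1ℤ - δ u v - A u v) (non-neighbour u))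

  -- The difference is Σ (order - 1 - deg i) uᵢ² plus the Laplacian form, half the sum of Aᵢⱼ (uᵢ -
  -- uⱼ)² over ordered pairs. It is needed twice: as the bound K of `divisible-0`, and as the
  -- semidefiniteness of 2ν - A in `psd`.
  rayleigh-bound : ∀ u → 0≤ (pos order - 1ℤ) * ⟨ u , u ⟩ - ⟨ M u , u ⟩
  rayleigh-bound u = subst 0≤_ total (0≤-+ (0≤-sum slack slack≥0) laplacian≥0)
    where
    D : ℤ
    D = sum λ i → deg i * (u i * u i)
    slack : Row order
    slack i = (pos order - 1ℤ - deg i) * (u i * u i)
    slack≥0 : ∀ i → 0≤ slack i
    slack≥0 i = 0≤-* (deg-bound i) (0≤-square (u i))
    energy : Fin order → Row order
    energy i j = A i j * ((u i - u j) * (u i - u j))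
    rows : sum (λ i → sum λ j → A i j * (u i * u i)) ≡ D
    rows = sum-cong-≗ λ i → trans (sum-cong-≗ λ j → ℤ.*-comm (A i j) (u i * u i))
      (trans (sym (*-distribˡ-sum (u i * u i) (A i))) (ℤ.*-comm (u i * u i) (deg i)))
    columns : sum (λ i → sum λ j → A i j * (u j * u j)) ≡ D
    columns = trans (∑-comm λ i j → A i j * (u j * u j))
      (trans (sum-cong-≗ λ j → sum-cong-≗ λ i → cong (_* (u j * u j)) (A-sym i j)) rows)
    cross : sum (λ i → sum λ j → A i j * (u i * u j)) ≡ ⟨ M u , u ⟩
    cross = sum-cong-≗ λ i → trans (sum-cong-≗ λ j → eq (A i j) (u i) (u j))
      (trans (sym (*-distribˡ-sum (u i) λ j → A i j * u j)) (ℤ.*-comm (u i) (M u i)))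
      where
      eq : ∀ a u v → a * (u * v) ≡ u * (a * v)
      eq = solve-∀
    row-energy : ∀ i → sum (energy i) ≡ sum (λ j → A i j * (u i * u i))
      + (sum (λ j → A i j * (u j * u j)) + - pos 2 * sum (λ j → A i j * (u i * u j)))
    row-energy i = begin
      sum (energy i)
        ≡⟨ sum-cong-≗ (λ j → eq (A i j) (u i) (u j)) ⟩
      sum (λ j → A i j * (u i * u i) + (- pos 2 * (A i j * (u i * u j)) + A i j * (u j * u j)))
        ≡⟨ ∑-distrib-+ (λ j → A i j * (u i * u i)) _ ⟩
      sum (λ j → A i j * (u i * u i)) + sum (λ j → - pos 2 * (A i j * (u i * u j)) + A i j * (u j * u j))
        ≡⟨ cong (sum (λ j → A i j * (u i * u i)) +_) (trans
             (sum-lin (- pos 2) (λ j → A i j * (u i * u j)) (λ j → A i j * (u j * u j)))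
             (ℤ.+-comm (- pos 2 * sum (λ j → A i j * (u i * u j))) (sum (λ j → A i j * (u j * u j))))) ⟩
      _ ∎
      where
      eq : ∀ a u v → a * ((u - v) * (u - v)) ≡ a * (u * u) + (- pos 2 * (a * (u * v)) + a * (v * v))
      eq = solve-∀
    laplacian : sum (λ i → sum (energy i)) ≡ pos 2 * (D - ⟨ M u , u ⟩)
    laplacian = begin
      sum (λ i → sum (energy i))
        ≡⟨ sum-cong-≗ row-energy ⟩
      sum (λ i → sum (λ j → A i j * (u i * u i))
        + (sum (λ j → A i j * (u j * u j)) + - pos 2 * sum (λ j → A i j * (u i * u j))))
        ≡⟨ ∑-distrib-+ (λ i → sum (λ j → A i j * (u i * u i))) _ ⟩
      sum (λ i → sum (λ j → A i j * (u i * u i)))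
        + sum (λ i → sum (λ j → A i j * (u j * u j)) + - pos 2 * sum (λ j → A i j * (u i * u j)))
        ≡⟨ cong (sum (λ i → sum (λ j → A i j * (u i * u i))) +_)
             (∑-distrib-+ (λ i → sum (λ j → A i j * (u j * u j))) (λ i → - pos 2 * sum (λ j → A i j * (u i * u j)))) ⟩
      sum (λ i → sum (λ j → A i j * (u i * u i)))
        + (sum (λ i → sum (λ j → A i j * (u j * u j))) + sum (λ i → - pos 2 * sum (λ j → A i j * (u i * u j))))
        ≡⟨ cong₂ _+_ rows (cong₂ _+_ columns
             (trans (sym (*-distribˡ-sum (- pos 2) λ i → sum (λ j → A i j * (u i * u j)))) (cong (- pos 2 *_) cross))) ⟩
      D + (D + - pos 2 * ⟨ M u , u ⟩)
        ≡⟨ eq D ⟨ M u , u ⟩ ⟩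
      pos 2 * (D - ⟨ M u , u ⟩) ∎
      where
      eq : ∀ d m → d + (d + - pos 2 * m) ≡ pos 2 * (d - m)
      eq = solve-∀
    laplacian≥0 : 0≤ D - ⟨ M u , u ⟩
    laplacian≥0 = 0≤-cancel {pos 2} (ℤᵇ.+≤+ (ℕ.s≤s ℕ.z≤n)) (subst 0≤_ laplacian
      (0≤-sum (λ i → sum (energy i)) λ i → 0≤-sum (energy i) λ j →
        0≤-* (0≤A i j) (0≤-square (u i - u j))))
    total : sum slack + (D - ⟨ M u , u ⟩) ≡ (pos order - 1ℤ) * ⟨ u , u ⟩ - ⟨ M u , u ⟩
    total = begin
      sum slack + (D - ⟨ M u , u ⟩)
        ≡⟨ cong (_+ (D - ⟨ M u , u ⟩)) (trans (sum-cong-≗ λ i → eq (pos order - 1ℤ) (deg i) (u i * u i))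
             (trans (sum-lin (pos order - 1ℤ) (λ i → u i * u i) (λ i → -1ℤ * (deg i * (u i * u i))))
               (cong ((pos order - 1ℤ) * ⟨ u , u ⟩ +_) (sym (*-distribˡ-sum -1ℤ λ i → deg i * (u i * u i)))))) ⟩
      (pos order - 1ℤ) * ⟨ u , u ⟩ + -1ℤ * D + (D - ⟨ M u , u ⟩)
        ≡⟨ eq′ ((pos order - 1ℤ) * ⟨ u , u ⟩) D ⟨ M u , u ⟩ ⟩
      (pos order - 1ℤ) * ⟨ u , u ⟩ - ⟨ M u , u ⟩ ∎
      where
      eq : ∀ k d s → (k - d) * s ≡ k * s + -1ℤ * (d * s)
      eq = solve-∀
      eq′ : ∀ k d m → k + -1ℤ * d + (d - m) ≡ k - m
      eq′ = solve-∀

^-distrib-* : ∀ a b n → (a * b) ^ n ≡ a ^ n * b ^ n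
^-distrib-* a b zero    = refl
^-distrib-* a b (suc n) = trans (cong (a * b *_) (^-distrib-* a b n)) (eq a b (a ^ n) (b ^ n))
  where
  eq : ∀ a b c d → a * b * (c * d) ≡ a * c * (b * d)
  eq = solve-∀

-- (x² − 1)(x² − x − 2ν), whose roots are the distinct eigenvalues of the friendship graph.
minimal : ℤ → List ℤ
minimal ν = pos 2 * ν ∷ 1ℤ ∷ - (pos 2 * ν + 1ℤ) ∷ -1ℤ ∷ 1ℤ ∷ []

module Cospectrality (G : Graph) (n : ℕ) (cosp : Cospectral G (friendshipGraph n)) where
  open Graph G
  open Spectral G

  order-eq : pos order ≡ pos 2 * pos n + 1ℤ
  order-eq = begin
    pos order             ≡⟨ cong pos (cospectral-order {G} {friendshipGraph n} cosp) ⟩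
    pos (suc (n ℕ.* 2))   ≡⟨ pos-suc (n ℕ.* 2) ⟩
    1ℤ + pos (n ℕ.* 2)    ≡⟨ cong (1ℤ +_) (ℤ.pos-* n 2) ⟩
    1ℤ + pos n * pos 2    ≡⟨ eq (pos n) ⟩
    pos 2 * pos n + 1ℤ    ∎
    where
    eq : ∀ n → 1ℤ + n * pos 2 ≡ pos 2 * n + 1ℤ
    eq = solve-∀

  degree-total : sum deg ≡ pos 6 * pos n
  degree-total = begin
    sum deg
      ≡⟨ degree-sum adj symmetric irreflexive ⟩
    pos 2 * pairs A
      ≡⟨ cong (pos 2 *_) (pairs-det A (adjℤ (friendshipGraph n)) A-loop (Spectral.A-loop (friendshipGraph n))
           (cospectral-det {G} {friendshipGraph n} cosp 1ℤ)) ⟩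
    pos 2 * pairs (adjℤ (friendshipGraph n))
      ≡⟨ cong (pos 2 *_) (pairs-friendship n) ⟩
    pos 2 * (pos 3 * pos n)
      ≡⟨ eq (pos n) ⟩
    pos 6 * pos n ∎
    where
    eq : ∀ n → pos 2 * (pos 3 * n) ≡ pos 6 * n
    eq = solve-∀

  -- With q = x² - x - 2n, `det-friendship` reads (x - 1) det(x - A) = q (x² - 1)ⁿ. The exponent n +
  -- 1 leaves enough factors to extract the right-hand side.
  eval-minimal : ∀ x → ∃ λ c → evalℤ (minimal (pos n)) x ^ suc n ≡ c * det (charMatrix x 1ℤ A)
  eval-minimal x = q ^ n * (x * x - 1ℤ) * (x - 1ℤ) , (begin
    evalℤ (minimal (pos n)) x ^ suc n
      ≡⟨ cong (_^ suc n) (eq x (pos n)) ⟩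
    (q * (x * x - 1ℤ)) ^ suc n
      ≡⟨ ^-distrib-* q (x * x - 1ℤ) (suc n) ⟩
    q * q ^ n * ((x * x - 1ℤ) * (x * x - 1ℤ) ^ n)
      ≡⟨ eq₁ q (q ^ n) (x * x - 1ℤ) ((x * x - 1ℤ) ^ n) ⟩
    q ^ n * (x * x - 1ℤ) * (q * (x * x - 1ℤ) ^ n)
      ≡⟨ cong (q ^ n * (x * x - 1ℤ) *_) (sym (det-friendship x n)) ⟩
    q ^ n * (x * x - 1ℤ) * ((x - 1ℤ) * det (charMatrix x 1ℤ (adjℤ (friendshipGraph n))))
      ≡⟨ cong (λ d → q ^ n * (x * x - 1ℤ) * ((x - 1ℤ) * d)) (sym (cospectral-det {G} {friendshipGraph n} cosp x 1ℤ λ ())) ⟩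
    q ^ n * (x * x - 1ℤ) * ((x - 1ℤ) * det (charMatrix x 1ℤ A))
      ≡⟨ sym (ℤ.*-assoc (q ^ n * (x * x - 1ℤ)) (x - 1ℤ) (det (charMatrix x 1ℤ A))) ⟩
    q ^ n * (x * x - 1ℤ) * (x - 1ℤ) * det (charMatrix x 1ℤ A) ∎)
    where
    q = x * x - x - pos 2 * pos n
    eq : ∀ x n → pos 2 * n + (1ℤ + (- (pos 2 * n + 1ℤ) + (-1ℤ + (1ℤ + 0ℤ * x) * x) * x) * x) * x
       ≡ (x * x - x - pos 2 * n) * (x * x - 1ℤ)
    eq = solve-∀
    eq₁ : ∀ a b c d → a * b * (c * d) ≡ b * c * (a * d)
    eq₁ = solve-∀

  -- For each x the vector minimal(A)ⁿ⁺¹ v is congruent to minimal(x)ⁿ⁺¹ v, a multiple of det(x - A)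
  -- v, hence to 0 modulo the image of x - A. So it vanishes, and symmetry of A removes the
  -- exponent.
  annihilated : ∀ v i → ev (minimal (pos n)) v i ≡ 0ℤ
  annihilated v = ev^-0 (minimal (pos n)) n v (divisible-0 (pos order - 1ℤ) order-1≥0 rayleigh-bound
      (ev^ (minimal (pos n)) (suc n) v) λ x → let c , e = eval-minimal x in
        ≈-trans (≈-sym (eval^≈ev^ x (minimal (pos n)) (suc n) v))
        (≈-trans (≈-refl λ i → trans (cong (_* v i) e) (ℤ.*-assoc c (det (charMatrix x 1ℤ A)) (v i)))
        (≈-trans (≈-scale c (det-kills x v)) (≈-refl λ i → ℤ.*-zeroʳ c))))
    where
    order-1≥0 : 0≤ pos order - 1ℤ
    order-1≥0 = subst (λ k → 0≤ k - 1ℤ) (sym order-eq) (subst 0≤_ (eq (pos n))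
      (0≤-* {pos 2} {pos n} (ℤᵇ.+≤+ ℕ.z≤n) (ℤᵇ.+≤+ ℕ.z≤n)))
      where
      eq : ∀ n → pos 2 * n ≡ pos 2 * n + 1ℤ - 1ℤ
      eq = solve-∀

-- The form A² − 1

module Moments {N : ℕ} (A : Rows N N) (A-sym : ∀ i j → A i j ≡ A j i) where
  open SymmetricMatrix A A-sym

  M^ : ℕ → Row N → Row N
  M^ zero    v = v
  M^ (suc k) v = M (M^ k v)

  -- The moments ⟨Aᵏ u, v⟩. As A is self-adjoint, every inner product of polynomials in A applied to
  -- u and v is a combination of them.
  mom : ℕ → Row N → Row N → ℤ
  mom k u v = ⟨ M^ k u , v ⟩

  mom-shift : ∀ j k u v → ⟨ M^ j u , M^ k v ⟩ ≡ mom (k ℕ.+ j) u v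
  mom-shift j zero    u v = refl
  mom-shift j (suc k) u v = trans (sym (M-adj (M^ j u) (M^ k v)))
    (trans (mom-shift (suc j) k u v) (cong (λ l → mom l u v) (ℕ.+-suc k j)))

  mom-comm : ∀ k u v → mom k u v ≡ mom k v u
  mom-comm k u v = trans (⟨⟩-comm (M^ k u) v)
    (trans (mom-shift 0 k v u) (cong (λ l → mom l v u) (ℕ.+-identityʳ k)))

  M^-lin : ∀ k a u v → M^ k (a · u ∔ v) ≗ a · M^ k u ∔ M^ k v
  M^-lin zero    a u v i = refl
  M^-lin (suc k) a u v i = trans (M-cong (M^-lin k a u v) i) (M-lin a (M^ k u) (M^ k v) i)

  mom-lin : ∀ k a u v w → mom k (a · u ∔ v) w ≡ a * mom k u w + mom k v w
  mom-lin k a u v w = trans (⟨⟩-cong {v = w} (M^-lin k a u v) (λ _ → refl)) (⟨⟩-lin a (M^ k u) (M^ k v) w)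

  mom-M : ∀ k u v → mom k (M u) v ≡ mom (suc k) u v
  mom-M k u v = ⟨⟩-cong {v = v} (commute k) (λ _ → refl)
    where
    commute : ∀ k → M^ k (M u) ≗ M (M^ k u)
    commute zero    i = refl
    commute (suc k) i = M-cong (commute k) i

  mom-Mʳ : ∀ k u v → mom k u (M v) ≡ mom (suc k) u v
  mom-Mʳ k u v = mom-shift k 1 u v

  B : Row N → Row N
  B v = -1ℤ · v ∔ M (M v)

  β : Row N → Row N → ℤ
  β u v = mom 2 u v - mom 0 u v

  β-comm : ∀ u v → β u v ≡ β v u
  β-comm u v = cong₂ _-_ (mom-comm 2 u v) (mom-comm 0 u v)

  β-lin : ∀ a u v w → β (a · u ∔ v) w ≡ a * β u w + β v w
  β-lin a u v w = trans (cong₂ _-_ (mom-lin 2 a u v w) (mom-lin 0 a u v w))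
    (eq a (mom 2 u w) (mom 2 v w) (mom 0 u w) (mom 0 v w))
    where
    eq : ∀ a p q r s → (a * p + q) - (a * r + s) ≡ a * (p - r) + (q - s)
    eq = solve-∀

  β-linʳ : ∀ a u v w → β w (a · u ∔ v) ≡ a * β w u + β w v
  β-linʳ a u v w = trans (β-comm w (a · u ∔ v))
    (trans (β-lin a u v w) (cong₂ (λ p q → a * p + q) (β-comm u w) (β-comm v w)))

  β-0 : ∀ w → β 0ᵛ w ≡ 0ℤ
  β-0 w = trans (cong₂ _-_ (mom-0 2) (mom-0 0)) refl
    where
    M^-0 : ∀ k i → M^ k 0ᵛ i ≡ 0ℤ
    M^-0 zero    i = refl
    M^-0 (suc k) i = trans (M-cong (M^-0 k) i) (M-0 i)
    mom-0 : ∀ k → mom k 0ᵛ w ≡ 0ℤ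
    mom-0 k = trans (⟨⟩-cong {v = w} (M^-0 k) (λ _ → refl)) (⟨⟩-zero w)

  β-δ : ∀ j v → β (δ j) v ≡ B v j
  β-δ j v = begin
    mom 2 (δ j) v - mom 0 (δ j) v
      ≡⟨ cong (_- mom 0 (δ j) v) (trans (mom-comm 2 (δ j) v) (⟨⟩-comm (M (M v)) (δ j))) ⟩
    ⟨ δ j , M (M v) ⟩ - ⟨ δ j , v ⟩
      ≡⟨ cong₂ _-_ (sum-δ j (M (M v))) (sum-δ j v) ⟩
    M (M v) j - v j
      ≡⟨ eq (M (M v) j) (v j) ⟩
    -1ℤ * v j + M (M v) j ∎
    where
    eq : ∀ a b → a - b ≡ -1ℤ * b + a
    eq = solve-∀

  ⟨B,B⟩ : ∀ u v → ⟨ B u , B v ⟩ ≡ mom 4 u v - pos 2 * mom 2 u v + mom 0 u v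
  ⟨B,B⟩ u v = begin
    ⟨ B u , B v ⟩
      ≡⟨ ⟨⟩-lin -1ℤ u (M (M u)) (B v) ⟩
    -1ℤ * ⟨ u , B v ⟩ + ⟨ M (M u) , B v ⟩
      ≡⟨ cong₂ (λ a b → -1ℤ * a + b) (⟨⟩-linʳ -1ℤ v (M (M v)) u) (⟨⟩-linʳ -1ℤ v (M (M v)) (M (M u))) ⟩
    -1ℤ * (-1ℤ * mom 0 u v + ⟨ u , M (M v) ⟩) + (-1ℤ * mom 2 u v + ⟨ M (M u) , M (M v) ⟩)
      ≡⟨ cong₂ (λ a b → -1ℤ * (-1ℤ * mom 0 u v + a) + (-1ℤ * mom 2 u v + b))
           (mom-shift 0 2 u v) (mom-shift 2 2 u v) ⟩
    -1ℤ * (-1ℤ * mom 0 u v + mom 2 u v) + (-1ℤ * mom 2 u v + mom 4 u v)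
      ≡⟨ eq (mom 0 u v) (mom 2 u v) (mom 4 u v) ⟩
    mom 4 u v - pos 2 * mom 2 u v + mom 0 u v ∎
    where
    eq : ∀ a b c → -1ℤ * (-1ℤ * a + b) + (-1ℤ * b + c) ≡ c - pos 2 * b + a
    eq = solve-∀

  -- Bessel's inequality for a semi-inner product and the orthogonal vectors e (of
  -- norm 1) and q (of norm s).
  bessel : (∀ y → 0≤ β y y) → ∀ e q s → β e e ≡ 1ℤ → β e q ≡ 0ℤ → β q q ≡ s → 1ℤ ≤ s →
    ∀ w → 0≤ s * (β w w - β w e * β w e) - β w q * β w q
  bessel psd e q s ee eq′ qq s≥1 w = 0≤-cancel {s} s≥1 (subst 0≤_ expand (psd y))
    where
    a = β w e
    g = β w q
    -- The vector y below is s times the component of w orthogonal to e and q; the factor s keeps it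
    -- integral.
    r : Row N
    r = - (s * a) · e ∔ (- g · q ∔ 0ᵛ)
    y : Row N
    y = s · w ∔ r
    β-r : ∀ v → β r v ≡ - (s * a) * β e v + (- g * β q v + 0ℤ)
    β-r v = trans (β-lin (- (s * a)) e (- g · q ∔ 0ᵛ) v)
      (cong (- (s * a) * β e v +_) (trans (β-lin (- g) q 0ᵛ v) (cong (- g * β q v +_) (β-0 v))))
    β-y : ∀ v → β y v ≡ s * β w v + (- (s * a) * β e v + (- g * β q v + 0ℤ))
    β-y v = trans (β-lin s w r v) (cong (s * β w v +_) (β-r v))
    ye : β y e ≡ 0ℤ
    ye = trans (β-y e) (trans (cong₂ (λ x z → s * a + (- (s * a) * x + (- g * z + 0ℤ))) ee (trans (β-comm q e) eq′))
      (eq₁ s a g))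
      where
      eq₁ : ∀ s a g → s * a + (- (s * a) * 1ℤ + (- g * 0ℤ + 0ℤ)) ≡ 0ℤ
      eq₁ = solve-∀
    yq : β y q ≡ 0ℤ
    yq = trans (β-y q) (trans (cong₂ (λ x z → s * g + (- (s * a) * x + (- g * z + 0ℤ))) eq′ qq)
      (eq₁ s a g))
      where
      eq₁ : ∀ s a g → s * g + (- (s * a) * 0ℤ + (- g * s + 0ℤ)) ≡ 0ℤ
      eq₁ = solve-∀
    expand : β y y ≡ s * (s * (β w w - a * a) - g * g)
    expand = begin
      β y y
        ≡⟨ β-y y ⟩
      s * β w y + (- (s * a) * β e y + (- g * β q y + 0ℤ))
        ≡⟨ cong₂ (λ x z → s * β w y + (- (s * a) * x + (- g * z + 0ℤ)))
             (trans (β-comm e y) ye) (trans (β-comm q y) yq) ⟩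
      s * β w y + (- (s * a) * 0ℤ + (- g * 0ℤ + 0ℤ))
        ≡⟨ cong (λ x → s * x + (- (s * a) * 0ℤ + (- g * 0ℤ + 0ℤ))) (trans (β-comm w y) (trans (β-y w)
             (cong₂ (λ x z → s * β w w + (- (s * a) * x + (- g * z + 0ℤ))) (β-comm e w) (β-comm q w)))) ⟩
      s * (s * β w w + (- (s * a) * a + (- g * g + 0ℤ))) + (- (s * a) * 0ℤ + (- g * 0ℤ + 0ℤ))
        ≡⟨ eq₂ s (β w w) a g ⟩
      s * (s * (β w w - a * a) - g * g) ∎
      where
      eq₂ : ∀ s w a g → s * (s * w + (- (s * a) * a + (- g * g + 0ℤ))) + (- (s * a) * 0ℤ + (- g * 0ℤ + 0ℤ))
          ≡ s * (s * (w - a * a) - g * g)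
      eq₂ = solve-∀

-- The consequences of cospectrality with the friendship graph that the proof uses.
record FriendshipLike (G : Graph) (ν : ℤ) : Set where
  open Graph G
  open Spectral G
  field
    order-eq     : pos order ≡ pos 2 * ν + 1ℤ
    degree-total : sum deg ≡ pos 6 * ν
    annihilated  : ∀ v i → ev (minimal ν) v i ≡ 0ℤ

module RankTwo (G : Graph) (ν : ℤ) (like : FriendshipLike G ν) (n≥2 : 0≤ ν - pos 2) where
  open Graph G
  open Spectral G public
  open FriendshipLike like public
  open Moments A A-sym public

  recurrence : ∀ k u v →
    mom (4 ℕ.+ k) u v ≡ mom (3 ℕ.+ k) u v + (pos 2 * ν + 1ℤ) * mom (2 ℕ.+ k) u v - mom (1 ℕ.+ k) u v - pos 2 * ν * mom k u v
  recurrence k u v = ℤ.i-j≡0⇒i≡j _ _ (trans (eq ν (mom k u v) (mom (1 ℕ.+ k) u v) (mom (2 ℕ.+ k) u v) (mom (3 ℕ.+ k) u v) (mom (4 ℕ.+ k) u v))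
    (trans (sym expand) (trans (⟨⟩-cong {v = v} (annihilated y) (λ _ → refl)) (⟨⟩-zero v))))
    where
    y = M^ k u
    expand : ⟨ ev (minimal ν) y , v ⟩ ≡ pos 2 * ν * mom k u v + (1ℤ * mom (1 ℕ.+ k) u v
      + (- (pos 2 * ν + 1ℤ) * mom (2 ℕ.+ k) u v + (-1ℤ * mom (3 ℕ.+ k) u v + (1ℤ * mom (4 ℕ.+ k) u v + 0ℤ))))
    expand = go (pos 2 * ν) y (go 1ℤ (M y) (go (- (pos 2 * ν + 1ℤ)) (M (M y)) (go -1ℤ (M (M (M y))) (go 1ℤ (M (M (M (M y)))) (⟨⟩-zero v)))))
      where
      go : ∀ a w {r : Row order} {c} → ⟨ r , v ⟩ ≡ c → ⟨ a · w ∔ r , v ⟩ ≡ a * ⟨ w , v ⟩ + c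
      go a w {r} e = trans (⟨⟩-lin a w r v) (cong (a * ⟨ w , v ⟩ +_) e)
    eq : ∀ ν m₀ m₁ m₂ m₃ m₄ → m₄ - (m₃ + (pos 2 * ν + 1ℤ) * m₂ - m₁ - pos 2 * ν * m₀)
       ≡ pos 2 * ν * m₀ + (1ℤ * m₁ + (- (pos 2 * ν + 1ℤ) * m₂ + (-1ℤ * m₃ + (1ℤ * m₄ + 0ℤ))))
    eq = solve-∀

  -- On the image of B = A² − 1 the polynomial x² − x − 2ν vanishes, so that
  -- 4ν(ν − 1) B = B (2ν − A) B, and 2ν − A is positive semidefinite.
  psd : ∀ y → 0≤ β y y
  psd y = 0≤-cancel {pos 4 * ν * (ν - 1ℤ)} (0≤⇒≤ (subst 0≤_ (eq₁ ν) n-big)) (subst 0≤_ value (rayleigh-bound (B y)))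
    where
    -- With ν = k + 2 one has 4ν(ν - 1) - 1 = 4k² + 12k + 7. At ν = 1 the factor 4ν(ν - 1) would
    -- vanish and could not be cancelled.
    k = ν - pos 2
    n-big : 0≤ pos 4 * (k * k) + pos 12 * k + pos 7
    n-big = 0≤-+ (0≤-+ (0≤-* {pos 4} (ℤᵇ.+≤+ ℕ.z≤n) (0≤-square k)) (0≤-* {pos 12} (ℤᵇ.+≤+ ℕ.z≤n) n≥2)) (ℤᵇ.+≤+ ℕ.z≤n)
    eq₁ : ∀ ν → pos 4 * ((ν - pos 2) * (ν - pos 2)) + pos 12 * (ν - pos 2) + pos 7 ≡ pos 4 * ν * (ν - 1ℤ) - 1ℤ
    eq₁ = solve-∀
    m : ℕ → ℤ
    m k = mom k y y
    MB : ⟨ M (B y) , B y ⟩ ≡ m 5 - pos 2 * m 3 + m 1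
    MB = begin
      ⟨ M (B y) , B y ⟩
        ≡⟨ ⟨⟩-cong {v = B y} (M-lin -1ℤ y (M (M y))) (λ _ → refl) ⟩
      ⟨ B (M y) , B y ⟩
        ≡⟨ ⟨B,B⟩ (M y) y ⟩
      mom 4 (M y) y - pos 2 * mom 2 (M y) y + mom 0 (M y) y
        ≡⟨ cong₂ (λ a b → a - pos 2 * b + m 1) (mom-M 4 y y) (mom-M 2 y y) ⟩
      m 5 - pos 2 * m 3 + m 1 ∎
    value : (pos order - 1ℤ) * ⟨ B y , B y ⟩ - ⟨ M (B y) , B y ⟩ ≡ pos 4 * ν * (ν - 1ℤ) * β y y
    value = begin
      (pos order - 1ℤ) * ⟨ B y , B y ⟩ - ⟨ M (B y) , B y ⟩
        ≡⟨ cong₂ (λ a b → a - b) (cong₂ (λ o b → (o - 1ℤ) * b) order-eq (⟨B,B⟩ y y)) MB ⟩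
      (pos 2 * ν + 1ℤ - 1ℤ) * (m 4 - pos 2 * m 2 + m 0) - (m 5 - pos 2 * m 3 + m 1)
        ≡⟨ cong (λ a → (pos 2 * ν + 1ℤ - 1ℤ) * (m 4 - pos 2 * m 2 + m 0) - (a - pos 2 * m 3 + m 1)) (recurrence 1 y y) ⟩
      (pos 2 * ν + 1ℤ - 1ℤ) * (m 4 - pos 2 * m 2 + m 0)
        - ((m 4 + (pos 2 * ν + 1ℤ) * m 3 - m 2 - pos 2 * ν * m 1) - pos 2 * m 3 + m 1)
        ≡⟨ cong (λ a → (pos 2 * ν + 1ℤ - 1ℤ) * (a - pos 2 * m 2 + m 0)
             - ((a + (pos 2 * ν + 1ℤ) * m 3 - m 2 - pos 2 * ν * m 1) - pos 2 * m 3 + m 1)) (recurrence 0 y y) ⟩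
      _ ≡⟨ eq₂ ν (m 0) (m 1) (m 2) (m 3) ⟩
      pos 4 * ν * (ν - 1ℤ) * (m 2 - m 0) ∎
      where
      eq₂ : ∀ ν m₀ m₁ m₂ m₃ → let m₄ = m₃ + (pos 2 * ν + 1ℤ) * m₂ - m₁ - pos 2 * ν * m₀ in
        (pos 2 * ν + 1ℤ - 1ℤ) * (m₄ - pos 2 * m₂ + m₀)
          - ((m₄ + (pos 2 * ν + 1ℤ) * m₃ - m₂ - pos 2 * ν * m₁) - pos 2 * m₃ + m₁)
        ≡ pos 4 * ν * (ν - 1ℤ) * (m₂ - m₀)
      eq₂ = solve-∀

  M-δ : ∀ i j → M (δ i) j ≡ A i j
  M-δ i j = trans (sum-cong-≗ λ k → trans (ℤ.*-comm (A j k) (δ i k)) (cong (δ i k *_) (A-sym j k))) (sum-δ i (λ k → A k j))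

  mom-0-δ : ∀ i → mom 0 (δ i) (δ i) ≡ 1ℤ
  mom-0-δ i = trans (sum-δ i (δ i)) (go i)
    where
    go : ∀ {n} (i : Fin n) → δ i i ≡ 1ℤ
    go zero    = refl
    go (suc i) = go i

  mom-1-δ : ∀ i → mom 1 (δ i) (δ i) ≡ 0ℤ
  mom-1-δ i = trans (⟨⟩-comm (M (δ i)) (δ i)) (trans (sum-δ i (M (δ i))) (trans (M-δ i i) (A-loop i)))

  mom-2-δ : ∀ i → mom 2 (δ i) (δ i) ≡ deg i
  mom-2-δ i = trans (sym (mom-shift 1 1 (δ i) (δ i)))
    (sum-cong-≗ λ j → trans (cong₂ _*_ (M-δ i j) (M-δ i j)) (A-idem i j))

  β-δδ : ∀ i → β (δ i) (δ i) ≡ deg i - 1ℤ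
  β-δδ i = cong₂ _-_ (mom-2-δ i) (mom-0-δ i)

  sum-deg-1 : sum (λ j → deg j - 1ℤ) ≡ pos 4 * ν - 1ℤ
  sum-deg-1 = begin
    sum (λ j → deg j - 1ℤ)
      ≡⟨ ∑-distrib-+ deg (λ _ → - 1ℤ) ⟩
    sum deg + sum {order} (λ _ → - 1ℤ)
      ≡⟨ cong₂ _+_ degree-total (trans (sum-const order (- 1ℤ)) (cong (_* - 1ℤ) order-eq)) ⟩
    pos 6 * ν + (pos 2 * ν + 1ℤ) * - 1ℤ
      ≡⟨ eq ν ⟩
    pos 4 * ν - 1ℤ ∎
    where
    eq : ∀ ν → pos 6 * ν + (pos 2 * ν + 1ℤ) * - 1ℤ ≡ pos 4 * ν - 1ℤ
    eq = solve-∀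

  module DegreeTwo (i : Vertex) (deg-i : deg i ≡ pos 2) where

    e : Row order
    e = δ i

    -- τ is the number of closed walks of length 3 from i, twice the number of triangles at i. The
    -- value of σ is that of β q q, computed in `qq`.
    τ σ : ℤ
    τ = mom 3 e e
    σ = pos 2 * ν + τ - τ * τ

    -- A e made orthogonal to e for β. Because deg i = 2, β e e = 1 and the Gram-Schmidt coefficient
    -- is the integer τ = β e (A e).
    q : Row order
    q = - τ · e ∔ M e

    m : ℕ → ℤ
    m k = mom k e e

    m₀ : m 0 ≡ 1ℤ
    m₀ = mom-0-δ i
    m₁ : m 1 ≡ 0ℤ
    m₁ = mom-1-δ i
    m₂ : m 2 ≡ pos 2
    m₂ = trans (mom-2-δ i) deg-i
    m₄ : m 4 ≡ τ + pos 2 * ν + pos 2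
    m₄ = trans (recurrence 0 e e) (trans (cong₂ (λ a b → τ + (pos 2 * ν + 1ℤ) * a - m 1 - pos 2 * ν * b) m₂ m₀)
      (trans (cong (λ a → τ + (pos 2 * ν + 1ℤ) * pos 2 - a - pos 2 * ν * 1ℤ) m₁) (eq τ ν)))
      where
      eq : ∀ τ ν → τ + (pos 2 * ν + 1ℤ) * pos 2 - 0ℤ - pos 2 * ν * 1ℤ ≡ τ + pos 2 * ν + pos 2
      eq = solve-∀
    m₅ : m 5 ≡ m 4 + (pos 2 * ν + 1ℤ) * τ - pos 2
    m₅ = trans (recurrence 1 e e) (trans (cong₂ (λ a b → m 4 + (pos 2 * ν + 1ℤ) * τ - a - pos 2 * ν * b) m₂ m₁)
      (eq (m 4 + (pos 2 * ν + 1ℤ) * τ - pos 2) ν))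
      where
      eq : ∀ a ν → a - pos 2 * ν * 0ℤ ≡ a
      eq = solve-∀
    m₆ : m 6 ≡ m 5 + (pos 2 * ν + 1ℤ) * m 4 - τ - pos 2 * ν * pos 2
    m₆ = trans (recurrence 2 e e) (cong (λ a → m 5 + (pos 2 * ν + 1ℤ) * m 4 - τ - pos 2 * ν * a) m₂)

    ee : β e e ≡ 1ℤ
    ee = cong₂ _-_ m₂ m₀

    eMe : β e (M e) ≡ τ
    eMe = trans (cong₂ _-_ (mom-Mʳ 2 e e) (trans (mom-Mʳ 0 e e) m₁)) (ℤ.+-identityʳ τ)

    eq₀ : β e q ≡ 0ℤ
    eq₀ = trans (β-linʳ (- τ) e (M e) e) (trans (cong₂ (λ a b → - τ * a + b) ee eMe) (eq τ))
      where
      eq : ∀ τ → - τ * 1ℤ + τ ≡ 0ℤ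
      eq = solve-∀

    qq : β q q ≡ σ
    qq = begin
      β q q
        ≡⟨ β-lin (- τ) e (M e) q ⟩
      - τ * β e q + β (M e) q
        ≡⟨ cong₂ (λ a b → - τ * a + b) eq₀ (β-linʳ (- τ) e (M e) (M e)) ⟩
      - τ * 0ℤ + (- τ * β (M e) e + β (M e) (M e))
        ≡⟨ cong₂ (λ a b → - τ * 0ℤ + (- τ * a + b)) (trans (β-comm (M e) e) eMe)
             (cong₂ _-_ (trans (mom-M 2 e (M e)) (mom-Mʳ 3 e e)) (trans (mom-M 0 e (M e)) (mom-Mʳ 1 e e))) ⟩
      - τ * 0ℤ + (- τ * τ + (m 4 - m 2))
        ≡⟨ cong₂ (λ a b → - τ * 0ℤ + (- τ * τ + (a - b))) m₄ m₂ ⟩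
      - τ * 0ℤ + (- τ * τ + (τ + pos 2 * ν + pos 2 - pos 2))
        ≡⟨ eq τ ν ⟩
      σ ∎
      where
      eq : ∀ τ ν → - τ * 0ℤ + (- τ * τ + (τ + pos 2 * ν + pos 2 - pos 2)) ≡ pos 2 * ν + τ - τ * τ
      eq = solve-∀

    BeBe : ⟨ B e , B e ⟩ ≡ pos 2 * ν - 1ℤ + τ
    BeBe = trans (⟨B,B⟩ e e) (trans (cong₂ (λ a b → a - pos 2 * m 2 + b) m₄ m₀)
      (trans (cong (λ a → τ + pos 2 * ν + pos 2 - pos 2 * a + 1ℤ) m₂) (eq τ ν)))
      where
      eq : ∀ τ ν → τ + pos 2 * ν + pos 2 - pos 2 * pos 2 + 1ℤ ≡ pos 2 * ν - 1ℤ + τ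
      eq = solve-∀

    -- The recurrence reduces the moments of e up to the sixth to τ and ν. They are eliminated from
    -- the highest down, which leaves one ring identity.
    BqBq : ⟨ B q , B q ⟩ ≡ σ * (pos 2 * ν - τ)
    BqBq = begin
      ⟨ B q , B q ⟩
        ≡⟨ ⟨⟩-cong B-q B-q ⟩
      ⟨ - τ · B e ∔ B (M e) , - τ · B e ∔ B (M e) ⟩
        ≡⟨ ⟨⟩-lin (- τ) (B e) (B (M e)) (- τ · B e ∔ B (M e)) ⟩
      - τ * ⟨ B e , - τ · B e ∔ B (M e) ⟩ + ⟨ B (M e) , - τ · B e ∔ B (M e) ⟩
        ≡⟨ cong₂ (λ a b → - τ * a + b) (⟨⟩-linʳ (- τ) (B e) (B (M e)) (B e)) (⟨⟩-linʳ (- τ) (B e) (B (M e)) (B (M e))) ⟩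
      - τ * (- τ * ⟨ B e , B e ⟩ + ⟨ B e , B (M e) ⟩) + (- τ * ⟨ B (M e) , B e ⟩ + ⟨ B (M e) , B (M e) ⟩)
        ≡⟨ cong₂ (λ a b → - τ * (- τ * ⟨ B e , B e ⟩ + a) + (- τ * b + ⟨ B (M e) , B (M e) ⟩)) BeBMe
             (trans (⟨⟩-comm (B (M e)) (B e)) BeBMe) ⟩
      - τ * (- τ * ⟨ B e , B e ⟩ + x) + (- τ * x + ⟨ B (M e) , B (M e) ⟩)
        ≡⟨ cong₂ (λ a b → - τ * (- τ * a + x) + (- τ * x + b)) BeBe BMeBMe ⟩
      - τ * (- τ * (pos 2 * ν - 1ℤ + τ) + x) + (- τ * x + (m 6 - pos 2 * m 4 + pos 2))
        ≡⟨ cong (λ a → - τ * (- τ * (pos 2 * ν - 1ℤ + τ) + x) + (- τ * x + (a - pos 2 * m 4 + pos 2))) m₆ ⟩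
      _ ≡⟨ cong (λ a → - τ * (- τ * (pos 2 * ν - 1ℤ + τ) + (a - pos 2 * τ + 0ℤ)) + (- τ * (a - pos 2 * τ + 0ℤ)
             + (a + (pos 2 * ν + 1ℤ) * m 4 - τ - pos 2 * ν * pos 2 - pos 2 * m 4 + pos 2))) m₅ ⟩
      _ ≡⟨ cong (λ b → - τ * (- τ * (pos 2 * ν - 1ℤ + τ) + (b + (pos 2 * ν + 1ℤ) * τ - pos 2 - pos 2 * τ + 0ℤ))
             + (- τ * (b + (pos 2 * ν + 1ℤ) * τ - pos 2 - pos 2 * τ + 0ℤ)
             + (b + (pos 2 * ν + 1ℤ) * τ - pos 2 + (pos 2 * ν + 1ℤ) * b - τ - pos 2 * ν * pos 2 - pos 2 * b + pos 2))) m₄ ⟩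
      _ ≡⟨ eq τ ν ⟩
      σ * (pos 2 * ν - τ) ∎
      where
      x = m 5 - pos 2 * τ + 0ℤ
      B-q : B q ≗ - τ · B e ∔ B (M e)
      B-q j = trans (cong (-1ℤ * (- τ * e j + M e j) +_) (M^-lin 2 (- τ) e (M e) j))
        (eq′ τ (e j) (M e j) (M (M e) j) (M (M (M e)) j))
        where
        eq′ : ∀ τ a b c d → -1ℤ * (- τ * a + b) + (- τ * c + d) ≡ - τ * (-1ℤ * a + c) + (-1ℤ * b + d)
        eq′ = solve-∀
      BeBMe : ⟨ B e , B (M e) ⟩ ≡ x
      BeBMe = trans (⟨B,B⟩ e (M e)) (trans (cong₂ (λ a b → a - pos 2 * b + mom 0 e (M e)) (mom-Mʳ 4 e e) (mom-Mʳ 2 e e))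
        (cong (m 5 - pos 2 * τ +_) (trans (mom-Mʳ 0 e e) m₁)))
      BMeBMe : ⟨ B (M e) , B (M e) ⟩ ≡ m 6 - pos 2 * m 4 + pos 2
      BMeBMe = trans (⟨B,B⟩ (M e) (M e)) (trans (cong₂ (λ a b → a - pos 2 * b + mom 0 (M e) (M e))
          (trans (mom-M 4 e (M e)) (mom-Mʳ 5 e e)) (trans (mom-M 2 e (M e)) (mom-Mʳ 3 e e)))
        (cong (m 6 - pos 2 * m 4 +_) (trans (trans (mom-M 0 e (M e)) (mom-Mʳ 1 e e)) m₂)))
      eq : ∀ τ ν → let b = τ + pos 2 * ν + pos 2 in
        - τ * (- τ * (pos 2 * ν - 1ℤ + τ) + (b + (pos 2 * ν + 1ℤ) * τ - pos 2 - pos 2 * τ + 0ℤ))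
             + (- τ * (b + (pos 2 * ν + 1ℤ) * τ - pos 2 - pos 2 * τ + 0ℤ)
             + (b + (pos 2 * ν + 1ℤ) * τ - pos 2 + (pos 2 * ν + 1ℤ) * b - τ - pos 2 * ν * pos 2 - pos 2 * b + pos 2))
        ≡ (pos 2 * ν + τ - τ * τ) * (pos 2 * ν - τ)
      eq = solve-∀

    -- The norm β (δ j) (δ j) = deg j - 1 less the squared component along e: what remains for the
    -- direction of q.
    slack : Row order
    slack j = deg j - 1ℤ - B e j * B e j

    -- The trace of A² − 1 leaves no room in Bessel's inequality: A² − 1 has rank 2.
    tight : 1ℤ ≤ σ → ∀ j → σ * slack j ≡ B q j * B q j
    tight σ≥1 j = ℤ.i-j≡0⇒i≡j (σ * slack j) (B q j * B q j)
      (0≤-sum-0 gap (λ j → subst 0≤_ (form j) (bessel psd e q σ ee eq₀ qq σ≥1 (δ j))) total j)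
      where
      gap : Row order
      gap j = σ * slack j - B q j * B q j
      form : ∀ j → σ * (β (δ j) (δ j) - β (δ j) e * β (δ j) e) - β (δ j) q * β (δ j) q ≡ gap j
      form j = trans (cong₂ (λ a b → σ * (β (δ j) (δ j) - a * a) - b * b) (β-δ j e) (β-δ j q))
        (cong (λ a → σ * (a - B e j * B e j) - B q j * B q j) (β-δδ j))
      -- The trace Σ (deg j - 1) = 4ν - 1 is exactly |B e|² + |B q|² / σ = (2ν - 1 + τ) + (2ν - τ).
      total : sum gap ≡ 0ℤ
      total = begin
        sum gap
          ≡⟨ sum-cong-≗ (λ j → eq₁ σ (deg j - 1ℤ) (B e j * B e j) (B q j * B q j)) ⟩
        sum (λ j → σ * (deg j - 1ℤ) + (- σ * (B e j * B e j) + (-1ℤ * (B q j * B q j) + 0ℤ)))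
          ≡⟨ trans (sum-lin σ (λ j → deg j - 1ℤ) _) (cong (σ * sum (λ j → deg j - 1ℤ) +_)
             (trans (sum-lin (- σ) (λ j → B e j * B e j) _) (cong (- σ * ⟨ B e , B e ⟩ +_)
             (trans (sum-lin -1ℤ (λ j → B q j * B q j) (λ _ → 0ℤ)) (cong (-1ℤ * ⟨ B q , B q ⟩ +_) (sum-0 {order} (λ _ → 0ℤ) (λ _ → refl))))))) ⟩
        σ * sum (λ j → deg j - 1ℤ) + (- σ * ⟨ B e , B e ⟩ + (-1ℤ * ⟨ B q , B q ⟩ + 0ℤ))
          ≡⟨ cong₂ (λ a b → σ * a + (- σ * ⟨ B e , B e ⟩ + (-1ℤ * b + 0ℤ))) sum-deg-1 BqBq ⟩
        σ * (pos 4 * ν - 1ℤ) + (- σ * ⟨ B e , B e ⟩ + (-1ℤ * (σ * (pos 2 * ν - τ)) + 0ℤ))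
          ≡⟨ cong (λ a → σ * (pos 4 * ν - 1ℤ) + (- σ * a + (-1ℤ * (σ * (pos 2 * ν - τ)) + 0ℤ))) BeBe ⟩
        σ * (pos 4 * ν - 1ℤ) + (- σ * (pos 2 * ν - 1ℤ + τ) + (-1ℤ * (σ * (pos 2 * ν - τ)) + 0ℤ))
          ≡⟨ eq₂ σ ν τ ⟩
        0ℤ ∎
        where
        eq₁ : ∀ s d a g → s * (d - a) - g ≡ s * d + (- s * a + (-1ℤ * g + 0ℤ))
        eq₁ = solve-∀
        eq₂ : ∀ s ν τ → s * (pos 4 * ν - 1ℤ) + (- s * (pos 2 * ν - 1ℤ + τ) + (-1ℤ * (s * (pos 2 * ν - τ)) + 0ℤ)) ≡ 0ℤ
        eq₂ = solve-∀

-- Degrees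

δ-refl : ∀ {n} (i : Fin n) → δ i i ≡ 1ℤ
δ-refl zero    = refl
δ-refl (suc i) = δ-refl i

δ-≢ : ∀ {n} {i j : Fin n} → i ≢ j → δ i j ≡ 0ℤ
δ-≢ {i = i} {j} i≢j with i ≟ᶠ j
... | yes i≡j = ⊥-elim (i≢j i≡j)
... | no _    = refl

0≤1ᵇ : ∀ b → 0≤ 1ᵇ b
0≤1ᵇ true  = ℤᵇ.+≤+ ℕ.z≤n
0≤1ᵇ false = ℤᵇ.+≤+ ℕ.z≤n

0≤1-1ᵇ : ∀ b → 0≤ 1ℤ - 1ᵇ b
0≤1-1ᵇ true  = ℤᵇ.+≤+ ℕ.z≤n
0≤1-1ᵇ false = ℤᵇ.+≤+ ℕ.z≤n

¬0≤-1 : ¬ (0≤ -1ℤ)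
¬0≤-1 ()

0≤-next : ∀ d k → 0≤ d - pos (suc k) → d ≢ pos (suc k) → 0≤ d - pos (suc (suc k))
0≤-next d k le ne = subst 0≤_ (eq d (pos (suc k)) (pos (suc (suc k))) (pos-suc (suc k)))
  (≤⇒0≤ (ℤ.i<j⇒suc[i]≤j (ℤ.≤∧≢⇒< le λ e → ne (ℤ.i-j≡0⇒i≡j d (pos (suc k)) (sym e)))))
  where
  ring-eq : ∀ d k → d - k - 1ℤ ≡ d - (1ℤ + k)
  ring-eq = solve-∀
  eq : ∀ d k k′ → k′ ≡ 1ℤ + k → d - k - 1ℤ ≡ d - k′
  eq d k k′ refl = ring-eq d k

1≢0 : 1ℤ ≢ 0ℤ
1≢0 ()

sum-1ᵇ-0 : ∀ {n} (b : Fin n → Bool) → sum (1ᵇ ∘ b) ≡ 0ℤ → ∀ j → 1ᵇ (b j) ≡ 0ℤ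
sum-1ᵇ-0 b = 0≤-sum-0 (1ᵇ ∘ b) (0≤1ᵇ ∘ b)

sum-1ᵇ-1 : ∀ {n} (b : Fin n → Bool) → sum (1ᵇ ∘ b) ≡ 1ℤ → ∃ λ u → ∀ j → 1ᵇ (b j) ≡ δ u j
sum-1ᵇ-1 {suc n} b e with b zero in b₀
... | true  = zero , λ where
      zero    → cong 1ᵇ b₀
      (suc j) → sum-1ᵇ-0 (b ∘ suc) (+-cancelˡ 1ℤ _ _ e) j
... | false with sum-1ᵇ-1 (b ∘ suc) (trans (sym (ℤ.+-identityˡ _)) e)
...   | u , h = suc u , λ where
      zero    → cong 1ᵇ b₀
      (suc j) → h j

sum-1ᵇ-2 : ∀ {n} (b : Fin n → Bool) → sum (1ᵇ ∘ b) ≡ pos 2 →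
  ∃ λ u → ∃ λ v → u ≢ v × (∀ j → 1ᵇ (b j) ≡ δ u j + δ v j)
sum-1ᵇ-2 {suc n} b e with b zero in b₀
... | true with sum-1ᵇ-1 (b ∘ suc) (+-cancelˡ 1ℤ _ _ e)
...   | v , h = zero , suc v , (λ ()) , λ where
      zero    → cong 1ᵇ b₀
      (suc j) → trans (h j) (sym (ℤ.+-identityˡ (δ v j)))
sum-1ᵇ-2 {suc n} b e | false with sum-1ᵇ-2 (b ∘ suc) (trans (sym (ℤ.+-identityˡ _)) e)
...   | u , v , u≢v , h = suc u , suc v , (λ { refl → u≢v refl }) , λ where
      zero    → cong 1ᵇ b₀
      (suc j) → h j

0≤-sum-without : ∀ {n} (f : Row n) → (∀ j → 0≤ f j) → ∀ i → 0≤ sum f - f i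
0≤-sum-without f p i = subst 0≤_ (begin
    sum (λ j → -1ℤ * (δ i j * f j) + f j)   ≡⟨ sum-lin -1ℤ (λ j → δ i j * f j) f ⟩
    -1ℤ * sum (λ j → δ i j * f j) + sum f   ≡⟨ cong (λ s → -1ℤ * s + sum f) (sum-δ i f) ⟩
    -1ℤ * f i + sum f                       ≡⟨ eq (f i) (sum f) ⟩
    sum f - f i                             ∎)
  (0≤-sum (λ j → -1ℤ * (δ i j * f j) + f j) λ j → subst 0≤_ (eq′ (δ i j) (f j)) (0≤-* (0≤1-1ᵇ (does (i ≟ᶠ j))) (p j)))
  where
  eq : ∀ a s → -1ℤ * a + s ≡ s - a
  eq = solve-∀
  eq′ : ∀ d f → (1ℤ - d) * f ≡ -1ℤ * (d * f) + f
  eq′ = solve-∀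

0≤-sum-without₂ : ∀ {n} (f : Row n) → (∀ j → 0≤ f j) → ∀ {u v} → u ≢ v → 0≤ sum f - (f u + f v)
0≤-sum-without₂ f p {u} {v} u≢v = subst 0≤_ (begin
    sum g - g v                 ≡⟨ cong₂ _-_ (sum-lin -1ℤ (λ j → δ u j * f j) f) (cong (λ d → -1ℤ * (d * f v) + f v) (δ-≢ u≢v)) ⟩
    -1ℤ * sum (λ j → δ u j * f j) + sum f - (-1ℤ * (0ℤ * f v) + f v)
                                ≡⟨ cong (λ s → -1ℤ * s + sum f - (-1ℤ * (0ℤ * f v) + f v)) (sum-δ u f) ⟩
    -1ℤ * f u + sum f - (-1ℤ * (0ℤ * f v) + f v)
                                ≡⟨ eq (f u) (f v) (sum f) ⟩
    sum f - (f u + f v)         ∎)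
  (0≤-sum-without g (λ j → subst 0≤_ (eq′ (δ u j) (f j)) (0≤-* (0≤1-1ᵇ (does (u ≟ᶠ j))) (p j))) v)
  where
  g : Row _
  g j = -1ℤ * (δ u j * f j) + f j
  eq : ∀ a b s → -1ℤ * a + s - (-1ℤ * (0ℤ * b) + b) ≡ s - (a + b)
  eq = solve-∀
  eq′ : ∀ d f → (1ℤ - d) * f ≡ -1ℤ * (d * f) + f
  eq′ = solve-∀

-- Arithmetic of the possible degrees

no-square-between : ∀ a N → a ℕ.* a ℕ.< N → N ℕ.< suc a ℕ.* suc a → ∀ g → g * g ≢ pos N
no-square-between a N lo hi g e = go (∣ g ∣) (trans (sym (ℤ.∣i*j∣≡∣i∣*∣j∣ g g)) (cong ∣_∣ e))
  where
  go : ∀ k → k ℕ.* k ≢ N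
  go k e with k ℕ.≤? a
  ... | yes k≤a = ℕ.<⇒≱ lo (ℕ.≤-trans (ℕ.≤-reflexive (sym e)) (ℕ.*-mono-≤ k≤a k≤a))
  ... | no  k≰a = ℕ.<⇒≱ hi (ℕ.≤-trans (ℕ.*-mono-≤ (ℕ.≰⇒> k≰a) (ℕ.≰⇒> k≰a)) (ℕ.≤-reflexive e))

-- Here p and q stand for deg u - 1 and deg v - 1, and m for the number of common neighbours of u
-- and v. The cases `twos` and `threes` are arithmetically consistent; `no-triangle` excludes them
-- by counting vertices.
data Solution (ν p q : ℤ) : ℤ → Set where
  ones   : ∀ {m} → p ≡ 1ℤ → q ≡ 1ℤ → Solution ν p q m
  twos   : ∀ {m} → m ≡ pos 2 → pos 2 * ν ≡ pos 8 → Solution ν p q m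
  threes : ∀ {m} → m ≡ pos 3 → pos 2 * ν ≡ pos 12 → Solution ν p q m

small-factor : ∀ p q N → p ℕ.* q ≡ suc N → p ℕ.≤ suc N
small-factor p zero    N e = ⊥-elim (ℕ.0≢1+n (trans (sym (ℕ.*-zeroʳ p)) e))
small-factor p (suc q) N e = ℕ.≤-trans (ℕ.m≤m*n p (suc q)) (ℕ.≤-reflexive e)

bounded-search : {P : ℕ → ℕ → Set} → (∀ (p q : Fin 10) → P (toℕ p) (toℕ q)) → ∀ p q → p ℕ.≤ 9 → q ℕ.≤ 9 → P p q
bounded-search {P} h p q p≤9 q≤9 =
  subst₂ P (toℕ-fromℕ< (ℕ.s≤s p≤9)) (toℕ-fromℕ< (ℕ.s≤s q≤9)) (h (fromℕ< (ℕ.s≤s p≤9)) (fromℕ< (ℕ.s≤s q≤9)))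

factor-4 : ∀ p q → p ℕ.≤ 9 → q ℕ.≤ 9 → p ℕ.* q ≡ 4 → p ℕ.+ q ≡ 4 ⊎ p ℕ.+ q ≡ 5
factor-4 = bounded-search {λ p q → p ℕ.* q ≡ 4 → p ℕ.+ q ≡ 4 ⊎ p ℕ.+ q ≡ 5} (from-yes (all? λ (p : Fin 10) → all? λ (q : Fin 10) →
  (toℕ p ℕ.* toℕ q ℕ.≟ 4) →-dec ((toℕ p ℕ.+ toℕ q ℕ.≟ 4) ⊎-dec (toℕ p ℕ.+ toℕ q ℕ.≟ 5))))

factor-9 : ∀ p q → p ℕ.≤ 9 → q ℕ.≤ 9 → p ℕ.* q ≡ 9 → p ℕ.+ q ≡ 6 ⊎ (p ≡ 1 ⊎ q ≡ 1)
factor-9 = bounded-search {λ p q → p ℕ.* q ≡ 9 → p ℕ.+ q ≡ 6 ⊎ (p ≡ 1 ⊎ q ≡ 1)} (from-yes (all? λ (p : Fin 10) → all? λ (q : Fin 10) →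
  (toℕ p ℕ.* toℕ q ℕ.≟ 9) →-dec ((toℕ p ℕ.+ toℕ q ℕ.≟ 6) ⊎-dec ((toℕ p ℕ.≟ 1) ⊎-dec (toℕ q ℕ.≟ 1)))))

9-odd : ∀ ν → pos 2 * ν ≢ pos 9
9-odd ν e = go ∣ ν ∣ (trans (sym (ℤ.∣i*j∣≡∣i∣*∣j∣ (pos 2) ν)) (cong ∣_∣ e))
  where
  go : ∀ k → 2 ℕ.* k ≢ 9
  go k e with k ℕ.≤? 4
  ... | yes k≤4 = ℕ.<⇒≱ (ℕ.≤-refl {9}) (ℕ.≤-trans (ℕ.≤-reflexive (sym e)) (ℕ.*-monoʳ-≤ 2 k≤4))
  ... | no  k≰4 = ℕ.<⇒≱ (ℕ.≤-refl {10}) (ℕ.≤-trans (ℕ.*-monoʳ-≤ 2 (ℕ.≰⇒> k≰4)) (ℕ.≤-reflexive e))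

-- The equations say p q = m².
small-solutions : ∀ ν p q m → 0≤ m - 1ℤ → 0≤ pos 3 - m → 0≤ p - 1ℤ → 0≤ q - 1ℤ → 0≤ p + 1ℤ - m → 0≤ q + 1ℤ - m →
  p + q + pos 2 * m ≡ pos 2 * ν → pos 2 * ν * p ≡ (p + m) * (p + m) → Solution ν p q m
small-solutions ν (pos p) (pos q) m m≥1 m≤3 p≥1 q≥1 p≥ q≥ s e = go m m≥1 m≤3 p≥ q≥ s product
  where
  product : pos (p ℕ.* q) ≡ m * m
  product = trans (ℤ.pos-* p q) (ℤ.i-j≡0⇒i≡j (pos p * pos q) (m * m) (trans (eq (pos p) (pos q) m)
    (trans (cong (λ x → x * pos p - (pos p + m) * (pos p + m)) s) (ℤ.i≡j⇒i-j≡0 e))))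
    where
    eq : ∀ p q m → p * q - m * m ≡ (p + q + pos 2 * m) * p - (p + m) * (p + m)
    eq = solve-∀
  go : ∀ m → 0≤ m - 1ℤ → 0≤ pos 3 - m → 0≤ pos p + 1ℤ - m → 0≤ pos q + 1ℤ - m → pos p + pos q + pos 2 * m ≡ pos 2 * ν →
    pos (p ℕ.* q) ≡ m * m → Solution ν (pos p) (pos q) m
  go (pos 1) _ _ _ _ _ h = ones (cong pos (ℕ.m*n≡1⇒m≡1 p q (ℤ.+-injective h))) (cong pos (ℕ.m*n≡1⇒n≡1 p q (ℤ.+-injective h)))
  go (pos 2) _ _ _ _ s h with factor-4 p q (ℕ.≤-trans (small-factor p q 3 (ℤ.+-injective h)) (ℕ.m≤n+m 4 5))
      (ℕ.≤-trans (small-factor q p 3 (trans (ℕ.*-comm q p) (ℤ.+-injective h))) (ℕ.m≤n+m 4 5)) (ℤ.+-injective h)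
  ... | inj₁ e₄ = twos refl (trans (sym s) (cong (λ x → pos x + pos 4) e₄))
  -- The factorisation 1 · 4 would give 2ν = 5 + 4.
  ... | inj₂ e₅ = ⊥-elim (9-odd ν (trans (sym s) (cong (λ x → pos x + pos 4) e₅)))
  go (pos 3) _ _ p≥ q≥ s h with factor-9 p q (small-factor p q 8 (ℤ.+-injective h))
      (small-factor q p 8 (trans (ℕ.*-comm q p) (ℤ.+-injective h))) (ℤ.+-injective h)
  ... | inj₁ e₆ = threes refl (trans (sym s) (cong (λ x → pos x + pos 6) e₆))
  -- The factorisation 1 · 9 fails because a vertex has at least as many neighbours as common
  -- neighbours: 1 + 1 < 3.
  ... | inj₂ (inj₁ refl) = ⊥-elim (¬0≤-1 p≥)
  ... | inj₂ (inj₂ refl) = ⊥-elim (¬0≤-1 q≥)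
  go (pos (suc (suc (suc (suc m))))) _ () _ _ _ _

-- Common neighbours around a vertex of degree two

module Combinatorics (G : Graph) (ν : ℤ) (like : FriendshipLike G ν) (n≥2 : 0≤ ν - pos 2)
  (conn : Connected G) where

  open Graph G
  open RankTwo G ν like n≥2

  Hub : Set
  Hub = ∃ λ h → deg h ≡ pos 2 * ν

  adj-1 : ∀ {x y} → Adj x y → A x y ≡ 1ℤ
  adj-1 = cong 1ᵇ

  B-δ : ∀ i j → B (δ i) j ≡ -1ℤ * δ i j + sum (λ k → A j k * A i k)
  B-δ i j = cong (-1ℤ * δ i j +_) (sum-cong-≗ λ k → cong (A j k *_) (M-δ i k))

  -- Cauchy-Schwarz for a semidefinite form. With x = β u v and V = β v v, the coefficient c = -x (V
  -- + 1) gives c u + v the norm V - 2x² (V + 1), which is negative unless x = 0.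
  isotropic : ∀ u → β u u ≡ 0ℤ → ∀ v → β u v ≡ 0ℤ
  isotropic u uu v = square-0 x (go (x * x) V (psd v) (0≤-square x) (subst 0≤_ expand (psd (c · u ∔ v))))
    where
    x = β u v
    V = β v v
    c = - (x * (V + 1ℤ))
    expand : β (c · u ∔ v) (c · u ∔ v) ≡ V - pos 2 * (x * x) * (V + 1ℤ)
    expand = trans (β-lin c u v (c · u ∔ v)) (trans (cong₂ (λ a b → c * a + b)
        (trans (β-linʳ c u v u) (cong (λ a → c * a + x) uu))
        (trans (β-linʳ c u v v) (cong (λ a → c * a + V) (β-comm v u)))) (eq x V))
      where
      eq : ∀ x V → - (x * (V + 1ℤ)) * (- (x * (V + 1ℤ)) * 0ℤ + x) + (- (x * (V + 1ℤ)) * x + V)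
         ≡ V - pos 2 * (x * x) * (V + 1ℤ)
      eq = solve-∀
    go : ∀ s V → 0≤ V → 0≤ s → 0≤ V - pos 2 * s * (V + 1ℤ) → s ≡ 0ℤ
    go (pos zero)    V _   _ _ = refl
    go (pos (suc s)) V V≥0 _ h = ⊥-elim (¬0≤-1 (subst 0≤_ (trans
        (cong (λ t → V - pos 2 * t * (V + 1ℤ) + pos 2 * pos s * (V + 1ℤ) + V + 1ℤ) (pos-suc s)) (eq V (pos s)))
        (0≤-+ (0≤-+ (0≤-+ h (0≤-* {pos 2 * pos s} {V + 1ℤ} (0≤-* {pos 2} {pos s} (ℤᵇ.+≤+ ℕ.z≤n) (ℤᵇ.+≤+ ℕ.z≤n))
          (0≤-+ V≥0 (ℤᵇ.+≤+ ℕ.z≤n)))) V≥0) (ℤᵇ.+≤+ (ℕ.z≤n {1})))))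
      where
      eq : ∀ V s → V - pos 2 * (1ℤ + s) * (V + 1ℤ) + pos 2 * s * (V + 1ℤ) + V + 1ℤ ≡ -1ℤ
      eq = solve-∀

  -- A diagonal entry of a semidefinite form is nonnegative; this already excludes isolated
  -- vertices.
  deg≥1 : ∀ j → 0≤ deg j - 1ℤ
  deg≥1 j = subst 0≤_ (β-δδ j) (psd (δ j))

  -- A pendant vertex j would give A² − 1 a zero row at j: nothing is at distance two from j.
  deg≢1 : ∀ j → deg j ≢ 1ℤ
  deg≢1 j e = ¬0≤-1 (subst 0≤_ deficit (0≤-+ (0≤-+ n≥2 n≥2) (ℤᵇ.+≤+ (ℕ.z≤n {2}))))
    where
    row-0 : ∀ k → B (δ j) k ≡ 0ℤ
    row-0 k = trans (sym (β-δ k (δ j))) (trans (β-comm (δ k) (δ j))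
      (isotropic (δ j) (trans (β-δδ j) (cong (_- 1ℤ) e)) (δ k)))
    Near : Vertex → Set
    Near x = j ≡ x ⊎ Adj j x
    step : ∀ {x y} → Near x → Adj x y → Near y
    step (inj₁ refl) xy = inj₂ xy
    -- If y ≠ j, then x is a common neighbour of j and y, although the entry of row j at y, which
    -- counts such neighbours, is 0. So no walk from j leaves its closed neighbourhood.
    step {x} {y} (inj₂ jx) xy with j ≟ᶠ y
    ... | yes j≡y = inj₁ j≡y
    ... | no  j≢y = ⊥-elim (¬0≤-1 (subst 0≤_ (cong₂ _-_ common (cong₂ _*_ (trans (A-sym y x) (adj-1 xy)) (adj-1 jx)))
        (0≤-sum-without (λ k → A y k * A j k) (λ k → 0≤-* (0≤A y k) (0≤A j k)) x)))
      where
      common : sum (λ k → A y k * A j k) ≡ 0ℤ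
      common = trans (sym (ℤ.+-identityˡ _)) (trans
        (cong (λ d → -1ℤ * d + sum (λ k → A y k * A j k)) (sym (δ-≢ j≢y))) (trans (sym (B-δ j y)) (row-0 y)))
    reach : ∀ {x y} → Near x → Star Adj x y → Near y
    reach p nil      = p
    reach p (a ◅ as) = reach (step p a) as
    all-near : ∀ k → 1ℤ - δ j k - A j k ≡ 0ℤ
    all-near k with reach (inj₁ refl) (conn j k)
    ... | inj₁ refl = trans (cong₂ (λ a b → 1ℤ - a - b) (δ-refl j) (A-loop j)) refl
    ... | inj₂ jk with j ≟ᶠ k
    ...   | yes refl = trans (cong (λ a → 1ℤ - 1ℤ - a) (A-loop j)) refl
    ...   | no  j≢k  = cong (λ a → 1ℤ - 0ℤ - a) (adj-1 jk)
    full : pos order - 1ℤ - deg j ≡ 0ℤ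
    full = trans (sym (sum-non-neighbours j)) (sum-0 (λ k → 1ℤ - δ j k - A j k) all-near)
    -- With every vertex equal or adjacent to j, the order would be 2, against order = 2ν + 1 ≥ 5.
    deficit : (ν - pos 2) + (ν - pos 2) + pos 2 ≡ -1ℤ
    deficit = trans (eq ν) (cong (_- 1ℤ) (trans (cong₂ (λ o d → o - 1ℤ - d) (sym order-eq) (sym e)) full))
      where
      eq : ∀ ν → (ν - pos 2) + (ν - pos 2) + pos 2 ≡ pos 2 * ν + 1ℤ - 1ℤ - 1ℤ - 1ℤ
      eq = solve-∀

  deg≥2 : ∀ j → 0≤ deg j - pos 2
  deg≥2 j = 0≤-next (deg j) 0 (deg≥1 j) (deg≢1 j)

  degree-two-vertex : ∃ λ i → deg i ≡ pos 2
  degree-two-vertex with any? (λ i → deg i ℤ.≟ pos 2)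
  ... | yes found = found
  ... | no  none  = ⊥-elim (¬0≤-3 (subst 0≤_ total (0≤-sum (λ j → deg j + - pos 3) deg≥3)))
    where
    ¬0≤-3 : ¬ (0≤ - pos 3)
    ¬0≤-3 ()
    deg≥3 : ∀ j → 0≤ deg j + - pos 3
    deg≥3 j = 0≤-next (deg j) 1 (deg≥2 j) λ e → none (j , e)
    total : sum (λ j → deg j + - pos 3) ≡ - pos 3
    total = trans (∑-distrib-+ deg (λ _ → - pos 3)) (trans (cong₂ _+_ degree-total
      (trans (sum-const order (- pos 3)) (cong (_* - pos 3) order-eq))) (eq ν))
      where
      eq : ∀ ν → pos 6 * ν + (pos 2 * ν + 1ℤ) * - pos 3 ≡ - pos 3
      eq = solve-∀

  module Local (i : Vertex) (deg-i : deg i ≡ pos 2) where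
    open DegreeTwo i deg-i

    module Pair (u v : Vertex) (u≢v : u ≢ v) (nbr : ∀ j → A i j ≡ δ u j + δ v j) where

      -- t records whether i, u, v form a triangle. The vertex i itself is counted in m′.
      t m′ : ℤ
      t  = A u v
      m′ = sum λ k → A u k * A v k

      i~u : A u i ≡ 1ℤ
      i~u = trans (A-sym u i) (trans (nbr u) (cong₂ _+_ (δ-refl u) (δ-≢ (u≢v ∘ sym))))

      i~v : A v i ≡ 1ℤ
      i~v = trans (A-sym v i) (trans (nbr v) (cong₂ _+_ (δ-≢ u≢v) (δ-refl v)))

      i≢u : i ≢ u
      i≢u e = 1≢0 (trans (sym i~u) (trans (cong (A u) e) (A-loop u)))

      i≢v : i ≢ v
      i≢v e = 1≢0 (trans (sym i~v) (trans (cong (A v) e) (A-loop v)))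

      row-sum : ∀ (f : Row order) → sum (λ k → f k * A i k) ≡ f u + f v
      row-sum f = trans (sum-cong-≗ λ k → trans (cong (f k *_) (nbr k)) (eq (f k) (δ u k) (δ v k)))
        (trans (∑-distrib-+ (λ k → δ u k * f k) (λ k → δ v k * f k)) (cong₂ _+_ (sum-δ u f) (sum-δ v f)))
        where
        eq : ∀ f a b → f * (a + b) ≡ a * f + b * f
        eq = solve-∀

      a-eq : ∀ j → B e j ≡ A u j + A v j - δ i j
      a-eq j = trans (B-δ i j) (trans (cong (-1ℤ * δ i j +_) (trans (row-sum (A j)) (cong₂ _+_ (A-sym j u) (A-sym j v))))
        (eq (δ i j) (A u j) (A v j)))
        where
        eq : ∀ d a b → -1ℤ * d + (a + b) ≡ a + b - d
        eq = solve-∀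

      a-u : B e u ≡ t
      a-u = trans (a-eq u) (trans (cong₂ (λ x y → x + y - δ i u) (A-loop u) (A-sym v u))
        (trans (cong (λ d → 0ℤ + t - d) (δ-≢ i≢u)) (eq t)))
        where
        eq : ∀ t → 0ℤ + t - 0ℤ ≡ t
        eq = solve-∀

      a-v : B e v ≡ t
      a-v = trans (a-eq v) (trans (cong₂ (λ x y → t + x - y) (A-loop v) (δ-≢ i≢v)) (eq t))
        where
        eq : ∀ t → t + 0ℤ - 0ℤ ≡ t
        eq = solve-∀

      τ-eq : τ ≡ pos 2 * t
      τ-eq = begin
        mom 3 e e
          ≡⟨ sym (mom-shift 2 1 e e) ⟩
        ⟨ M (M e) , M e ⟩
          ≡⟨ ⟨⟩-cong {u = M (M e)} (λ _ → refl) (M-δ i) ⟩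
        sum (λ k → M (M e) k * A i k)
          ≡⟨ row-sum (M (M e)) ⟩
        M (M e) u + M (M e) v
          ≡⟨ cong₂ _+_ (two u) (two v) ⟩
        (A u u + A u v) + (A v u + A v v)
          ≡⟨ cong₂ (λ x y → (x + t) + (y + A v v)) (A-loop u) (A-sym v u) ⟩
        (0ℤ + t) + (t + A v v)
          ≡⟨ cong (λ x → (0ℤ + t) + (t + x)) (A-loop v) ⟩
        (0ℤ + t) + (t + 0ℤ)
          ≡⟨ eq t ⟩
        pos 2 * t ∎
        where
        two : ∀ j → M (M e) j ≡ A j u + A j v
        two j = trans (sum-cong-≗ λ k → cong (A j k *_) (M-δ i k)) (row-sum (A j))
        eq : ∀ t → (0ℤ + t) + (t + 0ℤ) ≡ pos 2 * t
        eq = solve-∀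

      -- B commutes with A, so B q = A (B e) - τ B e. By `a-eq` the first vector has the value deg u
      -- + m′ - 1 at u.
      g-u : B q u ≡ deg u + m′ - 1ℤ - τ * t
      g-u = begin
        B q u
          ≡⟨ cong (-1ℤ * q u +_) (M^-lin 2 (- τ) e (M e) u) ⟩
        -1ℤ * (- τ * e u + M e u) + (- τ * M (M e) u + M (M (M e)) u)
          ≡⟨ eq₁ τ (e u) (M e u) (M (M e) u) (M (M (M e)) u) ⟩
        (-1ℤ * M e u + M (M (M e)) u) - τ * B e u
          ≡⟨ cong₂ (λ a b → a - τ * b) (sym (M-lin -1ℤ e (M (M e)) u)) a-u ⟩
        M (B e) u - τ * t
          ≡⟨ cong (_- τ * t) (trans (sum-cong-≗ λ k → trans (cong (A u k *_) (a-eq k)) (trans (eq₂ (A u k) (A v k) (δ i k))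
               (cong (_+ (A u k * A v k + (- 1ℤ) * (δ i k * A u k))) (A-idem u k))))
             (trans (∑-distrib-+ (A u) _) (cong (deg u +_) (∑-distrib-+ (λ k → A u k * A v k) _)))) ⟩
        deg u + (m′ + sum (λ k → (- 1ℤ) * (δ i k * A u k))) - τ * t
          ≡⟨ cong (λ s → deg u + (m′ + s) - τ * t) (trans (sym (*-distribˡ-sum (- 1ℤ) λ k → δ i k * A u k))
               (cong ((- 1ℤ) *_) (trans (sum-δ i (A u)) i~u))) ⟩
        deg u + (m′ + (- 1ℤ) * 1ℤ) - τ * t
          ≡⟨ eq₃ (deg u) m′ (τ * t) ⟩
        deg u + m′ - 1ℤ - τ * t ∎
        where
        eq₁ : ∀ τ a b c d → -1ℤ * (- τ * a + b) + (- τ * c + d) ≡ (-1ℤ * b + d) - τ * (-1ℤ * a + c)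
        eq₁ = solve-∀
        eq₂ : ∀ a b d → a * (a + b - d) ≡ a * a + (a * b + (- 1ℤ) * (d * a))
        eq₂ = solve-∀
        eq₃ : ∀ d m x → d + (m + (- 1ℤ) * 1ℤ) - x ≡ d + m - 1ℤ - x
        eq₃ = solve-∀

      -- The norm |B e|² computed in two ways: from the moments it is 2ν - 1 + τ, from the entries
      -- `a-eq` it is deg u + deg v + 2m′ - 3.
      degree-pair : deg u + deg v ≡ pos 2 * ν + pos 2 + τ - pos 2 * m′
      degree-pair = ℤ.i-j≡0⇒i≡j _ _ (trans (eq₁ (deg u) (deg v) m′ ν τ) (ℤ.i≡j⇒i-j≡0 (trans (sym direct) BeBe)))
        where
        eq₁ : ∀ d d′ m ν τ → d + d′ - (pos 2 * ν + pos 2 + τ - pos 2 * m)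
            ≡ d + (d′ + (pos 2 * m + (1ℤ + - pos 2 * (1ℤ + 1ℤ)))) - (pos 2 * ν - 1ℤ + τ)
        eq₁ = solve-∀
        eq₂ : ∀ a b d → (a + b - d) * (a + b - d) ≡ a * a + (b * b + (pos 2 * (a * b) + (d * d + - pos 2 * (d * a + d * b))))
        eq₂ = solve-∀
        term : ∀ k → B e k * B e k ≡ A u k + (A v k + (pos 2 * (A u k * A v k) + (δ i k * 1ℤ + - pos 2 * (δ i k * A u k + δ i k * A v k))))
        term k = trans (cong₂ _*_ (a-eq k) (a-eq k)) (trans (eq₂ (A u k) (A v k) (δ i k))
          (cong₂ _+_ (A-idem u k) (cong₂ _+_ (A-idem v k) (cong (λ d → pos 2 * (A u k * A v k) + (d + - pos 2 * (δ i k * A u k + δ i k * A v k)))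
            (trans (1ᵇ-idem (does (i ≟ᶠ k))) (sym (ℤ.*-identityʳ (δ i k))))))))
        direct : ⟨ B e , B e ⟩ ≡ deg u + (deg v + (pos 2 * m′ + (1ℤ + - pos 2 * (1ℤ + 1ℤ))))
        direct = begin
          ⟨ B e , B e ⟩
            ≡⟨ sum-cong-≗ term ⟩
          sum (λ k → A u k + (A v k + (pos 2 * (A u k * A v k) + (δ i k * 1ℤ + - pos 2 * (δ i k * A u k + δ i k * A v k)))))
            ≡⟨ ∑-distrib-+ (A u) _ ⟩
          _ ≡⟨ cong (deg u +_) (∑-distrib-+ (A v) _) ⟩
          _ ≡⟨ cong (λ s → deg u + (deg v + s)) (sum-lin (pos 2) (λ k → A u k * A v k) _) ⟩
          _ ≡⟨ cong (λ s → deg u + (deg v + (pos 2 * m′ + s))) (∑-distrib-+ (λ k → δ i k * 1ℤ) _) ⟩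
          _ ≡⟨ cong₂ (λ s s′ → deg u + (deg v + (pos 2 * m′ + (s + s′)))) (sum-δ i (λ _ → 1ℤ))
                 (trans (sym (*-distribˡ-sum (- pos 2) λ k → δ i k * A u k + δ i k * A v k))
                   (cong (- pos 2 *_) (trans (∑-distrib-+ (λ k → δ i k * A u k) (λ k → δ i k * A v k))
                     (cong₂ _+_ (trans (sum-δ i (A u)) i~u) (trans (sum-δ i (A v)) i~v))))) ⟩
          deg u + (deg v + (pos 2 * m′ + (1ℤ + - pos 2 * (1ℤ + 1ℤ)))) ∎

      m′≥1 : 0≤ m′ - 1ℤ
      m′≥1 = subst 0≤_ (cong₂ (λ a b → m′ - a * b) i~u i~v)
        (0≤-sum-without (λ k → A u k * A v k) (λ k → 0≤-* (0≤A u k) (0≤A v k)) i)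

      deg-u≥m′ : 0≤ deg u - m′
      deg-u≥m′ = subst 0≤_ (trans (∑-distrib-+ (A u) (λ k → -1ℤ * (A u k * A v k)))
          (trans (cong (deg u +_) (sym (*-distribˡ-sum -1ℤ λ k → A u k * A v k))) (eq′ (deg u) m′)))
        (0≤-sum (λ k → A u k + -1ℤ * (A u k * A v k)) λ k → subst 0≤_ (eq (A u k) (A v k)) (0≤-* (0≤A u k) (0≤1-1ᵇ (adj v k))))
        where
        eq : ∀ a b → a * (1ℤ - b) ≡ a + -1ℤ * (a * b)
        eq = solve-∀
        eq′ : ∀ d m → d + -1ℤ * m ≡ d - m
        eq′ = solve-∀

      -- The indicator of the vertices adjacent to neither u nor v. It omits i, so B e vanishes at
      -- all of them; it contains u and v when these are not adjacent.
      far : Row order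
      far j = (1ℤ - A u j) * (1ℤ - A v j)

      sum-far : sum far ≡ pos 3 * m′ - 1ℤ - τ
      sum-far = begin
        sum far
          ≡⟨ sum-cong-≗ (λ j → eq₁ (A u j) (A v j)) ⟩
        sum (λ j → -1ℤ * A u j + (-1ℤ * A v j + (A u j * A v j + 1ℤ)))
          ≡⟨ trans (sum-lin -1ℤ (A u) _) (cong (-1ℤ * deg u +_) (trans (sum-lin -1ℤ (A v) _) (cong (-1ℤ * deg v +_)
               (trans (∑-distrib-+ (λ j → A u j * A v j) (λ _ → 1ℤ)) (cong (m′ +_) (trans (sum-const order 1ℤ) (cong (_* 1ℤ) order-eq))))))) ⟩
        -1ℤ * deg u + (-1ℤ * deg v + (m′ + (pos 2 * ν + 1ℤ) * 1ℤ))
          ≡⟨ eq₂ (deg u) (deg v) m′ ν ⟩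
        m′ + pos 2 * ν + 1ℤ - (deg u + deg v)
          ≡⟨ cong (λ s → m′ + pos 2 * ν + 1ℤ - s) degree-pair ⟩
        m′ + pos 2 * ν + 1ℤ - (pos 2 * ν + pos 2 + τ - pos 2 * m′)
          ≡⟨ eq₃ m′ ν τ ⟩
        pos 3 * m′ - 1ℤ - τ ∎
        where
        eq₁ : ∀ a b → (1ℤ - a) * (1ℤ - b) ≡ -1ℤ * a + (-1ℤ * b + (a * b + 1ℤ))
        eq₁ = solve-∀
        eq₂ : ∀ d d′ m ν → -1ℤ * d + (-1ℤ * d′ + (m + (pos 2 * ν + 1ℤ) * 1ℤ)) ≡ m + pos 2 * ν + 1ℤ - (d + d′)
        eq₂ = solve-∀
        eq₃ : ∀ m ν τ → m + pos 2 * ν + 1ℤ - (pos 2 * ν + pos 2 + τ - pos 2 * m) ≡ pos 3 * m - 1ℤ - τ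
        eq₃ = solve-∀

      sum-slack : sum slack ≡ pos 2 * ν - τ
      sum-slack = trans (trans (sum-cong-≗ λ j → eq₁ (deg j - 1ℤ) (B e j * B e j))
          (trans (sum-lin -1ℤ (λ j → B e j * B e j) (λ j → deg j - 1ℤ)) (cong₂ (λ a b → -1ℤ * a + b) BeBe sum-deg-1)))
        (eq₂ ν τ)
        where
        eq₁ : ∀ a b → a - b ≡ -1ℤ * b + a
        eq₁ = solve-∀
        eq₂ : ∀ ν τ → -1ℤ * (pos 2 * ν - 1ℤ + τ) + (pos 4 * ν - 1ℤ) ≡ pos 2 * ν - τ
        eq₂ = solve-∀

      -- Where `far` is 1, B e is 0 and the slack is deg j - 1, so a lower bound c need only be
      -- known for such vertices; elsewhere nonnegativity suffices.
      far-slack : ∀ c → (∀ j → 0≤ slack j) → (∀ j → slack j ≡ deg j - 1ℤ → 0≤ slack j - c) →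
        ∀ j → 0≤ slack j - c * far j
      far-slack c slack≥0 large j = cases (adj u j) (adj v j) refl refl
        where
        s = slack j
        near : ∀ x → far j ≡ x → x ≡ 0ℤ → 0≤ s - c * far j
        near x e z = subst 0≤_ (trans (eq c s) (cong (λ f → s - c * f) (sym (trans e z)))) (slack≥0 j)
          where
          eq : ∀ c s → s ≡ s - c * 0ℤ
          eq = solve-∀
        cases : ∀ x y → adj u j ≡ x → adj v j ≡ y → 0≤ s - c * far j
        cases true y uj vj = near (0ℤ * (1ℤ - A v j)) (cong (λ x → (1ℤ - 1ᵇ x) * (1ℤ - A v j)) uj) refl
        cases false true uj vj = near 0ℤ (cong₂ (λ x y → (1ℤ - 1ᵇ x) * (1ℤ - 1ᵇ y)) uj vj) refl
        cases false false uj vj = subst 0≤_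
            (trans (eq c s) (cong (λ f → s - c * f) (sym (cong₂ (λ x y → (1ℤ - 1ᵇ x) * (1ℤ - 1ᵇ y)) uj vj))))
            (large j (trans (cong (λ a → deg j - 1ℤ - a * a) a-j) (eq′ (deg j - 1ℤ))))
          where
          i≢j : i ≢ j
          i≢j e = 1≢0 (trans (sym i~u) (trans (cong (A u) e) (cong 1ᵇ uj)))
          a-j : B e j ≡ 0ℤ
          a-j = trans (a-eq j) (trans (cong₂ (λ x y → 1ᵇ x + 1ᵇ y - δ i j) uj vj) (cong (λ d → 0ℤ + 0ℤ - d) (δ-≢ i≢j)))
          eq : ∀ c s → s - c ≡ s - c * 1ℤ
          eq = solve-∀
          eq′ : ∀ d → d - 0ℤ * 0ℤ ≡ d
          eq′ = solve-∀

      slack-u : slack u ≡ deg u - 1ℤ - t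
      slack-u = cong (λ a → deg u - 1ℤ - a) (trans (cong₂ _*_ a-u a-u) (A-idem u v))

      slack-v : slack v ≡ deg v - 1ℤ - t
      slack-v = cong (λ a → deg v - 1ℤ - a) (trans (cong₂ _*_ a-v a-v) (A-idem u v))

      -- Each far vertex has slack at least 1, as degrees are at least 2. At u and v the surplus
      -- slack - far is deg - 2, whether or not they are adjacent; subtracting these two from the
      -- nonnegative total and inserting `degree-pair` leaves 3 - m′ - τ.
      m′-bound : (∀ j → 0≤ slack j) → 0≤ pos 3 - m′ - τ
      m′-bound slack≥0 = subst 0≤_ total (0≤-sum-without₂ h (far-slack 1ℤ slack≥0 large) u≢v)
        where
        h : Row order
        h j = slack j - 1ℤ * far j
        large : ∀ j → slack j ≡ deg j - 1ℤ → 0≤ slack j - 1ℤ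
        large j e = subst 0≤_ (trans (eq (deg j)) (cong (_- 1ℤ) (sym e))) (deg≥2 j)
          where
          eq : ∀ d → d - pos 2 ≡ d - 1ℤ - 1ℤ
          eq = solve-∀
        h-u : h u ≡ deg u - pos 2
        h-u = trans (cong₂ (λ s a → s - 1ℤ * ((1ℤ - a) * (1ℤ - A v u))) slack-u (A-loop u))
          (trans (cong (λ a → deg u - 1ℤ - t - 1ℤ * ((1ℤ - 0ℤ) * (1ℤ - a))) (A-sym v u)) (eq (deg u) t))
          where
          eq : ∀ d t → d - 1ℤ - t - 1ℤ * ((1ℤ - 0ℤ) * (1ℤ - t)) ≡ d - pos 2
          eq = solve-∀
        h-v : h v ≡ deg v - pos 2
        h-v = trans (cong₂ (λ s a → s - 1ℤ * ((1ℤ - t) * (1ℤ - a))) slack-v (A-loop v)) (eq (deg v) t)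
          where
          eq : ∀ d t → d - 1ℤ - t - 1ℤ * ((1ℤ - t) * (1ℤ - 0ℤ)) ≡ d - pos 2
          eq = solve-∀
        total : sum h - (h u + h v) ≡ pos 3 - m′ - τ
        total = begin
          sum h - (h u + h v)
            ≡⟨ cong₂ _-_ (trans (sum-cong-≗ λ j → eq₁ (slack j) (far j)) (trans (sum-lin -1ℤ far slack)
                 (cong₂ (λ a b → -1ℤ * a + b) sum-far sum-slack))) (trans (cong₂ _+_ h-u h-v) (eq₂ (deg u) (deg v))) ⟩
          -1ℤ * (pos 3 * m′ - 1ℤ - τ) + (pos 2 * ν - τ) - (deg u + deg v - pos 4)
            ≡⟨ cong (λ s → -1ℤ * (pos 3 * m′ - 1ℤ - τ) + (pos 2 * ν - τ) - (s - pos 4)) degree-pair ⟩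
          -1ℤ * (pos 3 * m′ - 1ℤ - τ) + (pos 2 * ν - τ) - (pos 2 * ν + pos 2 + τ - pos 2 * m′ - pos 4)
            ≡⟨ eq₃ m′ ν τ ⟩
          pos 3 - m′ - τ ∎
          where
          eq₁ : ∀ s f → s - 1ℤ * f ≡ -1ℤ * f + s
          eq₁ = solve-∀
          eq₂ : ∀ d d′ → d - pos 2 + (d′ - pos 2) ≡ d + d′ - pos 4
          eq₂ = solve-∀
          eq₃ : ∀ m ν τ → -1ℤ * (pos 3 * m - 1ℤ - τ) + (pos 2 * ν - τ) - (pos 2 * ν + pos 2 + τ - pos 2 * m - pos 4) ≡ pos 3 - m - τ
          eq₃ = solve-∀

      weighted : ∀ c → (∀ j → 0≤ slack j) → (∀ j → slack j ≡ deg j - 1ℤ → 0≤ slack j - c) →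
        0≤ pos 2 * ν - τ - c * (pos 3 * m′ - 1ℤ - τ)
      weighted c slack≥0 large = subst 0≤_ total (0≤-sum (λ j → slack j - c * far j) (far-slack c slack≥0 large))
        where
        eq : ∀ c s f → s - c * f ≡ - c * f + s
        eq = solve-∀
        eq′ : ∀ c a b → - c * a + b ≡ b - c * a
        eq′ = solve-∀
        total : sum (λ j → slack j - c * far j) ≡ pos 2 * ν - τ - c * (pos 3 * m′ - 1ℤ - τ)
        total = trans (sum-cong-≗ λ j → eq c (slack j) (far j)) (trans (sum-lin (- c) far slack)
          (trans (cong₂ (λ a b → - c * a + b) sum-far sum-slack) (eq′ c (pos 3 * m′ - 1ℤ - τ) (pos 2 * ν - τ))))

      -- Here τ = 2 forces m′ = 1. Tightness at u becomes (2ν - 2)(deg u - 2) = (deg u - 2)², so deg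
      -- u is 2 or 2ν; since deg u + deg v = 2ν + 2, in the first case v is the hub.
      triangle : t ≡ 1ℤ → Hub
      triangle t≡1 = conclude (factor (deg u) (deg v) ν equation sums)
        where
        τ≡2 : τ ≡ pos 2
        τ≡2 = trans τ-eq (cong (pos 2 *_) t≡1)
        σ≡ : σ ≡ pos 2 * ν - pos 2
        σ≡ = trans (cong (λ x → pos 2 * ν + x - x * x) τ≡2) (eq ν)
          where
          eq : ∀ ν → pos 2 * ν + pos 2 - pos 2 * pos 2 ≡ pos 2 * ν - pos 2
          eq = solve-∀
        σ≥1 : 1ℤ ≤ σ
        σ≥1 = 0≤⇒≤ (subst 0≤_ (trans (eq ν) (cong (_- 1ℤ) (sym σ≡))) (0≤-+ (0≤-+ n≥2 n≥2) (ℤᵇ.+≤+ (ℕ.z≤n {1}))))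
          where
          eq : ∀ ν → (ν - pos 2) + (ν - pos 2) + 1ℤ ≡ pos 2 * ν - pos 2 - 1ℤ
          eq = solve-∀
        slack≥0 : ∀ j → 0≤ slack j
        slack≥0 j = 0≤-cancel {σ} σ≥1 (subst 0≤_ (sym (tight σ≥1 j)) (0≤-square (B q j)))
        m′≡1 : m′ ≡ 1ℤ
        m′≡1 = ℤ.i-j≡0⇒i≡j m′ 1ℤ (0≤-antisym m′≥1 (subst 0≤_ (trans (cong (λ x → pos 3 - m′ - x) τ≡2) (eq m′)) (m′-bound slack≥0)))
          where
          eq : ∀ m → pos 3 - m - pos 2 ≡ - (m - 1ℤ)
          eq = solve-∀
        Bq-u : B q u ≡ deg u - pos 2
        Bq-u = trans g-u (trans (cong₂ (λ a b → deg u + m′ - 1ℤ - a * b) τ≡2 t≡1)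
          (trans (cong (λ a → deg u + a - 1ℤ - pos 2 * 1ℤ) m′≡1) (eq (deg u))))
          where
          eq : ∀ d → d + 1ℤ - 1ℤ - pos 2 * 1ℤ ≡ d - pos 2
          eq = solve-∀
        slack-u′ : slack u ≡ deg u - pos 2
        slack-u′ = trans slack-u (trans (cong (λ a → deg u - 1ℤ - a) t≡1) (eq (deg u)))
          where
          eq : ∀ d → d - 1ℤ - 1ℤ ≡ d - pos 2
          eq = solve-∀
        equation : (pos 2 * ν - pos 2) * (deg u - pos 2) ≡ (deg u - pos 2) * (deg u - pos 2)
        equation = trans (sym (cong₂ _*_ σ≡ slack-u′)) (trans (tight σ≥1 u) (cong₂ _*_ Bq-u Bq-u))
        sums : deg u + deg v ≡ pos 2 * ν + pos 2
        sums = trans degree-pair (trans (cong₂ (λ a b → pos 2 * ν + pos 2 + a - pos 2 * b) τ≡2 m′≡1) (eq ν))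
          where
          eq : ∀ ν → pos 2 * ν + pos 2 + pos 2 - pos 2 * 1ℤ ≡ pos 2 * ν + pos 2
          eq = solve-∀
        conclude : (deg u ≡ pos 2 * ν) ⊎ (deg v ≡ pos 2 * ν) → Hub
        conclude (inj₁ e) = u , e
        conclude (inj₂ e) = v , e
        factor : ∀ a b ν → (pos 2 * ν - pos 2) * (a - pos 2) ≡ (a - pos 2) * (a - pos 2) → a + b ≡ pos 2 * ν + pos 2 →
          (a ≡ pos 2 * ν) ⊎ (b ≡ pos 2 * ν)
        factor a b ν e s with ℤ.i*j≡0⇒i≡0∨j≡0 (a - pos 2) (trans (eq a ν) (ℤ.i≡j⇒i-j≡0 e))
          where
          eq : ∀ a ν → (a - pos 2) * (pos 2 * ν - a) ≡ (pos 2 * ν - pos 2) * (a - pos 2) - (a - pos 2) * (a - pos 2)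
          eq = solve-∀
        ... | inj₁ a≡2 = inj₂ (ℤ.i-j≡0⇒i≡j b (pos 2 * ν) (trans (eq a b ν) (cong₂ _-_ (ℤ.i≡j⇒i-j≡0 s) a≡2)))
          where
          eq : ∀ a b ν → b - pos 2 * ν ≡ (a + b - (pos 2 * ν + pos 2)) - (a - pos 2)
          eq = solve-∀
        ... | inj₂ e′  = inj₁ (sym (ℤ.i-j≡0⇒i≡j (pos 2 * ν) a e′))

      -- Here τ = 0, and tightness at u together with `degree-pair` says (deg u - 1)(deg v - 1) =
      -- m′² with 1 ≤ m′ ≤ 3.
      no-triangle : t ≡ 0ℤ → 0≤ deg v - m′ → deg u ≡ pos 2 × deg v ≡ pos 2
      no-triangle t≡0 deg-v≥m′ = conclude (small-solutions ν (deg u - 1ℤ) (deg v - 1ℤ) m′ m′≥1 m′≤3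
          (subst 0≤_ (eq₁ (deg u)) (deg≥2 u)) (subst 0≤_ (eq₁ (deg v)) (deg≥2 v))
          (subst 0≤_ (eq₂ (deg u) m′) deg-u≥m′) (subst 0≤_ (eq₂ (deg v) m′) deg-v≥m′)
          (trans (eq₃ (deg u) (deg v) m′) (trans (cong (λ s → s - pos 2 + pos 2 * m′) degree-pair)
            (trans (cong (λ a → pos 2 * ν + pos 2 + a - pos 2 * m′ - pos 2 + pos 2 * m′) τ≡0) (eq₄ ν m′))))
          equation)
        where
        eq₁ : ∀ d → d - pos 2 ≡ d - 1ℤ - 1ℤ
        eq₁ = solve-∀
        eq₂ : ∀ d m → d - m ≡ d - 1ℤ + 1ℤ - m
        eq₂ = solve-∀
        eq₃ : ∀ d d′ m → d - 1ℤ + (d′ - 1ℤ) + pos 2 * m ≡ d + d′ - pos 2 + pos 2 * m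
        eq₃ = solve-∀
        eq₄ : ∀ ν m → pos 2 * ν + pos 2 + 0ℤ - pos 2 * m - pos 2 + pos 2 * m ≡ pos 2 * ν
        eq₄ = solve-∀
        τ≡0 : τ ≡ 0ℤ
        τ≡0 = trans τ-eq (cong (pos 2 *_) t≡0)
        σ≡ : σ ≡ pos 2 * ν
        σ≡ = trans (cong (λ x → pos 2 * ν + x - x * x) τ≡0) (eq ν)
          where
          eq : ∀ ν → pos 2 * ν + 0ℤ - 0ℤ * 0ℤ ≡ pos 2 * ν
          eq = solve-∀
        σ≥1 : 1ℤ ≤ σ
        σ≥1 = 0≤⇒≤ (subst 0≤_ (trans (eq ν) (cong (_- 1ℤ) (sym σ≡))) (0≤-+ (0≤-+ n≥2 n≥2) (ℤᵇ.+≤+ (ℕ.z≤n {3}))))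
          where
          eq : ∀ ν → (ν - pos 2) + (ν - pos 2) + pos 3 ≡ pos 2 * ν - 1ℤ
          eq = solve-∀
        slack≥0 : ∀ j → 0≤ slack j
        slack≥0 j = 0≤-cancel {σ} σ≥1 (subst 0≤_ (sym (tight σ≥1 j)) (0≤-square (B q j)))
        m′≤3 : 0≤ pos 3 - m′
        m′≤3 = subst 0≤_ (trans (cong (λ x → pos 3 - m′ - x) τ≡0) (ℤ.+-identityʳ (pos 3 - m′))) (m′-bound slack≥0)
        equation : pos 2 * ν * (deg u - 1ℤ) ≡ (deg u - 1ℤ + m′) * (deg u - 1ℤ + m′)
        equation = trans (sym (cong₂ _*_ σ≡ (trans slack-u (trans (cong (λ a → deg u - 1ℤ - a) t≡0) (ℤ.+-identityʳ (deg u - 1ℤ))))))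
          (trans (tight σ≥1 u) (cong₂ _*_ Bq-u Bq-u))
          where
          eq : ∀ d m t → d + m - 1ℤ - 0ℤ * t ≡ d - 1ℤ + m
          eq = solve-∀
          Bq-u : B q u ≡ deg u - 1ℤ + m′
          Bq-u = trans g-u (trans (cong (λ a → deg u + m′ - 1ℤ - a * t) τ≡0) (eq (deg u) m′ t))
        slack-square : ∀ j {c s} → pos 2 * ν ≡ c → slack j ≡ s → B q j * B q j ≡ c * s
        slack-square j e e′ = trans (sym (tight σ≥1 j)) (cong₂ _*_ (trans σ≡ e) e′)
        large₁ : ∀ j → slack j ≡ deg j - 1ℤ → 0≤ slack j - pos 1
        large₁ j e = subst 0≤_ (trans (eq₁ (deg j)) (cong (_- 1ℤ) (sym e))) (deg≥2 j)
        bound : ∀ c → (∀ j → slack j ≡ deg j - 1ℤ → 0≤ slack j - c) → 0≤ pos 2 * ν - 0ℤ - c * (pos 3 * m′ - 1ℤ - 0ℤ)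
        bound c large = subst (λ x → 0≤ pos 2 * ν - x - c * (pos 3 * m′ - 1ℤ - x)) τ≡0 (weighted c slack≥0 large)
        conclude : Solution ν (deg u - 1ℤ) (deg v - 1ℤ) m′ → deg u ≡ pos 2 × deg v ≡ pos 2
        conclude (ones p q) = ℤ.i-j≡0⇒i≡j (deg u) (pos 2) (trans (eq₁ (deg u)) (cong (_- 1ℤ) p))
                            , ℤ.i-j≡0⇒i≡j (deg v) (pos 2) (trans (eq₁ (deg v)) (cong (_- 1ℤ) q))
        -- Tightness makes 8 · slack a square, so the slack of a far vertex is not 1 and is at least
        -- 2. The 3m′ - 1 = 5 far vertices then need 10, but the total slack is 8.
        conclude (twos m≡2 ν≡4) = ⊥-elim (absurd (subst₂ (λ a b → 0≤ a - 0ℤ - pos 2 * (pos 3 * b - 1ℤ - 0ℤ)) ν≡4 m≡2 (bound (pos 2) large₂)))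
          where
          large₂ : ∀ j → slack j ≡ deg j - 1ℤ → 0≤ slack j - pos 2
          large₂ j e = 0≤-next (slack j) 0 (large₁ j e) λ s≡1 →
            no-square-between 2 8 (ℕ.m≤n+m 5 3) (ℕ.m≤n+m 9 0) (B q j) (slack-square j ν≡4 s≡1)
          absurd : ¬ (0≤ - pos 2)
          absurd ()
        -- Neither 12 nor 24 is a square, so far vertices have slack at least 3. There are 8 of
        -- them, needing 24 out of a total of 12.
        conclude (threes m≡3 ν≡6) = ⊥-elim (absurd (subst₂ (λ a b → 0≤ a - 0ℤ - pos 3 * (pos 3 * b - 1ℤ - 0ℤ)) ν≡6 m≡3 (bound (pos 3) large₃)))
          where
          large₃ : ∀ j → slack j ≡ deg j - 1ℤ → 0≤ slack j - pos 3
          large₃ j e = 0≤-next (slack j) 1 (0≤-next (slack j) 0 (large₁ j e) λ s≡1 →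
              no-square-between 3 12 (ℕ.m≤n+m 10 2) (ℕ.m≤n+m 13 3) (B q j) (slack-square j ν≡6 s≡1)) λ s≡2 →
            no-square-between 4 24 (ℕ.m≤n+m 17 7) (ℕ.m≤n+m 25 0) (B q j) (slack-square j ν≡6 s≡2)
          absurd : ¬ (0≤ - pos 12)
          absurd ()

    outcome : Hub ⊎ (∀ k → Adj i k → deg k ≡ pos 2)
    outcome = let u , v , u≢v , nbr = sum-1ᵇ-2 (adj i) deg-i in cases u v u≢v nbr (adj u v) refl
      where
      cases : ∀ u v → u ≢ v → (∀ j → A i j ≡ δ u j + δ v j) → ∀ b → adj u v ≡ b →
        Hub ⊎ (∀ k → Adj i k → deg k ≡ pos 2)
      cases u v u≢v nbr true  uv = inj₁ (Pair.triangle u v u≢v nbr (cong 1ᵇ uv))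
      cases u v u≢v nbr false uv = inj₂ λ k ik → pick k (u ≟ᶠ k) (v ≟ᶠ k) (trans (sym (nbr k)) (adj-1 ik))
        where
        module P = Pair u v u≢v nbr
        deg-v≥m′ : 0≤ deg v - P.m′
        deg-v≥m′ = subst (λ m → 0≤ deg v - m) (sum-cong-≗ λ k → ℤ.*-comm (A v k) (A u k))
          (Pair.deg-u≥m′ v u (u≢v ∘ sym) (λ j → trans (nbr j) (ℤ.+-comm (δ u j) (δ v j))))
        degs : deg u ≡ pos 2 × deg v ≡ pos 2
        degs = P.no-triangle (cong 1ᵇ uv) deg-v≥m′
        pick : ∀ k → Dec (u ≡ k) → Dec (v ≡ k) → δ u k + δ v k ≡ 1ℤ → deg k ≡ pos 2
        pick k (yes refl) _          _ = proj₁ degs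
        pick k (no _)     (yes refl) _ = proj₂ degs
        pick k (no u≢k)   (no v≢k)   e = ⊥-elim (1≢0 (sym (trans (sym (cong₂ _+_ (δ-≢ u≢k) (δ-≢ v≢k))) e)))

  hub : Hub
  hub = finish (all? λ j → deg j ℤ.≟ pos 2)
    where
    i₀ : ∃ λ i → deg i ≡ pos 2
    i₀ = degree-two-vertex
    -- A hub may turn up at any vertex of the walk, so the alternative is carried along until the
    -- walk ends.
    step : ∀ {x y} → Hub ⊎ deg x ≡ pos 2 → Adj x y → Hub ⊎ deg y ≡ pos 2
    step (inj₁ h) _ = inj₁ h
    step {x} {y} (inj₂ dx) xy = [ inj₁ , (λ f → inj₂ (f y xy)) ]′ (Local.outcome x dx)
    reach : ∀ {x y} → Hub ⊎ deg x ≡ pos 2 → Star Adj x y → Hub ⊎ deg y ≡ pos 2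
    reach p nil      = p
    reach p (a ◅ as) = reach (step p a) as
    finish : Dec (∀ j → deg j ≡ pos 2) → Hub
    -- All degrees equal to 2 would give 6ν = 2(2ν + 1), that is ν = 1.
    finish (yes all-two) = ⊥-elim (¬0≤-1 (subst 0≤_ (trans (eq ν) (cong (_- 1ℤ) (ℤ.i≡j⇒i-j≡0 total)))
        (0≤-+ (0≤-+ n≥2 n≥2) (ℤᵇ.+≤+ (ℕ.z≤n {1})))))
      where
      total : pos 6 * ν ≡ (pos 2 * ν + 1ℤ) * pos 2
      total = trans (sym degree-total) (trans (sum-cong-≗ all-two) (trans (sum-const order (pos 2)) (cong (_* pos 2) order-eq)))
      eq : ∀ ν → (ν - pos 2) + (ν - pos 2) + 1ℤ ≡ pos 6 * ν - (pos 2 * ν + 1ℤ) * pos 2 - 1ℤ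
      eq = solve-∀
    finish (no ¬all) = let j , dj = ¬∀⟶∃¬ order (λ j → deg j ≡ pos 2) (λ j → deg j ℤ.≟ pos 2) ¬all in
      [ id , ⊥-elim ∘ dj ]′ (reach (inj₂ (proj₂ i₀)) (conn (proj₁ i₀) j))

-- Reconstruction of the friendship graph

transpose-right : ∀ {n} (i j : Fin n) → transpose i j ⟨$⟩ʳ j ≡ i
transpose-right i j with j ≟ᶠ i
... | yes j≡i = j≡i
... | no  _ with j ≟ᶠ j
...   | yes _   = refl
...   | no  j≢j = ⊥-elim (j≢j refl)

1ᵇ-true : ∀ {b} → 1ᵇ b ≡ 1ℤ → b ≡ true
1ᵇ-true {true} _ = refl

1ᵇ-false : ∀ {b} → 1ᵇ b ≡ 0ℤ → b ≡ false
1ᵇ-false {false} _ = refl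

_Transports_To_ : ∀ {m n} → Permutation m n → (Fin m → Fin m → Bool) → (Fin n → Fin n → Bool) → Set
ρ Transports a To b = ∀ i j → a i j ≡ b (ρ ⟨$⟩ʳ i) (ρ ⟨$⟩ʳ j)

relabel : ∀ {m} → Permutation′ m → (Fin m → Fin m → Bool) → Fin m → Fin m → Bool
relabel τ a i j = a (τ ⟨$⟩ʳ i) (τ ⟨$⟩ʳ j)

relabel-transports : ∀ {m n} (τ : Permutation′ m) a {b} (ρ : Permutation m n) →
  ρ Transports relabel τ a To b → (flip τ ∘ₚ ρ) Transports a To b
relabel-transports τ a ρ h i j =
  trans (sym (cong₂ a (inverseʳ τ) (inverseʳ τ))) (h (τ ⟨$⟩ˡ i) (τ ⟨$⟩ˡ j))

relabel-row : ∀ {m} (τ : Permutation′ m) a i → sum (1ᵇ ∘ relabel τ a i) ≡ sum (1ᵇ ∘ a (τ ⟨$⟩ʳ i))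
relabel-row τ a i = sym (sum-permute (1ᵇ ∘ a (τ ⟨$⟩ʳ i)) τ)

-- All row sums being 1, the graph is a perfect matching. The partner of vertex 0 is moved next to
-- it, this pair is split off, and the rest is again a matching.
matching-unique : ∀ n (a : Fin (n ℕ.* 2) → Fin (n ℕ.* 2) → Bool) →
  (∀ i j → a i j ≡ a j i) → (∀ i → a i i ≡ false) → (∀ i → sum (1ᵇ ∘ a i) ≡ 1ℤ) →
  ∃ λ (ρ : Permutation′ (n ℕ.* 2)) →
    ρ Transports a To (λ i j → Graph.adj (friendshipGraph n) (suc i) (suc j))
matching-unique zero    a a-sym a-irr row = idₚ , λ ()
matching-unique (suc n) a a-sym a-irr row with sum-1ᵇ-1 (a zero) (row zero)
... | zero  , h = ⊥-elim (1≢0 (trans (sym (h zero)) (cong 1ᵇ (a-irr zero))))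
... | suc k , h = let ρ , t = matching-unique n c (λ i j → b-sym (suc (suc i)) (suc (suc j))) (λ i → b-irr (suc (suc i))) c-row in
    (flip τ ∘ₚ lift₀ (lift₀ ρ)) , relabel-transports τ a {λ i j → Graph.adj (friendshipGraph (suc n)) (suc i) (suc j)} (lift₀ (lift₀ ρ)) (blocks ρ t)
  where
  τ : Permutation′ (suc n ℕ.* 2)
  τ = lift₀ (transpose k zero)
  b : Fin (suc n ℕ.* 2) → Fin (suc n ℕ.* 2) → Bool
  b = relabel τ a
  b-sym : ∀ i j → b i j ≡ b j i
  b-sym i j = a-sym (τ ⟨$⟩ʳ i) (τ ⟨$⟩ʳ j)
  b-irr : ∀ i → b i i ≡ false
  b-irr i = a-irr (τ ⟨$⟩ʳ i)
  b-row : ∀ i → sum (1ᵇ ∘ b i) ≡ 1ℤ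
  b-row i = trans (relabel-row τ a i) (row (τ ⟨$⟩ʳ i))
  b01 : b zero (suc zero) ≡ true
  b01 = 1ᵇ-true (trans (cong (λ x → 1ᵇ (a zero (suc x))) (transpose-right k zero)) (trans (h (suc k)) (δ-refl k)))
  b10 : b (suc zero) zero ≡ true
  b10 = trans (b-sym (suc zero) zero) b01
  rest : ∀ {x y} (f : Fin (n ℕ.* 2) → Bool) → 1ᵇ x + (1ᵇ y + sum (1ᵇ ∘ f)) ≡ 1ℤ → 1ᵇ x + 1ᵇ y ≡ 1ℤ → ∀ j → f j ≡ false
  rest {x} {y} f e xy j = 1ᵇ-false (sum-1ᵇ-0 f (+-cancelˡ 1ℤ (sum (1ᵇ ∘ f)) 0ℤ (trans (cong (_+ sum (1ᵇ ∘ f)) (sym xy))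
    (trans (ℤ.+-assoc (1ᵇ x) (1ᵇ y) (sum (1ᵇ ∘ f))) e))) j)
  b0j : ∀ j → b zero (suc (suc j)) ≡ false
  b0j = rest {b zero zero} {b zero (suc zero)} (λ j → b zero (suc (suc j))) (b-row zero) (cong₂ (λ x y → 1ᵇ x + 1ᵇ y) (b-irr zero) b01)
  b1j : ∀ j → b (suc zero) (suc (suc j)) ≡ false
  b1j = rest {b (suc zero) zero} {b (suc zero) (suc zero)} (λ j → b (suc zero) (suc (suc j))) (b-row (suc zero)) (cong₂ (λ x y → 1ᵇ x + 1ᵇ y) b10 (b-irr (suc zero)))
  c : Fin (n ℕ.* 2) → Fin (n ℕ.* 2) → Bool
  c i j = b (suc (suc i)) (suc (suc j))
  c-row : ∀ i → sum (1ᵇ ∘ c i) ≡ 1ℤ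
  c-row i = skip (trans (b-sym (suc (suc i)) zero) (b0j i)) (trans (b-sym (suc (suc i)) (suc zero)) (b1j i)) (b-row (suc (suc i)))
    where
    skip : ∀ {x y s} → x ≡ false → y ≡ false → 1ᵇ x + (1ᵇ y + s) ≡ 1ℤ → s ≡ 1ℤ
    skip {s = s} refl refl e = trans (sym (trans (ℤ.+-identityˡ (0ℤ + s)) (ℤ.+-identityˡ s))) e
  blocks : ∀ ρ → ρ Transports c To (λ i j → Graph.adj (friendshipGraph n) (suc i) (suc j)) →
    lift₀ (lift₀ ρ) Transports b To (λ i j → Graph.adj (friendshipGraph (suc n)) (suc i) (suc j))
  blocks ρ t zero          zero          = b-irr zero
  blocks ρ t zero          (suc zero)    = b01
  blocks ρ t zero          (suc (suc j)) = b0j j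
  blocks ρ t (suc zero)    zero          = b10
  blocks ρ t (suc zero)    (suc zero)    = b-irr (suc zero)
  blocks ρ t (suc zero)    (suc (suc j)) = b1j j
  blocks ρ t (suc (suc i)) zero          = trans (b-sym (suc (suc i)) zero) (b0j i)
  blocks ρ t (suc (suc i)) (suc zero)    = trans (b-sym (suc (suc i)) (suc zero)) (b1j i)
  -- Away from the first pair, adjacency in the larger friendship graph reduces by computation to
  -- adjacency in the smaller one.
  blocks ρ t (suc (suc i)) (suc (suc j)) = t i j

-- Once the hub is moved to position 0, removing it lowers every other degree from 2 to 1 and leaves
-- a perfect matching.
windmill-unique : ∀ {N} n (a : Fin N → Fin N → Bool) → N ≡ suc (n ℕ.* 2) →
  (∀ i j → a i j ≡ a j i) → (∀ i → a i i ≡ false) →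
  ∀ h → (∀ j → j ≢ h → a h j ≡ true) → (∀ j → j ≢ h → sum (1ᵇ ∘ a j) ≡ pos 2) →
  ∃ λ (ρ : Permutation N (suc (n ℕ.* 2))) → ρ Transports a To Graph.adj (friendshipGraph n)
windmill-unique n a refl a-sym a-irr h full row =
  let ρ , t = matching-unique n c (λ i j → b-sym (suc i) (suc j)) (λ i → b-irr (suc i)) c-row in
  (flip τ ∘ₚ lift₀ ρ) , relabel-transports τ a {Graph.adj (friendshipGraph n)} (lift₀ ρ) (blocks ρ t)
  where
  τ : Permutation′ (suc (n ℕ.* 2))
  τ = transpose h zero
  b : Fin (suc (n ℕ.* 2)) → Fin (suc (n ℕ.* 2)) → Bool
  b = relabel τ a
  b-sym : ∀ i j → b i j ≡ b j i
  b-sym i j = a-sym (τ ⟨$⟩ʳ i) (τ ⟨$⟩ʳ j)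
  b-irr : ∀ i → b i i ≡ false
  b-irr i = a-irr (τ ⟨$⟩ʳ i)
  τ0 : τ ⟨$⟩ʳ zero ≡ h
  τ0 = transpose-right h zero
  τs : ∀ j → τ ⟨$⟩ʳ suc j ≢ h
  τs j e = Fin.0≢1+n (trans (sym (inverseˡ τ)) (trans (cong (τ ⟨$⟩ˡ_) (trans τ0 (sym e))) (inverseˡ τ)))
  b0j : ∀ j → b zero (suc j) ≡ true
  b0j j = trans (cong (λ x → a x (τ ⟨$⟩ʳ suc j)) τ0) (full (τ ⟨$⟩ʳ suc j) (τs j))
  bj0 : ∀ j → b (suc j) zero ≡ true
  bj0 j = trans (b-sym (suc j) zero) (b0j j)
  c : Fin (n ℕ.* 2) → Fin (n ℕ.* 2) → Bool
  c i j = b (suc i) (suc j)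
  c-row : ∀ i → sum (1ᵇ ∘ c i) ≡ 1ℤ
  c-row i = +-cancelˡ 1ℤ (sum (1ᵇ ∘ c i)) 1ℤ (trans (cong (λ x → 1ᵇ x + sum (1ᵇ ∘ c i)) (sym (bj0 i)))
    (trans (relabel-row τ a (suc i)) (row (τ ⟨$⟩ʳ suc i) (τs i))))
  blocks : ∀ ρ → ρ Transports c To (λ i j → Graph.adj (friendshipGraph n) (suc i) (suc j)) →
    lift₀ ρ Transports b To Graph.adj (friendshipGraph n)
  blocks ρ t zero    zero    = b-irr zero
  blocks ρ t zero    (suc j) = b0j j
  blocks ρ t (suc i) zero    = bj0 i
  blocks ρ t (suc i) (suc j) = t i j

-- From a hub to the remaining degrees

module HubDegrees (G : Graph) (ν : ℤ) (like : FriendshipLike G ν) where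
  open Graph G
  open Spectral G
  open FriendshipLike like

  Windmill : Set
  Windmill = ∃ λ h → deg h ≡ pos 2 * ν × (∀ j → j ≢ h → deg j ≡ pos 2)

  excess : ∀ k → sum (λ j → deg j + - k) ≡ pos 6 * ν + (pos 2 * ν + 1ℤ) * - k
  excess k = trans (∑-distrib-+ deg (λ _ → - k)) (cong₂ _+_ degree-total
    (trans (sum-const order (- k)) (cong (_* - k) order-eq)))

  -- The sum of deg j - 2 over all vertices is 2ν - 2, and the hub alone accounts for it.
  windmill : (∀ j → 0≤ deg j - pos 2) → ∀ h → deg h ≡ pos 2 * ν → Windmill
  windmill deg≥2 h dh = h , dh , λ j j≢h → ℤ.i-j≡0⇒i≡j (deg j) (pos 2)
    (0≤-antisym (deg≥2 j) (subst 0≤_ (trans (cong₂ (λ s d → s - (d + - pos 2 + (deg j + - pos 2))) (excess (pos 2)) dh)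
      (eq ν (deg j))) (0≤-sum-without₂ (λ j → deg j - pos 2) deg≥2 (j≢h ∘ sym))))
    where
    eq : ∀ ν d → pos 6 * ν + (pos 2 * ν + 1ℤ) * - pos 2 - (pos 2 * ν + - pos 2 + (d + - pos 2)) ≡ - (d - pos 2)
    eq = solve-∀

  hub-adjacent : ∀ h → deg h ≡ pos 2 * ν → ∀ j → j ≢ h → adj h j ≡ true
  hub-adjacent h dh j j≢h = 1ᵇ-true (sym (ℤ.i-j≡0⇒i≡j 1ℤ (A h j) (trans (cong (λ d → 1ℤ - d - A h j) (sym (δ-≢ (j≢h ∘ sym))))
    (0≤-sum-0 (λ v → 1ℤ - δ h v - A h v) (non-neighbour h)
      (trans (sum-non-neighbours h) (trans (cong₂ (λ o d → o - 1ℤ - d) order-eq dh) (eq ν))) j))))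
    where
    eq : ∀ ν → pos 2 * ν + 1ℤ - 1ℤ - pos 2 * ν ≡ 0ℤ
    eq = solve-∀

  -- On three vertices the degree sum 6 is the maximum.
  triangle-case : ν ≡ 1ℤ → Windmill
  triangle-case refl = h , deg-2 h , λ j _ → deg-2 j
    where
    h : Vertex
    h = subst Fin (sym (ℤ.+-injective order-eq)) zero
    deg-2 : ∀ j → deg j ≡ pos 2
    deg-2 j = sym (ℤ.i-j≡0⇒i≡j (pos 2) (deg j) (trans (cong (λ o → o - 1ℤ - deg j) (sym order-eq))
      (0≤-sum-0 (λ j → pos order - 1ℤ - deg j) deg-bound total j)))
      where
      total : sum (λ j → pos order - 1ℤ - deg j) ≡ 0ℤ
      total = trans (sum-cong-≗ λ j → trans (cong (λ o → o - 1ℤ - deg j) order-eq) (eq (deg j)))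
        (trans (sym (*-distribˡ-sum -1ℤ λ j → deg j + - pos 2)) (cong (-1ℤ *_) (excess (pos 2))))
        where
        eq : ∀ d → pos 2 - d ≡ -1ℤ * (d + - pos 2)
        eq = solve-∀

friendship-like : ∀ G n → Cospectral G (friendshipGraph n) → FriendshipLike G (pos n)
friendship-like G n cosp = record { order-eq = order-eq ; degree-total = degree-total ; annihilated = annihilated }
  where open Cospectrality G n cosp

find-windmill : ∀ G n → n ≥ 1 → Connected G → (like : FriendshipLike G (pos n)) → HubDegrees.Windmill G (pos n) like
find-windmill G (suc zero)    _ conn like = HubDegrees.triangle-case G 1ℤ like refl
find-windmill G (suc (suc n)) _ conn like = HubDegrees.windmill G (pos (suc (suc n))) like C.deg≥2 (proj₁ C.hub) (proj₂ C.hub)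
  where module C = Combinatorics G (pos (suc (suc n))) like (ℤᵇ.+≤+ ℕ.z≤n) conn

corollary2p8 : (n : ℕ) → n ≥ 1 → (G : Graph) →
    Connected G → Planar G → Cospectral G (friendshipGraph n) →
    G ≅ friendshipGraph n
corollary2p8 n n≥1 G conn planar cosp = record { bijection = proj₁ iso ; preserves = proj₂ iso }
  where
  open Graph G
  like : FriendshipLike G (pos n)
  like = friendship-like G n cosp
  w : HubDegrees.Windmill G (pos n) like
  w = find-windmill G n n≥1 conn like
  iso : ∃ λ (ρ : Permutation order (suc (n ℕ.* 2))) → ρ Transports adj To Graph.adj (friendshipGraph n)
  iso = windmill-unique n adj (cospectral-order {G} {friendshipGraph n} cosp) symmetric irreflexive (proj₁ w)
    (HubDegrees.hub-adjacent G (pos n) like (proj₁ w) (proj₁ (proj₂ w))) (proj₂ (proj₂ w))
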